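{- Let $\mathcal V$ be a VAS of dimension $d$. Given $\vec f\in\mathbb N_\omega^d$, one can compute a basis of $\downarrow_{\vec f}\mathrm{Post}^*(\mathcal V)$.
   Context: A VAS of dimension $d$ is $\mathcal V=\langle A,\delta,\vec x_{in}\rangle$ with $A$ finite, $\delta:A\to\mathbb Z^d$, $\vec x_{in}\in\mathbb N^d$; $\vec x\xrightarrow{a}\vec y$ for $\vec x,\vec y\in\mathbb N^d$ iff $\vec y-\vec x=\delta(a)$, extended to words; $\mathrm{Post}^*(\mathcal V)=\{\vec y\in\mathbb N^d\mid\exists u\in A^*,\ \vec x_{in}\xrightarrow{u}\vec y\}$. $\mathbb N_\omega=\mathbb N\cup\{\omega\}$ with $n\le\omega$, ordered componentwise on $\mathbb N_\omega^d$; $\downarrow$ denotes downward closure in $\mathbb N_\omega^d$. For $\vec f\in\mathbb N_\omega^d$ and $\vec M\subseteq\mathbb N_\omega^d$: $\vec M|_{\vec f}=\{\vec x\in\vec M\mid \forall i,\ \vec f(i)<\omega\Rightarrow\vec x(i)=\vec f(i)\}$ and $\downarrow_{\vec f}\vec M=\downarrow(\vec M|_{\vec f})$. Convergence in $\mathbb N_\omega$: a sequence converges to $\ell$ if ultimately constant equal to $\ell$, or its integer subsequence is infinite and tends to infinity and $\ell=\omega$; componentwise in $\mathbb N_\omega^d$. $\mathrm{Lim}\,\vec M$ is the set of limits of sequences from $\vec M$. A basis of $\vec D\subseteq\mathbb N_\omega^d$ is a finite $\vec B\subseteq\mathbb N_\omega^d$ with $\mathrm{Lim}\,\vec D=\downarrow\vec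 B$. -}

module Defs where

open import Data.Nat using (ℕ; _≤_; _≥_)
open import Data.Integer using (ℤ; +_; _+_)
open import Data.Fin using (Fin)
open import Data.List using (List; []; _∷_)
open import Data.List.Membership.Propositional using (_∈_)
open import Data.Product using (Σ; ∃; _×_; _,_)
open import Data.Sum using (_⊎_)
open import Relation.Binary.PropositionalEquality using (_≡_)

data ℕω : Set where
  fin : ℕ → ℕω
  ω   : ℕω

data _≤ω_ : ℕω → ℕω → Set where
  fin≤fin : ∀ {m n} → m ≤ n → fin m ≤ω fin n
  ≤ω-top  : ∀ {x} → x ≤ω ω

Vecℕ : ℕ → Set
Vecℕ d = Fin d → ℕ

Vecω : ℕ → Set
Vecω d = Fin d → ℕω

Vecℤ : ℕ → Set
Vecℤ d = Fin d → ℤ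

_≤ᵛ_ : ∀ {d} → Vecω d → Vecω d → Set
x ≤ᵛ y = ∀ i → x i ≤ω y i

embed : ∀ {d} → Vecℕ d → Vecω d
embed x i = fin (x i)

Subset : ℕ → Set₁
Subset d = Vecω d → Set

-- A VAS ⟨A, δ, x_in⟩ of dimension d; the alphabet A is Fin k
record VAS (d : ℕ) : Set where
  field
    k     : ℕ
    δ     : Fin k → Vecℤ d
    x-in  : Vecℕ d

Step : ∀ {d} (V : VAS d) → Vecℕ d → Fin (VAS.k V) → Vecℕ d → Set
Step V x a y = ∀ i → + (y i) ≡ + (x i) + VAS.δ V a i

data Run {d} (V : VAS d) : Vecℕ d → List (Fin (VAS.k V)) → Vecℕ d → Set where
  run-[] : ∀ {x} → Run V x [] x
  run-∷  : ∀ {x y z a u} → Step V x a y → Run V y u z → Run V x (a ∷ u) z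

Post* : ∀ {d} → VAS d → Subset d
Post* V z = Σ (Vecℕ _) λ y → (Σ (List (Fin (VAS.k V))) λ u → Run V (VAS.x-in V) u y) × (z ≡ embed y)
  where open VAS V

↓ : ∀ {d} → Subset d → Subset d
↓ M x = Σ (Vecω _) λ y → M y × (x ≤ᵛ y)

restrict : ∀ {d} → Subset d → Vecω d → Subset d
restrict M f x = M x × (∀ i n → f i ≡ fin n → x i ≡ fin n)

↓[_] : ∀ {d} → Vecω d → Subset d → Subset d
↓[ f ] M = ↓ (restrict M f)

IsFin : ℕω → Set
IsFin x = Σ ℕ λ n → x ≡ fin n

ConvergesTo : (ℕ → ℕω) → ℕω → Set
ConvergesTo s ℓ =
  (Σ ℕ λ N → ∀ n → n ≥ N → s n ≡ ℓ)
  ⊎ ( (∀ N → Σ ℕ λ n → (n ≥ N) × IsFin (s n))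
    × (∀ m → Σ ℕ λ N → ∀ n k → n ≥ N → s n ≡ fin k → m ≤ k)
    × (ℓ ≡ ω))

ConvergesToᵛ : ∀ {d} → (ℕ → Vecω d) → Vecω d → Set
ConvergesToᵛ s ℓ = ∀ i → ConvergesTo (λ n → s n i) (ℓ i)

Lim : ∀ {d} → Subset d → Subset d
Lim M ℓ = Σ (ℕ → Vecω _) λ s → (∀ n → M (s n)) × ConvergesToᵛ s ℓ

⟦_⟧ : ∀ {d} → List (Vecω d) → Subset d
⟦ B ⟧ x = x ∈ B

IsBasis : ∀ {d} → List (Vecω d) → Subset d → Set
IsBasis B D = ∀ x → (Lim D x → ↓ ⟦ B ⟧ x) × (↓ ⟦ B ⟧ x → Lim D x)

{-# OPTIONS --safe #-}

-- For finite f a basis decides whether f is reachable, so the proof is a decomposition in the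
-- style of Kosaraju, Mayr and Lambert.  Runs are confined to sequences of single steps and
-- control graphs, where a state of a graph stores the values of the counters that are not free.
-- The edges used by the walks of a graph form a semilinear set (Parikh) whose periods are cycles
-- attached to a base walk.  With the counter values at the junctions as further unknowns, the
-- runs of a sequence solve a linear system, and on each linear set of solutions every unknown is
-- constant or unbounded.  An edge on no unbounded cycle occurs a constant number of times, and
-- the graph is cut at it.  Otherwise either a closed walk u at the entry increases all free
-- counters with constant entry value, or, by Rackoff's argument, each run keeps one of them below
-- a fixed bound, and that counter is moved into the states; likewise backwards with a closed walk
-- v at the exit.  Both refinements decrease (number of free counters, number of edges) at the
-- refined item.  When none applies, a loop ℓ compensates u and v up to a multiple of the periods,
-- and the runs uⁿ ℓⁿ W vⁿ show that the exit values of the linear set, with ω for the unbounded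
-- ones, are limits of reachable vectors.
module Submission where

open import Defs
open import Data.Empty using (⊥-elim)
open import Data.Unit using (⊤; tt)
open import Data.Fin using (Fin; zero; suc; punchIn; punchOut)
import Data.Fin.Properties as Finₚ
open import Data.Fin.Properties using (any?; all?; punchIn-punchOut)
open import Data.Integer using (ℤ; +_; -[1+_]; _+_; _*_; -_; _-_; 0ℤ; 1ℤ; +≤+; ∣_∣)
import Data.Integer as ℤ
import Data.Integer.Properties as ℤₚ
open import Data.Integer.Tactic.RingSolver using (solve-∀)
open import Data.List using (List; []; _∷_; _++_; [_]; concat; map; length; filter; replicate; upTo; allFin; concatMap; reverse; cartesianProduct; lookup)
open import Data.List.Membership.Propositional using (_∈_; _∉_; find)
open import Data.List.Membership.Propositional.Properties
open import Data.List.Relation.Binary.Subset.Propositional using (_⊆_)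
import Data.List.Relation.Binary.Subset.Propositional.Properties as Subsetₚ
open import Data.List.Relation.Unary.Any using (Any; here; there)
import Data.List.Relation.Unary.Any as Any
import Data.List.Relation.Unary.Any.Properties as Anyₚ
import Data.List.Properties as Listₚ
open import Data.Nat using (ℕ; zero; suc; _≤_; _<_; _≥_; z≤n; s≤s)
import Data.Nat as ℕ
import Data.Nat.Properties as ℕₚ
open import Data.Product using (Σ; ∃; ∃₂; _×_; _,_; proj₁; proj₂)
open import Data.Product.Properties using (≡-dec)
open import Data.Sum using (_⊎_; inj₁; inj₂; [_,_]′)
open import Data.Vec using (Vec; _[_]≔_; tabulate)
import Data.Vec as Vec
import Data.Vec.Properties as Vecₚ
open import Function using (_∘_; id; case_of_)
open import Induction.WellFounded using (Acc; acc; WellFounded)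
open import Data.Nat.Induction using (<-wellFounded)
open import Relation.Binary using (DecidableEquality)
open import Relation.Binary.PropositionalEquality using (_≡_; _≢_; refl; sym; trans; cong; cong₂; subst; module ≡-Reasoning)
open import Relation.Nullary using (¬_; Dec; yes; no; contradiction)
open import Relation.Nullary.Decidable using (¬?; _×-dec_; map′)

-- Solutions of the linear system fix the counters only at the junctions and ignore nonnegativity
-- inside the items, so they need not come from runs; the refinements exist to close this gap. Each
-- linear set of solutions is condensed to a particular solution `b` and the sum `H` of its periods:
-- a nonnegative weight that vanishes on `H` is constant on the set. The runs built at the end have
-- junction values `b + n K H`. Since `u` and `v` belong to no solution, `K` copies of `H` must
-- contain them along with their ways back, and this yields `ℓ` for all large `K`. Taking powers
-- block by block turns each value at a loop boundary into a combination of quantities at least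
-- linear in `n`, so for large `n` dips inside one loop are harmless; for a free counter the safety
-- of `u` or `v` itself matters only where `H` is zero at the entry or the exit. Strong connectivity
-- is not assumed: it results from every edge lying on a cycle of `H`. The initial vector and the
-- finite coordinates of `f` enter as equations on the first entry and the last exit.

∑ : {A : Set} → (A → ℤ) → List A → ℤ
∑ w []       = 0ℤ
∑ w (x ∷ xs) = w x + ∑ w xs

-- Multisets as lists compared by integer weights

module _ {A : Set} where

  ∑-++ : (w : A → ℤ) (xs ys : List A) → ∑ w (xs ++ ys) ≡ ∑ w xs + ∑ w ys
  ∑-++ w []       ys = sym (ℤₚ.+-identityˡ _)
  ∑-++ w (x ∷ xs) ys = trans (cong (_+_ (w x)) (∑-++ w xs ys)) (sym (ℤₚ.+-assoc (w x) _ _))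

  ∑-concat : (w : A → ℤ) (xss : List (List A)) → ∑ w (concat xss) ≡ ∑ (∑ w) xss
  ∑-concat w []         = refl
  ∑-concat w (xs ∷ xss) = trans (∑-++ w xs (concat xss)) (cong (_+_ (∑ w xs)) (∑-concat w xss))

  ∑-cong : {v w : A → ℤ} → (∀ x → v x ≡ w x) → ∀ xs → ∑ v xs ≡ ∑ w xs
  ∑-cong e []       = refl
  ∑-cong e (x ∷ xs) = cong₂ _+_ (e x) (∑-cong e xs)

  ∑-zero : {w : A → ℤ} (xs : List A) → (∀ {x} → x ∈ xs → w x ≡ 0ℤ) → ∑ w xs ≡ 0ℤ
  ∑-zero []       e = refl
  ∑-zero (x ∷ xs) e = cong₂ _+_ (e (here refl)) (∑-zero xs (e ∘ there))

  ∑-neg : (w : A → ℤ) (xs : List A) → ∑ (-_ ∘ w) xs ≡ - ∑ w xs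
  ∑-neg w []       = refl
  ∑-neg w (x ∷ xs) = trans (cong (_+_ (- w x)) (∑-neg w xs)) (sym (ℤₚ.neg-distrib-+ (w x) _))

  ∑-diff : (v w : A → ℤ) (xs : List A) → ∑ (λ x → v x - w x) xs ≡ ∑ v xs - ∑ w xs
  ∑-diff v w []       = refl
  ∑-diff v w (x ∷ xs) = trans (cong (_+_ (v x - w x)) (∑-diff v w xs)) (r (v x) (w x) (∑ v xs) (∑ w xs))
    where r : ∀ a b c d → a - b + (c - d) ≡ a + c - (b + d)
          r = solve-∀

  times : ℕ → List A → List A
  times zero    xs = []
  times (suc n) xs = xs ++ times n xs

  ∑-times : (w : A → ℤ) (n : ℕ) (xs : List A) → ∑ w (times n xs) ≡ + n * ∑ w xs
  ∑-times w zero    xs = refl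
  ∑-times w (suc n) xs = trans (∑-++ w xs _) (trans (cong (_+_ (∑ w xs)) (∑-times w n xs)) (r (+ n) (∑ w xs)))
    where r : ∀ n s → s + n * s ≡ (1ℤ + n) * s
          r = solve-∀

  times-⊆ : ∀ n {xs ys : List A} → xs ⊆ ys → times n xs ⊆ ys
  times-⊆ (suc n) {xs} s m with ∈-++⁻ xs m
  ... | inj₁ m′ = s m′
  ... | inj₂ m′ = times-⊆ n s m′

  ++-⊆ : ∀ {xs ys zs : List A} → xs ⊆ zs → ys ⊆ zs → xs ++ ys ⊆ zs
  ++-⊆ {xs} p q m = [ p , q ]′ (∈-++⁻ xs m)

  infix 4 _≈_

  -- Equality in the free commutative monoid: all additive weights agree.
  record _≈_ (xs ys : List A) : Set where
    constructor mk≈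
    field at : ∀ w → ∑ w xs ≡ ∑ w ys
  open _≈_ public

  ≈-refl : ∀ {xs} → xs ≈ xs
  at ≈-refl w = refl

  ≈-sym : ∀ {xs ys} → xs ≈ ys → ys ≈ xs
  at (≈-sym e) w = sym (at e w)

  ≈-trans : ∀ {xs ys zs} → xs ≈ ys → ys ≈ zs → xs ≈ zs
  at (≈-trans e f) w = trans (at e w) (at f w)

  ≡⇒≈ : ∀ {xs ys} → xs ≡ ys → xs ≈ ys
  ≡⇒≈ refl = ≈-refl

  ++-cong : ∀ {xs xs′ ys ys′} → xs ≈ xs′ → ys ≈ ys′ → xs ++ ys ≈ xs′ ++ ys′
  at (++-cong {xs} {xs′} {ys} {ys′} e f) w =
    trans (∑-++ w xs ys) (trans (cong₂ _+_ (at e w) (at f w)) (sym (∑-++ w xs′ ys′)))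

  ++-comm : ∀ xs ys → xs ++ ys ≈ ys ++ xs
  at (++-comm xs ys) w = trans (∑-++ w xs ys) (trans (ℤₚ.+-comm (∑ w xs) _) (sym (∑-++ w ys xs)))

-- Linear sets and finite covers

record LinearSet (A : Set) : Set where
  constructor _+⟨_⟩*
  field
    base    : List A
    periods : List (List A)
open LinearSet public

infix 4 _∈ᴸ_

_∈ᴸ_ : {A : Set} → List A → LinearSet A → Set
xs ∈ᴸ L = ∃ λ pss → pss ⊆ periods L × xs ≈ base L ++ concat pss

∈ᴸ-resp : {A : Set} {xs ys : List A} {L : LinearSet A} → xs ≈ ys → xs ∈ᴸ L → ys ∈ᴸ L
∈ᴸ-resp e (pss , s , f) = pss , s , ≈-trans (≈-sym e) f

-- Every finite decomposition of the proof has this shape: a computed list whose members are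
-- certified by `Q`, while `P` is a proposition that is never decided. For the outputs, `Q` is the
-- soundness of a basis element and `R` the completeness of the list.
record FinCover {X B : Set} (R : X → B → Set) (Q : B → Set) (P : X → Set) : Set where
  constructor mkCover
  field
    elems  : List B
    good   : ∀ {b} → b ∈ elems → Q b
    covers : ∀ x → P x → Σ B λ b → b ∈ elems × R x b
open FinCover public

module _ {X B : Set} {R : X → B → Set} {Q : B → Set} where

  cover-none : {P : X → Set} → (∀ x → ¬ P x) → FinCover R Q P
  cover-none ¬P = mkCover [] (λ ()) (λ x px → ⊥-elim (¬P x px))

  cover-one : {P : X → Set} (b : B) → Q b → (∀ x → P x → R x b) → FinCover R Q P
  cover-one b q r = mkCover [ b ] (λ { (here refl) → q }) (λ x px → b , here refl , r x px)

  cover-⊆ : {P P′ : X → Set} → (∀ x → P x → P′ x) → FinCover R Q P′ → FinCover R Q P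
  cover-⊆ i c = mkCover (elems c) (good c) (λ x px → covers c x (i x px))

  cover-∪ : {P P₁ P₂ : X → Set} → FinCover R Q P₁ → FinCover R Q P₂ →
            (∀ x → P x → P₁ x ⊎ P₂ x) → FinCover R Q P
  cover-∪ c₁ c₂ i = mkCover (elems c₁ ++ elems c₂)
    (λ m → [ good c₁ , good c₂ ]′ (∈-++⁻ (elems c₁) m))
    λ x px → case i x px of λ where
      (inj₁ p) → let b , m , r = covers c₁ x p in b , ∈-++⁺ˡ m , r
      (inj₂ p) → let b , m , r = covers c₂ x p in b , ∈-++⁺ʳ (elems c₁) m , r

  cover-⋃ : {I : Set} {P : X → Set} {S : I → X → Set} (is : List I) →
            (∀ {i} → i ∈ is → FinCover R Q (S i)) →
            (∀ x → P x → ∃ λ i → i ∈ is × S i x) → FinCover R Q P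
  cover-⋃ []       c i = cover-none (λ x px → case i x px of λ { (_ , () , _) })
  cover-⋃ {I} {P} {S} (k ∷ is) c i =
    cover-∪ (c (here refl)) (cover-⋃ {P = λ x → ∃ λ i → i ∈ is × S i x} is (c ∘ there) (λ _ → id))
      λ x px → case i x px of λ where
        (_ , here refl , s) → inj₁ s
        (j , there m , s)   → inj₂ (j , m , s)

cover-bind : {X B C : Set} {R : X → B → Set} {Q : B → Set} {R′ : X → C → Set} {Q′ : C → Set} {P : X → Set} →
             FinCover R Q P → (∀ b → Q b → FinCover R′ Q′ (λ x → P x × R x b)) → FinCover R′ Q′ P
cover-bind c f = cover-⋃ (elems c) (λ {b} m → f b (good c m))
  λ x px → let b , m , r = covers c x px in b , m , px , r

-- Linear equations over linear sets

module _ {A : Set} where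

  at-concat : {x : List A} (c : List A) (pss : List (List A)) → x ≈ c ++ concat pss →
              ∀ u → ∑ u x ≡ ∑ u c + ∑ (∑ u) pss
  at-concat c pss e u = trans (at e u) (trans (∑-++ u c _) (cong (_+_ (∑ u c)) (∑-concat u pss)))

  concat-at : {x : List A} (c : List A) (pss : List (List A)) → (∀ u → ∑ u x ≡ ∑ u c + ∑ (∑ u) pss) →
              x ≈ c ++ concat pss
  concat-at c pss e =
    mk≈ λ u → trans (e u) (sym (trans (∑-++ u c _) (cong (_+_ (∑ u c)) (∑-concat u pss))))

  -- Copies of `p` are recognised by their position in the membership proof, which avoids deciding
  -- equality on `A`; a list equal to `p` that is found in `R` stays there.
  collect : (p : List A) {R : List (List A)} (pss : List (List A)) → pss ⊆ p ∷ R →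
            ∃₂ λ n rss → rss ⊆ R × (∀ u → ∑ (∑ u) pss ≡ + n * ∑ u p + ∑ (∑ u) rss)
  collect p []         s = 0 , [] , (λ ()) , λ _ → refl
  collect p (q ∷ pss)  s with collect p pss (s ∘ there) | s (here refl)
  ... | n , rss , t , e | here refl = suc n , rss , t , λ u →
        trans (cong (_+_ (∑ u p)) (e u)) (r (+ n) (∑ u p) (∑ (∑ u) rss))
    where r : ∀ n a b → a + (n * a + b) ≡ (1ℤ + n) * a + b
          r = solve-∀
  ... | n , rss , t , e | there m   = n , q ∷ rss , (λ { (here refl) → m ; (there k) → t k }) , λ u →
        trans (cong (_+_ (∑ u q)) (e u)) (r (+ n * ∑ u p) (∑ u q) (∑ (∑ u) rss))
    where r : ∀ n a b → a + (n + b) ≡ n + (a + b)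
          r = solve-∀

  ∑-nonneg : (w : A → ℤ) (xs : List A) → (∀ {x} → x ∈ xs → 0ℤ ℤ.≤ w x) → 0ℤ ℤ.≤ ∑ w xs
  ∑-nonneg w []       h = ℤₚ.≤-refl
  ∑-nonneg w (x ∷ xs) h = ℤₚ.+-mono-≤ (h (here refl)) (∑-nonneg w xs (h ∘ there))

-- Division of two counts in lockstep, stopped once one of them is smaller than its block. Here `i`
-- and `j` will be the multiplicities of a positive and a negative period, and `t` that of their
-- null combination. The recursion runs on `fuel`, since `i` only shrinks by truncated subtraction.
common-multiples : ∀ K L fuel i j → i ≤ fuel →
  Σ ℕ λ t → Σ ℕ λ i′ → Σ ℕ λ j′ →
    i ≡ t ℕ.* suc K ℕ.+ i′ × j ≡ t ℕ.* suc L ℕ.+ j′ × (i′ < suc K ⊎ j′ < suc L)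
common-multiples K L fuel i j le with i ℕ.<? suc K | j ℕ.<? suc L
... | yes p | _     = 0 , i , j , refl , refl , inj₁ p
... | no _  | yes q = 0 , i , j , refl , refl , inj₂ q
common-multiples K L zero zero j z≤n | no p | no q = contradiction (s≤s z≤n) p
common-multiples K L (suc fuel) i j le | no p | no q =
  let K<i = ℕₚ.≮⇒≥ p
      L<j = ℕₚ.≮⇒≥ q
      t , i′ , j′ , e , f , h = common-multiples K L fuel (i ℕ.∸ suc K) (j ℕ.∸ suc L)
        (ℕₚ.≤-trans (ℕₚ.∸-monoʳ-≤ i (s≤s (z≤n {K}))) (ℕₚ.∸-monoˡ-≤ 1 le))
      back = λ {k} {n} {n′} (le : suc k ≤ n) (e : n ℕ.∸ suc k ≡ t ℕ.* suc k ℕ.+ n′) →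
        trans (sym (ℕₚ.m+[n∸m]≡n le)) (trans (cong (ℕ._+_ (suc k)) e) (sym (ℕₚ.+-assoc (suc k) (t ℕ.* suc k) n′)))
  in suc t , i′ , j′ , back K<i e , back L<j f , h

-- Solutions of one linear equation ∑ w x ≡ v inside a linear set.  A period p of positive
-- weight and a period n of negative weight combine to a period h of weight zero; after
-- splitting off copies of h, the multiplicity of p or that of n is bounded.
module Equation {A : Set} (w : A → ℤ) (v : ℤ)
                (B D : List A → Set)
                (B-++ : ∀ {c p} → B c → D p → B (c ++ p))
                (D-++ : ∀ {p q} → D p → D q → D (p ++ q))
                (D-[] : D []) where

  -- `B` and `D` are invariants of bases and periods, stable under the additions made during the
  -- elimination. For a system they hold the equations solved before.
  Solution : LinearSet A → Set
  Solution L = (B (base L) × ∑ w (base L) ≡ v) × (∀ {p} → p ∈ periods L → D p × ∑ w p ≡ 0ℤ)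

  private
    Solves : LinearSet A → List A → Set
    Solves L x = x ∈ᴸ L × ∑ w x ≡ v

    Cover : (List A → Set) → Set
    Cover = FinCover _∈ᴸ_ Solution

    Positive Negative Null : List (List A) → Set
    Positive Ps = ∀ {p} → p ∈ Ps → D p × ∃ λ m → ∑ w p ≡ + suc m
    Negative Ns = ∀ {n} → n ∈ Ns → D n × ∃ λ m → ∑ w n ≡ -[1+ m ]
    Null     Zs = ∀ {z} → z ∈ Zs → D z × ∑ w z ≡ 0ℤ

    D-times : ∀ k {p} → D p → D (times k p)
    D-times zero    d = D-[]
    D-times (suc k) d = D-++ d (D-times k d)

    -- Every remaining period has nonnegative `u`-weight and each copy of `p` adds at least one, so
    -- `k` cannot exceed the gap between the required weight and that of the base. Negative periods
    -- are treated with the weight `-_ ∘ w`.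
    multiplicity-bound : (u : A → ℤ) (t : ℤ) {x c p : List A} {rss : List (List A)} {m k : ℕ} →
      ∑ u x ≡ t → ∑ u x ≡ ∑ u c + (+ k * ∑ u p + ∑ (∑ u) rss) → ∑ u p ≡ + suc m →
      (∀ {r} → r ∈ rss → 0ℤ ℤ.≤ ∑ u r) → k ∈ upTo (suc ∣ t - ∑ u c ∣)
    multiplicity-bound u t {x} {c} {p} {rss} {m} {k} e f g nn = ∈-upTo⁺ (s≤s (ℤₚ.drop‿+≤+ (begin
      + k                                       ≤⟨ +≤+ (ℕₚ.m≤m*n k (suc m)) ⟩
      + (k ℕ.* suc m)                           ≡⟨ ℤₚ.pos-* k (suc m) ⟩
      + k * + suc m                             ≡⟨ sym (ℤₚ.+-identityʳ _) ⟩
      + k * + suc m + 0ℤ                        ≤⟨ ℤₚ.+-monoʳ-≤ (+ k * + suc m) (∑-nonneg (∑ u) rss nn) ⟩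
      + k * + suc m + ∑ (∑ u) rss               ≡⟨ cong (λ s → + k * s + ∑ (∑ u) rss) (sym g) ⟩
      + k * ∑ u p + ∑ (∑ u) rss                 ≡⟨ r (∑ u c) (+ k * ∑ u p + ∑ (∑ u) rss) ⟩
      ∑ u c + (+ k * ∑ u p + ∑ (∑ u) rss) - ∑ u c  ≡⟨ cong (_- ∑ u c) (trans (sym f) e) ⟩
      t - ∑ u c                                 ≤⟨ ≤∣∣ (t - ∑ u c) ⟩
      + ∣ t - ∑ u c ∣ ∎)))
      where
        open ℤₚ.≤-Reasoning
        r : ∀ a b → b ≡ a + b - a
        r = solve-∀
        ≤∣∣ : ∀ i → i ℤ.≤ + ∣ i ∣
        ≤∣∣ (+ n)    = ℤₚ.≤-refl
        ≤∣∣ -[1+ n ] = ℤ.-≤+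

    absorb : ∀ {x} (c p : List A) (rss : List (List A)) (k : ℕ) →
      (∀ u → ∑ u x ≡ ∑ u c + (+ k * ∑ u p + ∑ (∑ u) rss)) →
      x ≈ (c ++ times k p) ++ concat rss
    absorb c p rss k e = concat-at (c ++ times k p) rss λ u → trans (e u)
      (trans (sym (ℤₚ.+-assoc (∑ u c) _ _))
             (cong (_+ ∑ (∑ u) rss) (sym (trans (∑-++ u c _) (cong (_+_ (∑ u c)) (∑-times u k p))))))

    sandwich : ∀ (Z Ps Ns : List (List A)) {p n} → Z ++ (p ∷ Ps) ++ (n ∷ Ns) ⊆ p ∷ n ∷ Z ++ Ps ++ Ns
    sandwich Z Ps Ns {p} {n} m with ∈-++⁻ Z m
    ... | inj₁ k = there (there (∈-++⁺ˡ k))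
    ... | inj₂ (here e) = here e
    ... | inj₂ (there k) with ∈-++⁻ Ps k
    ... | inj₁ l = there (there (∈-++⁺ʳ Z (∈-++⁺ˡ l)))
    ... | inj₂ (here e) = there (here e)
    ... | inj₂ (there l) = there (there (∈-++⁺ʳ Z (∈-++⁺ʳ Ps l)))

    bring : ∀ (Z Ps : List (List A)) {p} → Z ++ p ∷ Ps ⊆ p ∷ Z ++ Ps
    bring Z Ps m with ∈-++⁻ Z m
    ... | inj₁ k = there (∈-++⁺ˡ k)
    ... | inj₂ (here e) = here e
    ... | inj₂ (there k) = there (∈-++⁺ʳ Z k)

    nonneg₊ : ∀ {z m} → z ≡ + suc m → 0ℤ ℤ.≤ z
    nonneg₊ refl = +≤+ z≤n

    nonneg₋ : ∀ {z m} → z ≡ -[1+ m ] → 0ℤ ℤ.≤ - z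
    nonneg₋ refl = +≤+ z≤n

  -- Each call drops a period from `Ps` or `Ns`. If all nonzero periods have one sign, the
  -- multiplicity of the head is bounded and its copies are absorbed into the base. With both signs,
  -- splitting off `h` leaves a bounded remainder for one of the two heads, but which one depends on
  -- the solution; hence a union of two covers.
  eliminate : ∀ c Z Ps Ns → B c → Null Z → Positive Ps → Negative Ns →
              Cover (Solves (c +⟨ Z ++ Ps ++ Ns ⟩*))
  eliminate c Z [] [] bc hZ hP hN with ∑ w c ℤₚ.≟ v
  ... | yes e = cover-one (c +⟨ Z ⟩*) ((bc , e) , hZ)
                  λ { x ((pss , s , f) , _) → pss , subst (pss ⊆_) (Listₚ.++-identityʳ Z) s , f }
  ... | no ≢v = cover-none λ { x ((pss , s , f) , e) → ≢v (begin
        ∑ w c                    ≡⟨ sym (ℤₚ.+-identityʳ _) ⟩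
        ∑ w c + 0ℤ               ≡⟨ cong (_+_ (∑ w c)) (sym (∑-zero pss λ m →
                                      proj₂ (hZ (subst (_ ∈_) (Listₚ.++-identityʳ Z) (s m))))) ⟩
        ∑ w c + ∑ (∑ w) pss      ≡⟨ sym (at-concat c pss f w) ⟩
        ∑ w x                    ≡⟨ e ⟩
        v ∎) }
    where open ≡-Reasoning
  eliminate c Z (p ∷ Ps) [] bc hZ hP hN =
    cover-⋃ {S = λ k → Solves ((c ++ times k p) +⟨ Z ++ Ps ++ [] ⟩*)} (upTo (suc ∣ v - ∑ w c ∣))
      (λ {k} _ → eliminate (c ++ times k p) Z Ps [] (B-++ bc (D-times k (proj₁ (hP (here refl))))) hZ (hP ∘ there) hN)
      λ { x ((pss , s , f) , e) →
        let k , rss , t , g = collect p pss (bring Z (Ps ++ []) ∘ s)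
            h = λ u → trans (at-concat c pss f u) (cong (_+_ (∑ u c)) (g u))
        in k , multiplicity-bound w v {x} {c} {p} {rss} e (h w) (proj₂ (proj₂ (hP (here refl)))) (nn ∘ t)
             , (rss , t , absorb c p rss k h) , e }
    where
      nn : ∀ {r} → r ∈ Z ++ Ps ++ [] → 0ℤ ℤ.≤ ∑ w r
      nn m with ∈-++⁻ Z m
      ... | inj₁ k = ℤₚ.≤-reflexive (sym (proj₂ (hZ k)))
      ... | inj₂ k with ∈-++⁻ Ps k
      ... | inj₁ l = nonneg₊ (proj₂ (proj₂ (hP (there l))))
  eliminate c Z [] (n ∷ Ns) bc hZ hP hN =
    cover-⋃ {S = λ k → Solves ((c ++ times k n) +⟨ Z ++ Ns ⟩*)} (upTo (suc ∣ - v - ∑ (-_ ∘ w) c ∣))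
      (λ {k} _ → eliminate (c ++ times k n) Z [] Ns (B-++ bc (D-times k (proj₁ (hN (here refl))))) hZ hP (hN ∘ there))
      λ { x ((pss , s , f) , e) →
        let k , rss , t , g = collect n pss (bring Z Ns ∘ s)
            h = λ u → trans (at-concat c pss f u) (cong (_+_ (∑ u c)) (g u))
        in k , multiplicity-bound (-_ ∘ w) (- v) {x} {c} {n} {rss} (trans (∑-neg w x) (cong -_ e)) (h (-_ ∘ w))
                 (trans (∑-neg w n) (cong -_ (proj₂ (proj₂ (hN (here refl)))))) (nn ∘ t)
             , (rss , t , absorb c n rss k h) , e }
    where
      nn : ∀ {r} → r ∈ Z ++ Ns → 0ℤ ℤ.≤ ∑ (-_ ∘ w) r
      nn {r} m with ∈-++⁻ Z m
      ... | inj₁ k = ℤₚ.≤-reflexive (sym (trans (∑-neg w r) (cong -_ (proj₂ (hZ k)))))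
      ... | inj₂ k = subst (0ℤ ℤ.≤_) (sym (∑-neg w r)) (nonneg₋ (proj₂ (proj₂ (hN (there k)))))
  eliminate c Z (p ∷ Ps) (n ∷ Ns) bc hZ hP hN =
    cover-∪
      (cover-⋃ {P = λ x → ∃ λ k → k ∈ upTo (suc b) × Solves₁ k x} (upTo (suc b))
         (λ {k} _ → eliminate (c ++ times k p) (h ∷ Z) Ps (n ∷ Ns) (B-++ bc (D-times k (proj₁ (hP (here refl))))) hZ′ (hP ∘ there) hN)
         (λ _ → id))
      (cover-⋃ {P = λ x → ∃ λ k → k ∈ upTo (suc a) × Solves₂ k x} (upTo (suc a))
         (λ {k} _ → eliminate (c ++ times k n) (h ∷ Z) (p ∷ Ps) Ns (B-++ bc (D-times k (proj₁ (hN (here refl))))) hZ′ hP (hN ∘ there))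
         (λ _ → id))
      split
    where
      -- `p` weighs `suc a` and `n` weighs `- suc b`, so `suc b` copies of `p` cancel `suc a` copies
      -- of `n`.
      a b : ℕ
      a = proj₁ (proj₂ (hP (here refl)))
      b = proj₁ (proj₂ (hN (here refl)))
      h : List A
      h = times (suc b) p ++ times (suc a) n
      ∑-h : ∀ u → ∑ u h ≡ + suc b * ∑ u p + + suc a * ∑ u n
      ∑-h u = trans (∑-++ u (times (suc b) p) _) (cong₂ _+_ (∑-times u (suc b) p) (∑-times u (suc a) n))
      hZ′ : Null (h ∷ Z)
      hZ′ (there m)   = hZ m
      hZ′ (here refl) = D-++ (D-times (suc b) (proj₁ (hP (here refl)))) (D-times (suc a) (proj₁ (hN (here refl)))) ,
        trans (∑-h w) (trans (cong₂ (λ s t → + suc b * s + + suc a * t) (proj₂ (proj₂ (hP (here refl)))) (proj₂ (proj₂ (hN (here refl)))))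
                             (r (+ suc a) (+ suc b)))
        where r : ∀ a b → b * a + a * (- b) ≡ 0ℤ
              r = solve-∀
      Solves₁ Solves₂ : ℕ → List A → Set
      Solves₁ k = Solves ((c ++ times k p) +⟨ (h ∷ Z) ++ Ps ++ (n ∷ Ns) ⟩*)
      Solves₂ k = Solves ((c ++ times k n) +⟨ (h ∷ Z) ++ (p ∷ Ps) ++ Ns ⟩*)
      copies-⊆ : ∀ k {q : List A} {Q} → q ∈ Q → times k [ q ] ⊆ Q
      copies-⊆ k m = times-⊆ k λ { (here refl) → m }
      ∑-copies : ∀ u k (q : List A) → ∑ (∑ u) (times k [ q ]) ≡ + k * ∑ u q
      ∑-copies u k q = trans (∑-times (∑ u) k [ q ]) (cong (+ k *_) (ℤₚ.+-identityʳ _))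
      Z∪ : ∀ {Ps′ Ns′} → Ps ⊆ Ps′ → Ns ⊆ Ns′ → Z ++ Ps ++ Ns ⊆ (h ∷ Z) ++ Ps′ ++ Ns′
      Z∪ {Ps′} f g m with ∈-++⁻ Z m
      ... | inj₁ k = there (∈-++⁺ˡ k)
      ... | inj₂ k with ∈-++⁻ Ps k
      ... | inj₁ l = there (∈-++⁺ʳ Z (∈-++⁺ˡ (f l)))
      ... | inj₂ l = there (∈-++⁺ʳ Z (∈-++⁺ʳ Ps′ (g l)))
      pos-lin : ∀ t k m → + (t ℕ.* k ℕ.+ m) ≡ + t * + k + + m
      pos-lin t k m = trans (ℤₚ.pos-+ (t ℕ.* k) m) (cong (_+ + m) (ℤₚ.pos-* t k))
      split : ∀ x → Solves (c +⟨ Z ++ (p ∷ Ps) ++ (n ∷ Ns) ⟩*) x →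
              (∃ λ k → k ∈ upTo (suc b) × Solves₁ k x) ⊎ (∃ λ k → k ∈ upTo (suc a) × Solves₂ k x)
      split x ((pss , s , f) , e) with collect p pss (sandwich Z Ps Ns ∘ s)
      ... | i , qss , s₁ , f₁ with collect n qss s₁
      ... | j , rss , s₂ , f₂ with common-multiples b a i i j ℕₚ.≤-refl
      ... | t , i′ , j′ , refl , refl , lt = choose lt
        where
          expand : ∀ u k q → ∑ (∑ u) (times t [ h ] ++ times k [ q ] ++ rss) ≡
                   + t * ∑ u h + (+ k * ∑ u q + ∑ (∑ u) rss)
          expand u k q = trans (∑-++ (∑ u) (times t [ h ]) _)
            (cong₂ _+_ (∑-copies u t h) (trans (∑-++ (∑ u) (times k [ q ]) rss) (cong (_+ ∑ (∑ u) rss) (∑-copies u k q))))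
          r₀ : ∀ c t a b i′ j′ p n z → c + ((t * b + i′) * p + ((t * a + j′) * n + z)) ≡
                 c + (t * (b * p + a * n) + (i′ * p + (j′ * n + z)))
          r₀ = solve-∀
          total : ∀ u → ∑ u x ≡ ∑ u c + (+ t * ∑ u h + (+ i′ * ∑ u p + (+ j′ * ∑ u n + ∑ (∑ u) rss)))
          total u = begin
            ∑ u x ≡⟨ at-concat c pss f u ⟩
            ∑ u c + ∑ (∑ u) pss ≡⟨ cong (_+_ (∑ u c)) (trans (f₁ u) (cong (_+_ (+ (t ℕ.* suc b ℕ.+ i′) * ∑ u p)) (f₂ u))) ⟩
            ∑ u c + (+ (t ℕ.* suc b ℕ.+ i′) * ∑ u p + (+ (t ℕ.* suc a ℕ.+ j′) * ∑ u n + ∑ (∑ u) rss))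
              ≡⟨ cong₂ (λ y z → ∑ u c + (y * ∑ u p + (z * ∑ u n + ∑ (∑ u) rss))) (pos-lin t (suc b) i′) (pos-lin t (suc a) j′) ⟩
            ∑ u c + ((+ t * + suc b + + i′) * ∑ u p + ((+ t * + suc a + + j′) * ∑ u n + ∑ (∑ u) rss))
              ≡⟨ r₀ (∑ u c) (+ t) (+ suc a) (+ suc b) (+ i′) (+ j′) (∑ u p) (∑ u n) (∑ (∑ u) rss) ⟩
            ∑ u c + (+ t * (+ suc b * ∑ u p + + suc a * ∑ u n) + (+ i′ * ∑ u p + (+ j′ * ∑ u n + ∑ (∑ u) rss)))
              ≡⟨ cong (λ z → ∑ u c + (+ t * z + (+ i′ * ∑ u p + (+ j′ * ∑ u n + ∑ (∑ u) rss)))) (sym (∑-h u)) ⟩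
            ∑ u c + (+ t * ∑ u h + (+ i′ * ∑ u p + (+ j′ * ∑ u n + ∑ (∑ u) rss))) ∎
            where open ≡-Reasoning
          r₁ : ∀ c i t j z → c + (t + (i + (j + z))) ≡ c + (i + (t + (j + z)))
          r₁ = solve-∀
          r₂ : ∀ c i t j z → c + (t + (i + (j + z))) ≡ c + (j + (t + (i + z)))
          r₂ = solve-∀
          choose : i′ < suc b ⊎ j′ < suc a →
                   (∃ λ k → k ∈ upTo (suc b) × Solves₁ k x) ⊎ (∃ λ k → k ∈ upTo (suc a) × Solves₂ k x)
          choose (inj₁ l) = inj₁ (i′ , ∈-upTo⁺ l ,
                ( times t [ h ] ++ times j′ [ n ] ++ rss
                , ++-⊆ (copies-⊆ t (here refl))
                       (++-⊆ (copies-⊆ j′ (there (∈-++⁺ʳ Z (∈-++⁺ʳ Ps (here refl))))) (Z∪ id there ∘ s₂))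
                , absorb c p (times t [ h ] ++ times j′ [ n ] ++ rss) i′ (λ u → trans (total u) (trans
                    (r₁ (∑ u c) (+ i′ * ∑ u p) (+ t * ∑ u h) (+ j′ * ∑ u n) (∑ (∑ u) rss))
                    (cong (λ z → ∑ u c + (+ i′ * ∑ u p + z)) (sym (expand u j′ n)))))) , e)
          choose (inj₂ l) = inj₂ (j′ , ∈-upTo⁺ l ,
                ( times t [ h ] ++ times i′ [ p ] ++ rss
                , ++-⊆ (copies-⊆ t (here refl))
                       (++-⊆ (copies-⊆ i′ (there (∈-++⁺ʳ Z (here refl)))) (Z∪ there id ∘ s₂))
                , absorb c n (times t [ h ] ++ times i′ [ p ] ++ rss) j′ (λ u → trans (total u) (trans
                    (r₂ (∑ u c) (+ i′ * ∑ u p) (+ t * ∑ u h) (+ j′ * ∑ u n) (∑ (∑ u) rss))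
                    (cong (λ z → ∑ u c + (+ j′ * ∑ u n + z)) (sym (expand u i′ p)))))) , e)

  solve-equation : (L : LinearSet A) → B (base L) → (∀ {p} → p ∈ periods L → D p) → Cover (Solves L)
  solve-equation (c +⟨ P ⟩*) bc hP = classify P [] [] [] hP (λ ()) (λ ()) (λ ()) ∈-++⁺ˡ
    where
      classify : ∀ Q Z Ps Ns → (∀ {p} → p ∈ Q → D p) → Null Z → Positive Ps → Negative Ns →
                 P ⊆ Q ++ Z ++ Ps ++ Ns → Cover (Solves (c +⟨ P ⟩*))
      classify [] Z Ps Ns hQ hZ hP hN i =
        cover-⊆ {P′ = Solves (c +⟨ Z ++ Ps ++ Ns ⟩*)} (λ { x ((pss , s , f) , e) → (pss , i ∘ s , f) , e }) (eliminate c Z Ps Ns bc hZ hP hN)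
      classify (q ∷ Q) Z Ps Ns hQ hZ hP hN i with ∑ w q in eq
      ... | + zero   = classify Q (q ∷ Z) Ps Ns (hQ ∘ there)
                         (λ { (here refl) → hQ (here refl) , eq ; (there m) → hZ m }) hP hN
                         (λ k → case i k of (λ { (here e) → ∈-++⁺ʳ Q (here e) ; (there k) → [ ∈-++⁺ˡ , ∈-++⁺ʳ Q ∘ there ]′ (∈-++⁻ Q k) }))
      ... | + suc m  = classify Q Z (q ∷ Ps) Ns (hQ ∘ there) hZ
                         (λ { (here refl) → hQ (here refl) , m , eq ; (there k) → hP k }) hN
                         (λ k → case i k of λ where
                           (here e)  → ∈-++⁺ʳ Q (∈-++⁺ʳ Z (here e))
                           (there l) → [ ∈-++⁺ˡ , (λ r → ∈-++⁺ʳ Q ([ ∈-++⁺ˡ , ∈-++⁺ʳ Z ∘ there ]′ (∈-++⁻ Z r))) ]′ (∈-++⁻ Q l))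
      ... | -[1+ m ] = classify Q Z Ps (q ∷ Ns) (hQ ∘ there) hZ hP
                         (λ { (here refl) → hQ (here refl) , m , eq ; (there k) → hN k })
                         (λ k → case i k of λ where
                           (here e)  → ∈-++⁺ʳ Q (∈-++⁺ʳ Z (∈-++⁺ʳ Ps (here e)))
                           (there l) → [ ∈-++⁺ˡ , (λ r → ∈-++⁺ʳ Q ([ ∈-++⁺ˡ , (λ r → ∈-++⁺ʳ Z ([ ∈-++⁺ˡ , ∈-++⁺ʳ Ps ∘ there ]′ (∈-++⁻ Ps r))) ]′ (∈-++⁻ Z r))) ]′ (∈-++⁻ Q l))

-- Parikh images of walks as semilinear sets

∑-++₃ : {A : Set} (w : A → ℤ) (xs ys zs : List A) → ∑ w (xs ++ ys ++ zs) ≡ ∑ w xs + (∑ w ys + ∑ w zs)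
∑-++₃ w xs ys zs = trans (∑-++ w xs _) (cong (_+_ (∑ w xs)) (∑-++ w ys zs))

∑-++₄ : {A : Set} (w : A → ℤ) (xs ys zs us : List A) →
        ∑ w (xs ++ ys ++ zs ++ us) ≡ ∑ w xs + (∑ w ys + (∑ w zs + ∑ w us))
∑-++₄ w xs ys zs us = trans (∑-++ w xs _) (cong (_+_ (∑ w xs)) (∑-++₃ w ys zs us))

module Graph {State Edge : Set} (src tgt : Edge → State) where

  -- The endpoints are constrained by equations because `src` and `tgt` are arbitrary functions, on
  -- whose values pattern matching could not unify.
  data Walk (p : State) : List Edge → State → Set where
    nil  : ∀ {q} → p ≡ q → Walk p [] q
    cons : ∀ {e es q} → p ≡ src e → Walk (tgt e) es q → Walk p (e ∷ es) q

  walk-++ : ∀ {p q r xs ys} → Walk p xs q → Walk q ys r → Walk p (xs ++ ys) r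
  walk-++ (nil refl)  v = v
  walk-++ (cons e w)  v = cons e (walk-++ w v)

  walk-++⁻ : ∀ {p r} xs {ys} → Walk p (xs ++ ys) r → ∃ λ q → Walk p xs q × Walk q ys r
  walk-++⁻ []       w          = _ , nil refl , w
  walk-++⁻ (x ∷ xs) (cons e w) = let q , u , v = walk-++⁻ xs w in q , cons e u , v

  walk-edge : ∀ e → Walk (src e) [ e ] (tgt e)
  walk-edge e = cons refl (nil refl)

  visited : State → List Edge → List State
  visited p W = p ∷ map tgt W

  end-visited : ∀ {p q} W → Walk p W q → q ∈ visited p W
  end-visited []      (nil refl)  = here refl
  end-visited (x ∷ W) (cons e w)  = there (end-visited W w)

  visited-++ˡ : ∀ {p} xs ys → visited p xs ⊆ visited p (xs ++ ys)
  visited-++ˡ xs ys (here e)  = here e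
  visited-++ˡ xs ys (there m) = there (subst (_ ∈_) (sym (Listₚ.map-++ tgt xs ys)) (∈-++⁺ˡ m))

  visited-++ʳ : ∀ {p q} xs ys → Walk p xs q → visited q ys ⊆ visited p (xs ++ ys)
  visited-++ʳ xs ys w (here refl) = visited-++ˡ xs ys (end-visited xs w)
  visited-++ʳ xs ys w (there m)   = there (subst (_ ∈_) (sym (Listₚ.map-++ tgt xs ys)) (∈-++⁺ʳ (map tgt xs) m))

  visited-split : ∀ {p q r} W → Walk p W q → r ∈ visited p W →
                  ∃₂ λ A B → W ≡ A ++ B × Walk p A r × Walk r B q
  visited-split W       w          (here refl) = [] , W , refl , nil refl , w
  visited-split (x ∷ W) (cons e w) (there m)   =
    let A , B , eq , a , b = visited-split W w m in x ∷ A , B , cong (x ∷_) eq , cons e a , b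

  -- A period can be added any number of times because its hub lies on the base walk `W`. A hub on
  -- another period alone would not do, since that period may be used zero times.
  record Attached (E : List Edge) (p : State) (W C : List Edge) : Set where
    constructor attached
    field
      inside : C ⊆ E
      hub    : State
      closed : Walk hub C hub
      meets  : hub ∈ visited p W
  open Attached public

  record WalkPiece (E : List Edge) (p q : State) (L : LinearSet Edge) : Set where
    constructor piece
    field
      spine  : Walk p (base L) q
      within : base L ⊆ E
      cycles : ∀ {C} → C ∈ periods L → Attached E p (base L) C
  open WalkPiece public

  attached-mono : ∀ {E E′ p p′ W W′ C} → E ⊆ E′ → visited p W ⊆ visited p′ W′ →
                  Attached E p W C → Attached E′ p′ W′ C
  attached-mono i v (attached s h c m) = attached (i ∘ s) h c (v m)

  piece-mono : ∀ {E E′ p q L} → E ⊆ E′ → WalkPiece E p q L → WalkPiece E′ p q L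
  piece-mono i (piece s w c) = piece s (i ∘ w) (attached-mono i id ∘ c)

  record WalkIn (E : List Edge) (p : State) (W : List Edge) (q : State) : Set where
    constructor walkIn
    field
      walk    : Walk p W q
      edges-⊆ : W ⊆ E
  open WalkIn public

  WalkCover : List Edge → State → State → (List Edge → Set) → Set
  WalkCover E p q = FinCover _∈ᴸ_ (WalkPiece E p q)

  module _ (e : Edge) where

    loops : List (List Edge) → List Edge
    loops σs = concat (map (_++ [ e ]) σs)

    -- The shape `pre e σ₁ e ... σₙ e post`, with all parts inside the smaller edge list `E`.
    record Split (E : List Edge) (p : State) (ρ : List Edge) (q : State) : Set where
      field
        {pre post} : List Edge
        {mid}      : List (List Edge)
        pre-walk   : WalkIn E p pre (src e)
        mid-walk   : ∀ {σ} → σ ∈ mid → WalkIn E (tgt e) σ (src e)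
        post-walk  : WalkIn E (tgt e) post q
        whole      : ρ ≈ pre ++ [ e ] ++ loops mid ++ post
    open Split

    split-at-edge : ∀ {E p q} ρ → Walk p ρ q → ρ ⊆ e ∷ E → ρ ⊆ E ⊎ Split E p ρ q
    split-at-edge []      w          s = inj₁ λ ()
    split-at-edge (x ∷ ρ) (cons refl w) s with split-at-edge ρ w (s ∘ there) | s (here refl)
    ... | inj₁ t | there m   = inj₁ λ { (here refl) → m ; (there k) → t k }
    ... | inj₁ t | here refl = inj₂ record
          { pre = [] ; mid = [] ; pre-walk = walkIn (nil refl) (λ ()) ; mid-walk = λ ()
          ; post-walk = walkIn w t ; whole = ≈-refl }
    ... | inj₂ d | here refl = inj₂ record
          { pre = [] ; mid = pre d ∷ mid d ; pre-walk = walkIn (nil refl) (λ ())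
          ; mid-walk = λ { (here refl) → pre-walk d ; (there m) → mid-walk d m }
          ; post-walk = post-walk d
          ; whole = ++-cong (≈-refl {xs = [ e ]}) (≈-trans (whole d) (≡⇒≈ reassoc)) }
      where
        open ≡-Reasoning
        reassoc : pre d ++ [ e ] ++ loops (mid d) ++ post d ≡ loops (pre d ∷ mid d) ++ post d
        reassoc = begin
          pre d ++ [ e ] ++ loops (mid d) ++ post d     ≡⟨ sym (Listₚ.++-assoc (pre d) [ e ] _) ⟩
          (pre d ++ [ e ]) ++ loops (mid d) ++ post d   ≡⟨ sym (Listₚ.++-assoc (pre d ++ [ e ]) _ _) ⟩
          loops (pre d ∷ mid d) ++ post d               ∎
    ... | inj₂ d | there m   = inj₂ record
          { pre = x ∷ pre d ; mid = mid d
          ; pre-walk = walkIn (cons refl (walk (pre-walk d)))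
                              (λ { (here refl) → m ; (there k) → edges-⊆ (pre-walk d) k })
          ; mid-walk = mid-walk d ; post-walk = post-walk d
          ; whole = ++-cong (≈-refl {xs = [ x ]}) (whole d) }

    record LoopsFrom (Ls : List (LinearSet Edge)) (ρ : List Edge) : Set where
      constructor loopsFrom
      field
        {parts}  : List (List Edge)
        from     : ∀ {σ} → σ ∈ parts → ∃ λ L → L ∈ Ls × σ ∈ᴸ L
        combined : ρ ≈ loops parts
    open LoopsFrom

    _⟲_ : LinearSet Edge → LinearSet Edge → LinearSet Edge
    L ⟲ S = ((base L ++ [ e ]) ++ base S) +⟨ (base L ++ [ e ]) ∷ periods L ++ periods S ⟩*

    -- A loop piece that is used at all has its base traversed once in the new base; further uses
    -- of that base are periods.
    sort-loops : ∀ {L Ls} σs → (∀ {σ} → σ ∈ σs → ∃ λ K → K ∈ L ∷ Ls × σ ∈ᴸ K) →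
      ∃ λ ρ′ → LoopsFrom Ls ρ′ ×
        (loops σs ≈ ρ′ ⊎ (∃ λ pss → pss ⊆ (base L ++ [ e ]) ∷ periods L ×
                           loops σs ≈ (base L ++ [ e ]) ++ concat pss ++ ρ′))
    sort-loops [] f = [] , loopsFrom {parts = []} (λ ()) ≈-refl , inj₁ ≈-refl
    sort-loops {L} {Ls} (σ ∷ σs) f with sort-loops {L} {Ls} σs (f ∘ there) | f (here refl)
    ... | ρ′ , lf , inj₁ h | K , there m , k =
      (σ ++ [ e ]) ++ ρ′ ,
      loopsFrom {parts = σ ∷ parts lf} (λ { (here refl) → K , m , k ; (there j) → from lf j })
        (++-cong (≈-refl {xs = σ ++ [ e ]}) (combined lf)) ,
      inj₁ (++-cong (≈-refl {xs = σ ++ [ e ]}) h)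
    ... | ρ′ , lf , inj₂ (pss , s , h) | K , there m , k =
      (σ ++ [ e ]) ++ ρ′ ,
      loopsFrom {parts = σ ∷ parts lf} (λ { (here refl) → K , m , k ; (there j) → from lf j })
        (++-cong (≈-refl {xs = σ ++ [ e ]}) (combined lf)) ,
      inj₂ (pss , s , ≈-trans (++-cong (≈-refl {xs = σ ++ [ e ]}) h) (mk≈ λ w →
        trans (∑-++₄ w (σ ++ [ e ]) (base L ++ [ e ]) (concat pss) ρ′)
          (trans (r (∑ w (σ ++ [ e ])) (∑ w (base L ++ [ e ])) (∑ w (concat pss)) (∑ w ρ′)) (sym (∑-++₄ w (base L ++ [ e ]) (concat pss) (σ ++ [ e ]) ρ′)))))
      where r : ∀ a b c d → a + (b + (c + d)) ≡ b + (c + (a + d))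
            r = solve-∀
    ... | ρ′ , lf , inj₁ h | .L , here refl , (qss , t , g) =
      ρ′ , lf , inj₂ (qss , (there ∘ t) , ≈-trans (++-cong (++-cong g (≈-refl {xs = [ e ]})) h) (mk≈ λ w →
        trans (∑-++ w ((base L ++ concat qss) ++ [ e ]) ρ′)
          (trans (cong (_+ ∑ w ρ′) (trans (∑-++ w (base L ++ concat qss) [ e ]) (cong (_+ ∑ w [ e ]) (∑-++ w (base L) (concat qss)))))
            (trans (r (∑ w (base L)) (∑ w (concat qss)) (∑ w [ e ]) (∑ w ρ′))
              (trans (cong (_+ (∑ w (concat qss) + ∑ w ρ′)) (sym (∑-++ w (base L) [ e ])))
                     (sym (∑-++₃ w (base L ++ [ e ]) (concat qss) ρ′)))))))
      where r : ∀ b q e p → b + q + e + p ≡ b + e + (q + p)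
            r = solve-∀
    ... | ρ′ , lf , inj₂ (pss , s , h) | .L , here refl , (qss , t , g) =
      ρ′ , lf , inj₂ ((base L ++ [ e ]) ∷ qss ++ pss
        , (λ { (here refl) → here refl ; (there j) → [ there ∘ t , s ]′ (∈-++⁻ qss j) })
        , ≈-trans (++-cong (++-cong g (≈-refl {xs = [ e ]})) h) (mk≈ λ w →
        trans (∑-++₄ w ((base L ++ concat qss) ++ [ e ]) (base L ++ [ e ]) (concat pss) ρ′)
          (trans (cong (_+ (∑ w (base L ++ [ e ]) + (∑ w (concat pss) + ∑ w ρ′)))
                   (trans (∑-++ w (base L ++ concat qss) [ e ]) (cong (_+ ∑ w [ e ]) (∑-++ w (base L) (concat qss)))))
            (trans (r (∑ w (base L)) (∑ w (concat qss)) (∑ w [ e ]) (∑ w (base L ++ [ e ])) (∑ w (concat pss)) (∑ w ρ′))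
              (sym (trans (∑-++₃ w (base L ++ [ e ]) (concat ((base L ++ [ e ]) ∷ qss ++ pss)) ρ′)
                (cong (λ z → ∑ w (base L ++ [ e ]) + (z + ∑ w ρ′))
                  (trans (∑-++ w (base L ++ [ e ]) (concat (qss ++ pss)))
                    (cong₂ _+_ (∑-++ w (base L) [ e ])
                      (trans (∑-concat w (qss ++ pss)) (trans (∑-++ (∑ w) qss pss)
                        (sym (cong₂ _+_ (∑-concat w qss) (∑-concat w pss))))))))))))))
      where r : ∀ b q e l p z → b + q + e + (l + (p + z)) ≡ l + ((b + e) + (q + p) + z)
            r = solve-∀

    -- A commutative Kleene star: the order of the loops is immaterial, so it matters only which
    -- members of `Ls` occur at all, and there is one linear set for each subset of `Ls`.
    star : ∀ {E} Ls → (∀ {L} → L ∈ Ls → WalkPiece E (tgt e) (src e) L) →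
           WalkCover (e ∷ E) (tgt e) (tgt e) (LoopsFrom Ls)
    star [] h = cover-one ([] +⟨ [] ⟩*) (piece (nil refl) (λ ()) (λ ()))
      λ { x (loopsFrom {[]} f c) → [] , (λ ()) , c
        ; x (loopsFrom {σ ∷ σs} f c) → case f (here refl) of λ { (_ , () , _) } }
    star {E} (L ∷ Ls) h = mkCover (elems S ++ map (L ⟲_) (elems S)) ok cov
      where
        S : WalkCover (e ∷ E) (tgt e) (tgt e) (LoopsFrom Ls)
        S = star Ls (h ∘ there)
        hL : WalkPiece E (tgt e) (src e) L
        hL = h (here refl)
        loopL : Walk (tgt e) (base L ++ [ e ]) (tgt e)
        loopL = walk-++ (spine hL) (walk-edge e)
        loopL-⊆ : base L ++ [ e ] ⊆ e ∷ E
        loopL-⊆ = ++-⊆ (there ∘ within hL) (λ { (here refl) → here refl })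
        twist-good : ∀ {K} → WalkPiece (e ∷ E) (tgt e) (tgt e) K → WalkPiece (e ∷ E) (tgt e) (tgt e) (L ⟲ K)
        twist-good {K} k = piece (walk-++ loopL (spine k)) (++-⊆ loopL-⊆ (within k)) λ where
          (here refl) → attached loopL-⊆ (tgt e) loopL (here refl)
          (there m)   → case ∈-++⁻ (periods L) m of λ where
            (inj₁ j) → attached-mono there (visited-++ˡ (base L ++ [ e ]) (base K) ∘ visited-++ˡ (base L) [ e ]) (cycles hL j)
            (inj₂ j) → attached-mono id (visited-++ʳ (base L ++ [ e ]) (base K) loopL) (cycles k j)
        ok : ∀ {K} → K ∈ elems S ++ map (L ⟲_) (elems S) → WalkPiece (e ∷ E) (tgt e) (tgt e) K
        ok m with ∈-++⁻ (elems S) m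
        ... | inj₁ k = good S k
        ... | inj₂ k with ∈-map⁻ (L ⟲_) k
        ... | K , j , refl = twist-good (good S j)
        cov : ∀ x → LoopsFrom (L ∷ Ls) x → ∃ λ K → K ∈ elems S ++ map (L ⟲_) (elems S) × x ∈ᴸ K
        cov x (loopsFrom {σs} f c) with sort-loops {L} {Ls} σs f
        ... | ρ′ , lf , h with covers S ρ′ lf
        cov x (loopsFrom {σs} f c) | ρ′ , lf , inj₁ h | K , m , k =
          K , ∈-++⁺ˡ m , ∈ᴸ-resp {L = K} (≈-sym (≈-trans c h)) k
        cov x (loopsFrom {σs} f c) | ρ′ , lf , inj₂ (pss , s , h) | K , m , (qss , t , g) =
          (L ⟲ K) , ∈-++⁺ʳ (elems S) (∈-map⁺ (L ⟲_) m) ,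
          pss ++ qss ,
          ++-⊆ (λ j → case s j of λ { (here eq) → here eq ; (there l) → there (∈-++⁺ˡ l) })
               (there ∘ ∈-++⁺ʳ (periods L) ∘ t) ,
          ≈-trans c (≈-trans h (mk≈ λ w →
            trans (∑-++₃ w (base L ++ [ e ]) (concat pss) ρ′)
              (trans (cong (λ z → ∑ w (base L ++ [ e ]) + (∑ w (concat pss) + z)) (trans (at g w) (∑-++ w (base K) _)))
                (trans (r (∑ w (base L ++ [ e ])) (∑ w (concat pss)) (∑ w (base K)) (∑ w (concat qss)))
                  (sym (trans (∑-++ w ((base L ++ [ e ]) ++ base K) (concat (pss ++ qss)))
                    (cong₂ _+_ (∑-++ w (base L ++ [ e ]) (base K))
                      (trans (cong (∑ w) (sym (Listₚ.concat-++ pss qss))) (∑-++ w (concat pss) (concat qss))))))))))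
          where r : ∀ l p k q → l + (p + (k + q)) ≡ (l + k) + (p + q)
                r = solve-∀

  module _ (_≟_ : DecidableEquality State) where

    -- Kleene's recursion, with edges eliminated in place of states: a walk through the first edge
    -- `e` enters it, loops from its target back through it, and leaves, and all parts in between
    -- stay in the shorter list.
    parikh : ∀ E p q → WalkCover E p q (λ ρ → WalkIn E p ρ q)
    parikh [] p q with p ≟ q
    ... | yes refl = cover-one ([] +⟨ [] ⟩*) (piece (nil refl) (λ ()) (λ ()))
                       λ { [] _ → [] , (λ ()) , ≈-refl ; (x ∷ ρ) (walkIn _ s) → case s (here refl) of λ () }
    ... | no p≢q   = cover-none λ { _ (walkIn (nil eq) _) → p≢q eq ; _ (walkIn (cons _ _) s) → case s (here refl) of λ () }
    parikh (e ∷ E) p q = mkCover (elems direct ++ through) ok cov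
      where
        direct : WalkCover E p q (λ ρ → WalkIn E p ρ q)
        direct = parikh E p q
        enter : WalkCover E p (src e) (λ ρ → WalkIn E p ρ (src e))
        enter = parikh E p (src e)
        again : WalkCover E (tgt e) (src e) (λ ρ → WalkIn E (tgt e) ρ (src e))
        again = parikh E (tgt e) (src e)
        leave : WalkCover E (tgt e) q (λ ρ → WalkIn E (tgt e) ρ q)
        leave = parikh E (tgt e) q
        S : WalkCover (e ∷ E) (tgt e) (tgt e) (LoopsFrom e (elems again))
        S = star e (elems again) (good again)
        join : LinearSet Edge → LinearSet Edge → LinearSet Edge → LinearSet Edge
        join I K O = (base I ++ [ e ] ++ base K ++ base O) +⟨ periods I ++ periods K ++ periods O ⟩*
        through : List (LinearSet Edge)
        through = map (λ { (I , K , O) → join I K O }) (cartesianProduct (elems enter) (cartesianProduct (elems S) (elems leave)))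
        join-good : ∀ {I K O} → WalkPiece E p (src e) I → WalkPiece (e ∷ E) (tgt e) (tgt e) K →
                    WalkPiece E (tgt e) q O → WalkPiece (e ∷ E) p q (join I K O)
        join-good {I} {K} {O} i k o = piece
          (walk-++ (spine i) (walk-++ (walk-edge e) (walk-++ (spine k) (spine o))))
          (++-⊆ (there ∘ within i) (++-⊆ {xs = [ e ]} (λ { (here refl) → here refl }) (++-⊆ (within k) (there ∘ within o))))
          λ m → case ∈-++⁻ (periods I) m of λ where
            (inj₁ j) → attached-mono there (visited-++ˡ (base I) _) (cycles i j)
            (inj₂ j) → case ∈-++⁻ (periods K) j of λ where
              (inj₁ l) → attached-mono id (after ∘ visited-++ˡ (base K) (base O)) (cycles k l)
              (inj₂ l) → attached-mono there (after ∘ visited-++ʳ (base K) (base O) (spine k)) (cycles o l)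
          where
            after : visited (tgt e) (base K ++ base O) ⊆ visited p (base I ++ [ e ] ++ base K ++ base O)
            after = visited-++ʳ (base I) _ (spine i) ∘ visited-++ʳ [ e ] (base K ++ base O) (walk-edge e)
        ok : ∀ {L} → L ∈ elems direct ++ through → WalkPiece (e ∷ E) p q L
        ok m with ∈-++⁻ (elems direct) m
        ... | inj₁ k = piece-mono there (good direct k)
        ... | inj₂ k with ∈-map⁻ (λ { (I , K , O) → join I K O }) k
        ... | (I , K , O) , j , refl with ∈-cartesianProduct⁻ (elems enter) _ j
        ... | a , j′ with ∈-cartesianProduct⁻ (elems S) (elems leave) j′
        ... | b , c = join-good (good enter a) (good S b) (good leave c)
        cov : ∀ ρ → WalkIn (e ∷ E) p ρ q → ∃ λ L → L ∈ elems direct ++ through × ρ ∈ᴸ L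
        cov ρ (walkIn w s) with split-at-edge e ρ w s
        ... | inj₁ t = let L , m , l = covers direct ρ (walkIn w t) in L , ∈-++⁺ˡ m , l
        ... | inj₂ d with covers enter _ (Split.pre-walk d)
                        | covers S (loops e (Split.mid d)) (loopsFrom {parts = Split.mid d} (λ m → covers again _ (Split.mid-walk d m)) ≈-refl)
                        | covers leave _ (Split.post-walk d)
        ... | I , mi , (iss , si , ei) | K , mk , (kss , sk , ek) | O , mo , (oss , so , eo) =
          join I K O , ∈-++⁺ʳ (elems direct) (∈-map⁺ (λ { (I , K , O) → join I K O }) (∈-cartesianProduct⁺ mi (∈-cartesianProduct⁺ mk mo))) ,
          iss ++ kss ++ oss ,
          ++-⊆ (∈-++⁺ˡ ∘ si) (++-⊆ (∈-++⁺ʳ (periods I) ∘ ∈-++⁺ˡ ∘ sk) (∈-++⁺ʳ (periods I) ∘ ∈-++⁺ʳ (periods K) ∘ so)) ,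
          ≈-trans (Split.whole d) (≈-trans
            (++-cong ei (++-cong (≈-refl {xs = [ e ]}) (++-cong ek eo)))
            (mk≈ λ w →
              trans (∑-++₄ w (base I ++ concat iss) [ e ] (base K ++ concat kss) (base O ++ concat oss))
                (trans (cong₂ _+_ (∑-++ w (base I) _) (cong (_+_ (∑ w [ e ])) (cong₂ _+_ (∑-++ w (base K) _) (∑-++ w (base O) _))))
                  (trans (r (∑ w (base I)) (∑ w (concat iss)) (∑ w [ e ]) (∑ w (base K)) (∑ w (concat kss)) (∑ w (base O)) (∑ w (concat oss)))
                    (sym (trans (∑-++ w (base I ++ [ e ] ++ base K ++ base O) (concat (iss ++ kss ++ oss)))
                      (cong₂ _+_ (∑-++₄ w (base I) [ e ] (base K) (base O))
                        (trans (cong (∑ w) (trans (sym (Listₚ.concat-++ iss _)) (cong (concat iss ++_) (sym (Listₚ.concat-++ kss oss)))))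
                               (∑-++₃ w (concat iss) (concat kss) (concat oss))))))))))
          where r : ∀ i is e k ks o os → (i + is) + (e + ((k + ks) + (o + os))) ≡ (i + (e + (k + o))) + (is + (ks + os))
                r = solve-∀

-- Walks made of attached cycles

module Cyclic {State Edge : Set} (src tgt : Edge → State) where

  open Graph src tgt

  visited-insert : ∀ {p} A C B → visited p (A ++ B) ⊆ visited p (A ++ C ++ B)
  visited-insert A C B (here e)  = here e
  visited-insert A C B {x} (there m) with ∈-++⁻ (map tgt A) (subst (x ∈_) (Listₚ.map-++ tgt A B) m)
  ... | inj₁ k = there (subst (x ∈_) (sym (Listₚ.map-++ tgt A (C ++ B))) (∈-++⁺ˡ k))
  ... | inj₂ k = there (subst (x ∈_) (sym (Listₚ.map-++ tgt A (C ++ B)))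
                   (∈-++⁺ʳ (map tgt A) (subst (x ∈_) (sym (Listₚ.map-++ tgt C B)) (∈-++⁺ʳ (map tgt C) k))))

  record Inserted (E : List Edge) (p : State) (W : List Edge) (q : State) (Cs : List (List Edge)) : Set where
    field
      result  : List Edge
      result-walk : WalkIn E p result q
      result-≈    : result ≈ W ++ concat Cs
      result-sees : visited p W ⊆ visited p result

  insert-cycles : ∀ {E p W q} → WalkIn E p W q → ∀ Cs → (∀ {C} → C ∈ Cs → Attached E p W C) → Inserted E p W q Cs
  insert-cycles {W = W} w [] h = record
    { result = W ; result-walk = w ; result-≈ = ≡⇒≈ (sym (Listₚ.++-identityʳ W)) ; result-sees = id }
  insert-cycles {E} {p} {W} {q} w (C ∷ Cs) h
    with insert-cycles w Cs (h ∘ there) | h (here refl)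
  ... | record { result = W′ ; result-walk = w′ ; result-≈ = e ; result-sees = v } | attached s hub c m
    with visited-split W′ (walk w′) (v m)
  ... | A , B , refl , a , b = record
    { result = A ++ C ++ B
    ; result-walk = walkIn (walk-++ a (walk-++ c b))
                      (++-⊆ {xs = A} (λ m → edges-⊆ w′ (∈-++⁺ˡ m)) (++-⊆ s (λ m → edges-⊆ w′ (∈-++⁺ʳ A m))))
    ; result-≈ = mk≈ λ u → trans (∑-++₃ u A C B) (trans (r₁ (∑ u A) (∑ u C) (∑ u B))
        (trans (cong (_+_ (∑ u C)) (trans (sym (∑-++ u A B)) (trans (at e u) (∑-++ u W (concat Cs)))))
          (trans (r₂ (∑ u C) (∑ u W) (∑ u (concat Cs))) (sym (∑-++₃ u W C (concat Cs))))))
    ; result-sees = visited-insert A C B ∘ v }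
    where r₁ : ∀ a c b → a + (c + b) ≡ c + (a + b)
          r₁ = solve-∀
          r₂ : ∀ c w d → c + (w + d) ≡ w + (c + d)
          r₂ = solve-∀

  rotate : ∀ {e C r} → Walk r C r → e ∈ C → ∃ λ R → WalkIn C (tgt e) R (src e) × e ∷ R ≈ C
  rotate {e} w m with ∈-∃++ m
  ... | A , B , refl with walk-++⁻ A w
  ... | _ , a , cons refl b = B ++ A
      , walkIn (walk-++ b a) (++-⊆ {xs = B} (λ k → ∈-++⁺ʳ A (there k)) (λ k → ∈-++⁺ˡ k))
      , ≈-trans (++-comm (e ∷ B) A) ≈-refl

  -- One copy of `Cs` is charged for each entry of `Ds`; what remains of that copy without the entry
  -- goes to `Rs`, together with all copies that are not charged.
  absorb-copies : {Cs : List (List Edge)} (Ds : List (List Edge)) → Ds ⊆ Cs → ∀ K → length Ds ≤ K →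
    ∃ λ Rs → Rs ⊆ Cs × (∀ u → ∑ u (concat Ds) + ∑ u (concat Rs) ≡ + K * ∑ u (concat Cs))
  absorb-copies {Cs} [] s K le = times K Cs , times-⊆ K id , λ u →
    trans (ℤₚ.+-identityˡ _) (trans (∑-concat u (times K Cs)) (trans (∑-times (∑ u) K Cs) (cong (+ K *_) (sym (∑-concat u Cs)))))
  absorb-copies {Cs} (D ∷ Ds) s (suc K) (s≤s le) with absorb-copies Ds (s ∘ there) K le | ∈-∃++ (s (here refl))
  ... | Rs , t , e | A , B , refl = A ++ B ++ Rs ,
    ++-⊆ {xs = A} (λ m → ∈-++⁺ˡ m) (++-⊆ {xs = B} (λ m → ∈-++⁺ʳ A (there m)) t) , λ u → begin
      ∑ u (D ++ concat Ds) + ∑ u (concat (A ++ B ++ Rs))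
        ≡⟨ cong₂ _+_ (∑-++ u D (concat Ds)) (trans (∑-concat u (A ++ B ++ Rs)) (∑-++₃ (∑ u) A B Rs)) ⟩
      (∑ u D + ∑ u (concat Ds)) + (∑ (∑ u) A + (∑ (∑ u) B + ∑ (∑ u) Rs))
        ≡⟨ r (∑ u D) (∑ u (concat Ds)) (∑ (∑ u) A) (∑ (∑ u) B) (∑ (∑ u) Rs) ⟩
      (∑ u (concat Ds) + ∑ (∑ u) Rs) + (∑ (∑ u) A + (∑ u D + ∑ (∑ u) B))
        ≡⟨ cong₂ _+_ (cong (_+_ (∑ u (concat Ds))) (sym (∑-concat u Rs))) (sym (trans (∑-concat u (A ++ D ∷ B)) (∑-++ (∑ u) A (D ∷ B)))) ⟩
      (∑ u (concat Ds) + ∑ u (concat Rs)) + ∑ u (concat (A ++ D ∷ B))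
        ≡⟨ cong (_+ ∑ u (concat (A ++ D ∷ B))) (e u) ⟩
      + K * ∑ u (concat (A ++ D ∷ B)) + ∑ u (concat (A ++ D ∷ B))
        ≡⟨ r₂ (+ K) (∑ u (concat (A ++ D ∷ B))) ⟩
      + suc K * ∑ u (concat (A ++ D ∷ B)) ∎
    where
      open ≡-Reasoning
      r : ∀ d ds a b rs → (d + ds) + (a + (b + rs)) ≡ (ds + rs) + (a + (d + b))
      r = solve-∀
      r₂ : ∀ k s → k * s + s ≡ (1ℤ + k) * s
      r₂ = solve-∀

  -- Strong connectivity in disguise: by `exhaustive` each edge can be undone by the rest of a cycle
  -- through it, and the spine meets all cycles. In the application `Cs` lists the cycles of the
  -- homogeneous solution.
  record CycleSystem (E : List Edge) (p : State) (W : List Edge) (q : State) (Cs : List (List Edge)) : Set where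
    field
      spine-walk : WalkIn E p W q
      attachment : ∀ {C} → C ∈ Cs → Attached E p W C
      exhaustive : ∀ {e} → e ∈ E → ∃ λ C → C ∈ Cs × e ∈ C

    -- Each edge is answered by the rest of a cycle through it, in reverse order. A walk and its way
    -- back then make up whole cycles, so their joint effect is known exactly.
    complement : ∀ {a b X} → WalkIn E a X b →
      ∃₂ λ X′ Ds → WalkIn E b X′ a × Ds ⊆ Cs × X ++ X′ ≈ concat Ds
    complement (walkIn (nil refl) s) = [] , [] , walkIn (nil refl) (λ ()) , (λ ()) , ≈-refl
    complement {X = e ∷ X} (walkIn (cons refl w) s)
      with complement (walkIn w (s ∘ there)) | exhaustive (s (here refl))
    ... | X′ , Ds , walkIn w′ s′ , d , eq | C , C∈ , e∈
      with rotate (closed (attachment C∈)) e∈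
    ... | R , walkIn r rs , eR = X′ ++ R , C ∷ Ds
        , walkIn (walk-++ w′ r) (++-⊆ s′ (inside (attachment C∈) ∘ rs))
        , (λ { (here refl) → C∈ ; (there k) → d k })
        , mk≈ λ u → begin
            ∑ u (e ∷ X ++ X′ ++ R)          ≡⟨ cong (_+_ (u e)) (∑-++₃ u X X′ R) ⟩
            u e + (∑ u X + (∑ u X′ + ∑ u R)) ≡⟨ rg (u e) (∑ u X) (∑ u X′) (∑ u R) ⟩
            (u e + ∑ u R) + (∑ u X + ∑ u X′) ≡⟨ cong₂ _+_ (at eR u) (trans (sym (∑-++ u X X′)) (at eq u)) ⟩
            ∑ u C + ∑ u (concat Ds)          ≡⟨ sym (∑-++ u C (concat Ds)) ⟩
            ∑ u (C ++ concat Ds) ∎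
      where
        open ≡-Reasoning
        rg : ∀ a b c d → a + (b + (c + d)) ≡ (a + d) + (b + c)
        rg = solve-∀

    private
      reach : ∀ {e} → e ∈ E → ∃ λ X → WalkIn E p X (src e)
      reach {e} m with exhaustive m
      ... | C , C∈ , e∈ with ∈-∃++ e∈
      ... | C₁ , C₂ , refl with walk-++⁻ C₁ (closed (attachment C∈)) | visited-split W (walk spine-walk) (meets (attachment C∈))
      ... | _ , c₁ , cons refl c₂ | A , B , refl , a , b =
        A ++ C₁ , walkIn (walk-++ a c₁) (++-⊆ {xs = A} (λ k → edges-⊆ spine-walk (∈-++⁺ˡ k)) (λ k → inside (attachment C∈) (∈-++⁺ˡ k)))

    return-to-start : ∀ {e} → e ∈ E → ∃ λ X → WalkIn E (tgt e) X p
    return-to-start {e} m =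
      let X , walkIn w s = reach m
          X′ , _ , w′ , _ = complement (walkIn (walk-++ w (walk-edge e)) (++-⊆ s (λ { (here refl) → m })))
      in X′ , w′

    leave-from-end : ∀ {e} → e ∈ E → ∃ λ X → WalkIn E q X (src e)
    leave-from-end m =
      let X , walkIn w s = reach m
          Y , _ , walkIn y t , _ = complement spine-walk
      in Y ++ X , walkIn (walk-++ y w) (++-⊆ t s)

    -- The loop w traverses the spine with the missing copies of the cycles inserted, then
    -- complements of v, of the spine and of u.
    balancing-loop : ∀ {u v} → WalkIn E p u p → WalkIn E q v q →
      Σ ℕ λ K₀ → ∀ K → K₀ ≤ K → ∃ λ w → WalkIn E p w p ×
        (∀ f → ∑ f u + ∑ f w + ∑ f v ≡ + K * ∑ f (concat Cs))
    balancing-loop {u} {v} hu hv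
      with complement spine-walk | complement hu | complement hv
    ... | W′ , D₁ , walkIn w′ s₁ , d₁ , e₁ | u′ , D₂ , walkIn wu′ s₂ , d₂ , e₂ | v′ , D₃ , walkIn wv′ s₃ , d₃ , e₃ =
      -- The number of cycles spent on the spine, `u` and `v` together with their ways back; `K`
      -- copies of all cycles must contain these.
      length (D₁ ++ D₂ ++ D₃) , λ K le →
        let Rs , t , e = absorb-copies (D₁ ++ D₂ ++ D₃) (++-⊆ d₁ (++-⊆ d₂ d₃)) K le
            open Inserted (insert-cycles spine-walk Rs (attachment ∘ t))
        in result ++ v′ ++ W′ ++ u′
         , walkIn (walk-++ (walk result-walk) (walk-++ wv′ (walk-++ w′ wu′)))
                  (++-⊆ (edges-⊆ result-walk) (++-⊆ s₃ (++-⊆ s₁ s₂)))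
         , λ f → begin
             ∑ f u + ∑ f (result ++ v′ ++ W′ ++ u′) + ∑ f v
               ≡⟨ cong (λ z → ∑ f u + z + ∑ f v) (trans (∑-++₄ f result v′ W′ u′)
                    (cong (_+ (∑ f v′ + (∑ f W′ + ∑ f u′))) (trans (at result-≈ f) (∑-++ f W (concat Rs))))) ⟩
             ∑ f u + (∑ f W + ∑ f (concat Rs) + (∑ f v′ + (∑ f W′ + ∑ f u′))) + ∑ f v
               ≡⟨ rg (∑ f u) (∑ f W) (∑ f (concat Rs)) (∑ f v′) (∑ f W′) (∑ f u′) (∑ f v) ⟩
             (∑ f W + ∑ f W′) + ((∑ f u + ∑ f u′) + (∑ f v + ∑ f v′)) + ∑ f (concat Rs)
               ≡⟨ cong (_+ ∑ f (concat Rs)) (cong₂ _+_ (pair W W′ D₁ e₁ f) (cong₂ _+_ (pair u u′ D₂ e₂ f) (pair v v′ D₃ e₃ f))) ⟩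
             ∑ f (concat D₁) + (∑ f (concat D₂) + ∑ f (concat D₃)) + ∑ f (concat Rs)
               ≡⟨ cong (_+ ∑ f (concat Rs)) (sym (trans (∑-concat f (D₁ ++ D₂ ++ D₃)) (trans (∑-++₃ (∑ f) D₁ D₂ D₃)
                    (sym (cong₂ _+_ (∑-concat f D₁) (cong₂ _+_ (∑-concat f D₂) (∑-concat f D₃))))))) ⟩
             ∑ f (concat (D₁ ++ D₂ ++ D₃)) + ∑ f (concat Rs)
               ≡⟨ e f ⟩
             + K * ∑ f (concat Cs) ∎
      where
        open ≡-Reasoning
        pair : ∀ X X′ D → X ++ X′ ≈ concat D → ∀ f → ∑ f X + ∑ f X′ ≡ ∑ f (concat D)
        pair X X′ D e f = trans (sym (∑-++ f X X′)) (at e f)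
        rg : ∀ u w r v′ w′ u′ v → u + (w + r + (v′ + (w′ + u′))) + v ≡ (w + w′) + ((u + u′) + (v + v′)) + r
        rg = solve-∀

-- Values of one counter along a word

total : ∀ {n} → (Fin n → ℕ) → ℕ
total {zero}  f = 0
total {suc n} f = f zero ℕ.+ total (f ∘ suc)

≤-total : ∀ {n} (f : Fin n → ℕ) i → f i ≤ total f
≤-total f zero    = ℕₚ.m≤m+n (f zero) _
≤-total f (suc i) = ℕₚ.≤-trans (≤-total (f ∘ suc) i) (ℕₚ.m≤n+m _ (f zero))

-∣i∣≤i : ∀ i → - (+ ∣ i ∣) ℤ.≤ i
-∣i∣≤i (+ zero)  = ℤₚ.≤-refl
-∣i∣≤i (+ suc n) = ℤ.-≤+
-∣i∣≤i -[1+ n ]  = ℤₚ.≤-refl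

module _ {A : Set} where

  Along : (ℤ → Set) → (A → ℤ) → ℤ → List A → Set
  Along P w x []       = P x
  Along P w x (e ∷ es) = P x × Along P w (x + w e) es

  -- Leaves the last value free: the prefix up to the first excess obeys the bound everywhere except
  -- at its end.
  Before : (ℤ → Set) → (A → ℤ) → ℤ → List A → Set
  Before P w x []       = ⊤
  Before P w x (e ∷ es) = P x × Before P w (x + w e) es

  Safe : (A → ℤ) → ℤ → List A → Set
  Safe = Along (0ℤ ℤ.≤_)

  Below : ℕ → (A → ℤ) → ℤ → List A → Set
  Below T = Along (ℤ._< + T)

  module _ {P : ℤ → Set} (w : A → ℤ) where

    along-head : ∀ {x} es → Along P w x es → P x
    along-head []       p       = p
    along-head (e ∷ es) (p , _) = p

    along-++ : ∀ {x} xs {ys} → Along P w x xs → Along P w (x + ∑ w xs) ys → Along P w x (xs ++ ys)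
    along-++ {x} []       {ys} _ b = subst (λ z → Along P w z ys) (ℤₚ.+-identityʳ x) b
    along-++ {x} (e ∷ xs) {ys} (p , a) b =
      p , along-++ xs a (subst (λ z → Along P w z ys) (sym (ℤₚ.+-assoc x (w e) _)) b)

    before-++ : ∀ {x} xs {ys} → Before P w x xs → Along P w (x + ∑ w xs) ys → Along P w x (xs ++ ys)
    before-++ {x} []       {ys} _ b = subst (λ z → Along P w z ys) (ℤₚ.+-identityʳ x) b
    before-++ {x} (e ∷ xs) {ys} (p , a) b =
      p , before-++ xs a (subst (λ z → Along P w z ys) (sym (ℤₚ.+-assoc x (w e) _)) b)

    along-++⁻ : ∀ {x} xs {ys} → Along P w x (xs ++ ys) → Along P w x xs × Along P w (x + ∑ w xs) ys
    along-++⁻ {x} []       {ys} a = along-head ys a , subst (λ z → Along P w z ys) (sym (ℤₚ.+-identityʳ x)) a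
    along-++⁻ {x} (e ∷ xs) {ys} (p , a) =
      let b , c = along-++⁻ xs a in (p , b) , subst (λ z → Along P w z ys) (ℤₚ.+-assoc x (w e) _) c

    along-last : ∀ {x} es → Along P w x es → P (x + ∑ w es)
    along-last {x} []       p       = subst P (sym (ℤₚ.+-identityʳ x)) p
    along-last {x} (e ∷ es) (_ , a) = subst P (ℤₚ.+-assoc x (w e) _) (along-last es a)

    along? : (∀ z → Dec (P z)) → ∀ x es → Dec (Along P w x es)
    along? P? x []       = P? x
    along? P? x (e ∷ es) = P? x ×-dec along? P? (x + w e) es

  along-map : ∀ {P Q : ℤ → Set} (w : A → ℤ) → (∀ {z} → P z → Q z) → ∀ {x} es → Along P w x es → Along Q w x es
  along-map w f []       p       = f p
  along-map w f (e ∷ es) (p , a) = f p , along-map w f es a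

  norm : (A → ℤ) → List A → ℕ
  norm w []       = 0
  norm w (e ∷ es) = ∣ w e ∣ ℕ.+ norm w es

  norm-∈ : ∀ w {e es} → e ∈ es → ∣ w e ∣ ≤ norm w es
  norm-∈ w (here refl) = ℕₚ.m≤m+n _ _
  norm-∈ w (there m)   = ℕₚ.≤-trans (norm-∈ w m) (ℕₚ.m≤n+m _ _)

  norm-length : ∀ w {E} es → es ⊆ E → norm w es ≤ length es ℕ.* norm w E
  norm-length w []       s = z≤n
  norm-length w (e ∷ es) s = ℕₚ.+-mono-≤ (norm-∈ w (s (here refl))) (norm-length w es (s ∘ there))

  private
    lose-step : ∀ {z x n} y → + (∣ y ∣ ℕ.+ n) ℤ.≤ x - z → + n ℤ.≤ x + y - z
    lose-step {z} {x} {n} y h = begin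
      + n                        ≡⟨ r₁ (+ ∣ y ∣) (+ n) ⟩
      (+ ∣ y ∣ + + n) - + ∣ y ∣  ≤⟨ ℤₚ.+-mono-≤ h (-∣i∣≤i y) ⟩
      (x - z) + y                ≡⟨ r₂ x y z ⟩
      x + y - z ∎
      where
        open ℤₚ.≤-Reasoning
        r₁ : ∀ a n → n ≡ a + n - a
        r₁ = solve-∀
        r₂ : ∀ x y z → x - z + y ≡ x + y - z
        r₂ = solve-∀

  -- No prefix lowers the value by more than the norm of the word.
  along-high : ∀ w z {x} es → + norm w es ℤ.≤ x - z → Along (z ℤ.≤_) w x es
  along-high w z []       h = ℤₚ.0≤i-j⇒j≤i h
  along-high w z {x} (e ∷ es) h =
    ℤₚ.0≤i-j⇒j≤i (ℤₚ.≤-trans (+≤+ z≤n) h) ,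
    along-high w z es (lose-step {z} {x} (w e) h)

  ∑-reverse : ∀ (u : A → ℤ) ys → ∑ u (reverse ys) ≡ ∑ u ys
  ∑-reverse u []       = refl
  ∑-reverse u (y ∷ ys) = trans (cong (∑ u) (Listₚ.unfold-reverse y ys))
    (trans (∑-++ u (reverse ys) [ y ]) (trans (ℤₚ.+-comm (∑ u (reverse ys)) _)
      (cong₂ _+_ (ℤₚ.+-identityʳ (u y)) (∑-reverse u ys))))

  -- The reversed word with negated weights passes through the same values in opposite order; the
  -- backward analysis of a component rests on this.
  along-reverse : ∀ {P : ℤ → Set} w x es → Along P w x es → Along P (-_ ∘ w) (x + ∑ w es) (reverse es)
  along-reverse {P} w x []       p = subst P (sym (ℤₚ.+-identityʳ x)) p
  along-reverse {P} w x (e ∷ es) (p , a) =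
    subst (Along P (-_ ∘ w) (x + ∑ w (e ∷ es))) (sym (Listₚ.unfold-reverse e es))
      (along-++ (-_ ∘ w) (reverse es)
        (subst (λ z → Along P (-_ ∘ w) z (reverse es)) (ℤₚ.+-assoc x (w e) _) ih)
        ( subst P (r₁ x (w e) (∑ w es) (∑ (-_ ∘ w) (reverse es)) ∑-rev) (along-head w es a)
        , subst P (r₂ x (w e) (∑ w es) (∑ (-_ ∘ w) (reverse es)) ∑-rev) p))
    where
      ih : Along P (-_ ∘ w) (x + w e + ∑ w es) (reverse es)
      ih = along-reverse {P} w (x + w e) es a
      ∑-rev : ∑ (-_ ∘ w) (reverse es) ≡ - ∑ w es
      ∑-rev = trans (∑-reverse (-_ ∘ w) es) (∑-neg w es)
      r₁ : ∀ x y s t → t ≡ - s → x + y ≡ x + (y + s) + t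
      r₁ x y s .(- s) refl = r x y s
        where r : ∀ x y s → x + y ≡ x + (y + s) + - s
              r = solve-∀
      r₂ : ∀ x y s t → t ≡ - s → x ≡ x + (y + s) + t + - y
      r₂ x y s .(- s) refl = r x y s
        where r : ∀ x y s → x ≡ x + (y + s) + - s + - y
              r = solve-∀

-- Rackoff's argument

vectors : {A : Set} → List A → ∀ n → List (Vec A n)
vectors xs zero    = [ Vec.[] ]
vectors xs (suc n) = concatMap (λ x → map (x Vec.∷_) (vectors xs n)) xs

∈-vectors : {A : Set} {xs : List A} {n : ℕ} (v : Vec A n) → (∀ i → Vec.lookup v i ∈ xs) → v ∈ vectors xs n
∈-vectors Vec.[]      h = here refl
∈-vectors {xs = xs} (x Vec.∷ v) h =
  ∈-concatMap⁺ (λ x → map (x Vec.∷_) (vectors xs _)) (Any.map (λ { refl → ∈-map⁺ (x Vec.∷_) (∈-vectors v (h ∘ suc)) }) (h zero))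

-- Rackoff's argument: a walk exceeding a large enough bound at least once on every counter
-- can be replaced by one of bounded length after which all counters are large together.
module Rackoff {State Edge : Set} (src tgt : Edge → State) (_≟_ : DecidableEquality State) (E : List Edge) where

  open Graph src tgt

  module Configurations {n : ℕ} (W : Fin n → Edge → ℤ) where

    Node : Set
    Node = State × Vec ℤ n

    _≟ᴺ_ : DecidableEquality Node
    _≟ᴺ_ = ≡-dec _≟_ (Vecₚ.≡-dec ℤₚ._≟_)

    next : Node → Edge → Node
    next (_ , v) e = tgt e , tabulate λ j → Vec.lookup v j + W j e

    -- The last node is exempt from `Ok`, since it is the one where a counter has reached the bound.
    -- A path without repetitions thus has at most as many edges as there are `Ok` nodes.
    data Path (Ok : Node → Set) (a : Node) : List Edge → Node → Set where
      stop : ∀ {b} → a ≡ b → Path Ok a [] b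
      step : ∀ {e es b} → Ok a → proj₁ a ≡ src e → e ∈ E → Path Ok (next a e) es b → Path Ok a (e ∷ es) b

    path-map : ∀ {Ok Ok′ : Node → Set} → (∀ {a} → Ok a → Ok′ a) → ∀ {a es b} → Path Ok a es b → Path Ok′ a es b
    path-map f (stop e)         = stop e
    path-map f (step o s m p) = step (f o) s m (path-map f p)

    -- After the last visit no further edge leaves `c`, so `shorten` can delete `c` from the list of
    -- nodes and recurse.
    last-visit : ∀ {Ok : Node → Set} c {a es b} → Path Ok a es b →
      Path (λ z → Ok z × z ≢ c) a es b ⊎
      (Σ Edge λ e → Σ (List Edge) λ es′ → Ok c × proj₁ c ≡ src e × e ∈ E × Path (λ z → Ok z × z ≢ c) (next c e) es′ b)
    last-visit c (stop e) = inj₁ (stop e)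
    last-visit c {a} (step o s m p) with last-visit c p | a ≟ᴺ c
    ... | inj₂ r | _        = inj₂ r
    ... | inj₁ q | yes refl = inj₂ (_ , _ , o , s , m , q)
    ... | inj₁ q | no a≢c   = inj₁ (step (o , a≢c) s m q)

    shorten : ∀ m Ns → length Ns ≤ m → ∀ {a es b} → Path (_∈ Ns) a es b →
              ∃ λ es′ → length es′ ≤ m × Path (_∈ Ns) a es′ b
    shorten m Ns le (stop e) = [] , z≤n , stop e
    shorten zero [] z≤n (step () _ _ _)
    shorten (suc m) Ns le {a} (step o s k p) with last-visit a (step o s k p)
    ... | inj₁ (step (_ , a≢a) _ _ _) = contradiction refl a≢a
    ... | inj₂ (e , es′ , o′ , s′ , k′ , q) =
      let Ns′ = filter (λ z → ¬? (z ≟ᴺ a)) Ns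
          lt  = Listₚ.filter-notAll (λ z → ¬? (z ≟ᴺ a)) Ns (Any.map (λ { refl f → f refl }) o)
          es″ , le′ , q′ = shorten m Ns′ (ℕₚ.≤-pred (ℕₚ.≤-trans lt le))
                             (path-map (λ { (i , ne) → ∈-filter⁺ (λ z → ¬? (z ≟ᴺ a)) i ne }) q)
      in e ∷ es″ , s≤s le′ , step o′ s′ k′ (path-map (proj₁ ∘ ∈-filter⁻ (λ z → ¬? (z ≟ᴺ a))) q′)

    Low : ℕ → ℤ → Set
    Low T z = 0ℤ ℤ.≤ z × z ℤ.< + T

    nodes : ℕ → List Node
    nodes T = cartesianProduct (map src E) (vectors (map +_ (upTo T)) n)

    low-∈ : ∀ {T z} → Low T z → z ∈ map +_ (upTo T)
    low-∈ {T} {+ m} (_ , ℤ.+<+ lt) = ∈-map⁺ +_ (∈-upTo⁺ lt)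
    low-∈ { z = -[1+ m ] } (() , _)

    to-path : ∀ {T s m es} (x : Fin n → ℤ) → Walk s es m → es ⊆ E → (∀ j → Before (Low T) (W j) (x j) es) →
              Path (_∈ nodes T) (s , tabulate x) es (m , tabulate λ j → x j + ∑ (W j) es)
    to-path x (nil refl) s lo = stop (cong (_ ,_) (Vecₚ.tabulate-cong λ j → sym (ℤₚ.+-identityʳ (x j))))
    to-path {T} {es = e ∷ es} x (cons refl w) s lo = step
      (∈-cartesianProduct⁺ (∈-map⁺ src (s (here refl)))
        (∈-vectors (tabulate x) λ j → subst (_∈ map +_ (upTo T)) (sym (Vecₚ.lookup∘tabulate x j)) (low-∈ (proj₁ (lo j)))))
      refl (s (here refl))
      (subst (λ v → Path (_∈ nodes T) (tgt e , v) es (_ , tabulate λ j → x j + ∑ (W j) (e ∷ es))) (Vecₚ.tabulate-cong λ j → cong (_+ W j e) (sym (Vecₚ.lookup∘tabulate x j)))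
        (subst (λ v → Path (_∈ nodes T) (tgt e , tabulate λ j → x j + W j e) es (_ , v))
          (Vecₚ.tabulate-cong λ j → ℤₚ.+-assoc (x j) (W j e) _)
          (to-path (λ j → x j + W j e) w (s ∘ there) (proj₂ ∘ lo))))

    node-nonneg : ∀ {T s v} → (s , v) ∈ nodes T → ∀ j → 0ℤ ℤ.≤ Vec.lookup v j
    node-nonneg {T} {s} {v} m j = go v (proj₂ (∈-cartesianProduct⁻ (map src E) (vectors (map +_ (upTo T)) n) m)) j
      where
        go : ∀ {k} (v : Vec ℤ k) → v ∈ vectors (map +_ (upTo T)) k → ∀ j → 0ℤ ℤ.≤ Vec.lookup v j
        go {suc k} v i j with find (∈-concatMap⁻ (λ x → map (x Vec.∷_) (vectors (map +_ (upTo T)) k)) {xs = map +_ (upTo T)} i)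
        ... | x , x∈ , v∈ with ∈-map⁻ (x Vec.∷_) v∈ | ∈-map⁻ +_ x∈
        go {suc k} v i zero    | x , x∈ , v∈ | v′ , v′∈ , refl | y , _ , refl = +≤+ z≤n
        go {suc k} v i (suc j) | x , x∈ , v∈ | v′ , v′∈ , refl | y , _ , refl = go v′ v′∈ j

    from-path : ∀ {T s v es m v′} → Path (_∈ nodes T) (s , v) es (m , v′) → (∀ j → 0ℤ ℤ.≤ Vec.lookup v′ j) →
                WalkIn E s es m × (∀ j → Vec.lookup v′ j ≡ Vec.lookup v j + ∑ (W j) es) ×
                (∀ j → Safe (W j) (Vec.lookup v j) es)
    from-path (stop refl) nn = walkIn (nil refl) (λ ()) , (λ j → sym (ℤₚ.+-identityʳ _)) , nn
    from-path {v = v} {es = e ∷ es} (step o refl m p) nn =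
      let walkIn w s , eq , sf = from-path p nn
      in walkIn (cons refl w) (λ { (here refl) → m ; (there k) → s k })
       , (λ j → trans (eq j) (trans (cong (_+ ∑ (W j) es) (Vecₚ.lookup∘tabulate (λ j → Vec.lookup v j + W j e) j)) (ℤₚ.+-assoc (Vec.lookup v j) (W j e) _)))
       , (λ j → node-nonneg o j , subst (λ z → Safe (W j) z es) (Vecₚ.lookup∘tabulate (λ j → Vec.lookup v j + W j e) j) (sf j))

    first-exceeding : ∀ T es (x : Fin n → ℤ) → (∃ λ j → ¬ Below T (W j) (x j) es) →
      ∃₂ λ pre post → es ≡ pre ++ post × (∀ j → Before (ℤ._< + T) (W j) (x j) pre) ×
        (∃ λ j → + T ℤ.≤ x j + ∑ (W j) pre)
    first-exceeding T es x (j , ¬b) with any? (λ j → + T ℤₚ.≤? x j)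
    ... | yes (k , le) = [] , es , refl , (λ _ → tt) , k , subst (+ T ℤ.≤_) (sym (ℤₚ.+-identityʳ (x k))) le
    first-exceeding T [] x (j , ¬b) | no ¬e = contradiction (ℤₚ.≰⇒> (λ le → ¬e (j , le))) ¬b
    first-exceeding T (e ∷ es) x (j , ¬b) | no ¬e =
      let pre , post , eq , bf , k , le = first-exceeding T es (λ j → x j + W j e)
            (j , λ b → ¬b (ℤₚ.≰⇒> (λ le → ¬e (j , le)) , b))
      in e ∷ pre , post , cong (e ∷_) eq , (λ j → ℤₚ.≰⇒> (λ le → ¬e (j , le)) , bf j) , k ,
         subst (+ T ℤ.≤_) (ℤₚ.+-assoc (x k) (W k e) _) le

  before-× : ∀ {T} {w : Edge → ℤ} {x} pre {post} → Before (ℤ._< + T) w x pre → Safe w x (pre ++ post) →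
             Before (λ z → 0ℤ ℤ.≤ z × z ℤ.< + T) w x pre
  before-× []        _       _       = tt
  before-× (e ∷ pre) (b , c) (p , s) = (p , b) , before-× pre c s

  record ShortRun {n : ℕ} (W : Fin n → Edge → ℤ) (C L : ℕ) (s : State) (x : Fin n → ℤ) : Set where
    field
      {word}  : List Edge
      {final} : State
      is-walk : WalkIn E s word final
      short   : length word ≤ L
      is-safe : ∀ j → Safe (W j) (x j) word
      high    : ∀ j → + C ℤ.≤ x j + ∑ (W j) word

  record Thresholds {n : ℕ} (W : Fin n → Edge → ℤ) (C : ℕ) : Set where
    field
      T L     : ℕ
      extract : ∀ {s es t} (x : Fin n → ℤ) → WalkIn E s es t → (∀ j → Safe (W j) (x j) es) →
                (∀ j → ¬ Below T (W j) (x j) es) → ShortRun W C L s x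

  -- Induction on the number of counters. Until some counter `k` first reaches `T`, all
  -- configurations lie in `nodes T`, so removing repetitions bounds this prefix. From there on `k`
  -- is left out and the claim for the other counters is applied to the rest of the walk.
  rackoff : ∀ n (W : Fin n → Edge → ℤ) C → Thresholds W C
  rackoff zero    W C = record { T = 0 ; L = 0 ; extract = λ x _ _ _ → record
    { is-walk = walkIn (nil refl) (λ ()) ; short = z≤n ; is-safe = λ () ; high = λ () } }
  rackoff (suc n) W C = record { T = T ; L = length (nodes T) ℕ.+ L* ; extract = ex }
    where
      open Configurations W
      sub : (j : Fin (suc n)) → Thresholds (W ∘ punchIn j) C
      sub j = rackoff n (W ∘ punchIn j) C
      L* T* D T : ℕ
      L* = total (Thresholds.L ∘ sub)
      T* = total (Thresholds.T ∘ sub)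
      D  = total (λ j → norm (W j) E)
      -- `L* * D` is the most that `k` can lose in the remaining `L*` steps, so it ends no lower
      -- than `C`. The summand `T*` makes `T` dominate every threshold of the induction hypothesis.
      T  = C ℕ.+ L* ℕ.* D ℕ.+ T*
      ex : ∀ {s es t} (x : Fin (suc n) → ℤ) → WalkIn E s es t → (∀ j → Safe (W j) (x j) es) →
           (∀ j → ¬ Below T (W j) (x j) es) → ShortRun W C (length (nodes T) ℕ.+ L*) s x
      ex {s} {es} x (walkIn w s⊆) sf ¬b with first-exceeding T es x (zero , ¬b zero)
      ... | pre , post , refl , bf , k , le with walk-++⁻ pre w
      ... | m , u , v with shorten _ (nodes T) ℕₚ.≤-refl
                             (to-path {T} x u (s⊆ ∘ ∈-++⁺ˡ) (λ j → before-× pre (bf j) (sf j)))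
      ... | pre′ , short′ , path with from-path {T} path (λ j → subst (0ℤ ℤ.≤_) (sym (Vecₚ.lookup∘tabulate (λ j → x j + ∑ (W j) pre) j))
                                         (along-head (W j) post (proj₂ (along-++⁻ (W j) pre (sf j)))))
      ... | walkIn u′ u′⊆ , eq , sf′ = record
        { is-walk = walkIn (walk-++ u′ (walk R-walk)) (++-⊆ u′⊆ (edges-⊆ R-walk))
        ; short   = subst (_≤ length (nodes T) ℕ.+ L*) (sym (Listₚ.length-++ pre′))
                      (ℕₚ.+-mono-≤ short′ R-short)
        ; is-safe = λ j → along-++ (W j) pre′ (subst (λ z → Safe (W j) z pre′) (Vecₚ.lookup∘tabulate x j) (sf′ j))
                            (subst (λ z → Safe (W j) z (ShortRun.word R)) (y≡ j) (proj₁ (tail j)))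
        ; high    = λ j → subst (+ C ℤ.≤_) (trans (cong (_+ ∑ (W j) (ShortRun.word R)) (y≡ j))
                            (trans (ℤₚ.+-assoc (x j) _ _) (cong (_+_ (x j)) (sym (∑-++ (W j) pre′ _))))) (proj₂ (tail j)) }
        where
          y : Fin (suc n) → ℤ
          y j = x j + ∑ (W j) pre
          y≡ : ∀ j → y j ≡ x j + ∑ (W j) pre′
          y≡ j = trans (sym (Vecₚ.lookup∘tabulate y j)) (trans (eq j) (cong (_+ ∑ (W j) pre′) (Vecₚ.lookup∘tabulate x j)))
          Tk≤T : Thresholds.T (sub k) ≤ T
          Tk≤T = ℕₚ.≤-trans (≤-total (Thresholds.T ∘ sub) k) (ℕₚ.m≤n+m T* (C ℕ.+ L* ℕ.* D))
          R : ShortRun (W ∘ punchIn k) C (Thresholds.L (sub k)) m (y ∘ punchIn k)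
          R = Thresholds.extract (sub k) (y ∘ punchIn k) (walkIn v (s⊆ ∘ ∈-++⁺ʳ pre))
                (λ i → proj₂ (along-++⁻ (W (punchIn k i)) pre (sf (punchIn k i))))
                (λ i b → ¬b (punchIn k i) (before-++ (W (punchIn k i)) pre (bf (punchIn k i))
                  (along-map (W (punchIn k i)) (λ lt → ℤₚ.<-≤-trans lt (+≤+ Tk≤T)) post b)))
          open ShortRun R using () renaming (is-walk to R-walk)
          R-short : length (ShortRun.word R) ≤ L*
          R-short = ℕₚ.≤-trans (ShortRun.short R) (≤-total (Thresholds.L ∘ sub) k)
          Rw : List Edge
          Rw = ShortRun.word R
          at-k : Along (+ C ℤ.≤_) (W k) (y k) Rw
          at-k = along-high (W k) (+ C) Rw (begin
            + norm (W k) Rw             ≤⟨ +≤+ (norm-length (W k) Rw (edges-⊆ R-walk)) ⟩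
            + (length Rw ℕ.* norm (W k) E) ≤⟨ +≤+ (ℕₚ.*-mono-≤ R-short (≤-total (λ j → norm (W j) E) k)) ⟩
            + (L* ℕ.* D)                ≡⟨ r (+ C) (+ (L* ℕ.* D)) ⟩
            + (C ℕ.+ L* ℕ.* D) - + C    ≤⟨ ℤₚ.+-monoˡ-≤ (- (+ C)) (ℤₚ.≤-trans (+≤+ (ℕₚ.m≤m+n _ T*)) le) ⟩
            y k - + C ∎)
            where open ℤₚ.≤-Reasoning
                  r : ∀ c l → l ≡ c + l - c
                  r = solve-∀
          tail : ∀ j → Safe (W j) (y j) Rw × + C ℤ.≤ y j + ∑ (W j) Rw
          tail j with k Finₚ.≟ j
          ... | yes refl = along-map (W k) (ℤₚ.≤-trans (+≤+ z≤n)) Rw at-k , along-last (W k) Rw at-k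
          ... | no k≢j   = subst (λ j → Safe (W j) (y j) Rw × + C ℤ.≤ y j + ∑ (W j) Rw) (punchIn-punchOut k≢j)
                             (ShortRun.is-safe R (punchOut k≢j) , ShortRun.high R (punchOut k≢j))

-- Pumping loops against bounded counters

words : {A : Set} → List A → ℕ → List (List A)
words E zero    = [ [] ]
words E (suc m) = [] ∷ concatMap (λ e → map (e ∷_) (words E m)) E

∈-words : {A : Set} {E : List A} (m : ℕ) (es : List A) → es ⊆ E → length es ≤ m → es ∈ words E m
∈-words zero    []       s le       = here refl
∈-words (suc m) []       s le       = here refl
∈-words (suc m) (e ∷ es) s (s≤s le) =
  there (∈-concatMap⁺ (λ e → map (e ∷_) (words _ m)) (Any.map (λ { refl → ∈-map⁺ (e ∷_) (∈-words m es (s ∘ there) le) }) (s (here refl))))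

words-⊆ : {A : Set} {E : List A} (m : ℕ) {es : List A} → es ∈ words E m → es ⊆ E
words-⊆ zero    (here refl) ()
words-⊆ (suc m) (here refl) ()
words-⊆ {E = E} (suc m) (there k) j with find (∈-concatMap⁻ (λ e → map (e ∷_) (words E m)) {xs = E} k)
... | e , e∈ , i with ∈-map⁻ (e ∷_) i
words-⊆ (suc m) (there k) (here refl) | e , e∈ , i | es , es∈ , refl = e∈
words-⊆ (suc m) (there k) (there j)   | e , e∈ , i | es , es∈ , refl = words-⊆ m es∈ j

module Pumping {State Edge : Set} (src tgt : Edge → State) (_≟_ : DecidableEquality State) (E : List Edge) where

  open Graph src tgt
  open Rackoff src tgt _≟_ E

  walk? : ∀ p es q → Dec (Walk p es q)
  walk? p [] q       = map′ nil (λ { (nil e) → e }) (p ≟ q)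
  walk? p (e ∷ es) q = map′ (λ { (a , b) → cons a b }) (λ { (cons a b) → a , b }) (p ≟ src e ×-dec walk? (tgt e) es q)

  walk-end : ∀ {p es q} → Walk p es q → es ⊆ E → q ≡ p ⊎ ∃ λ e → e ∈ E × q ≡ tgt e
  walk-end (nil e) s = inj₁ (sym e)
  walk-end (cons e w) s with walk-end w (s ∘ there)
  ... | inj₁ eq = inj₂ (_ , s (here refl) , eq)
  ... | inj₂ r  = inj₂ r

  short-returns : ∀ {p} → (∀ {e} → e ∈ E → ∃ λ X → WalkIn E (tgt e) X p) →
                  ∃ λ R → ∀ {e} → e ∈ E → ∃ λ X → WalkIn E (tgt e) X p × length X ≤ R
  short-returns {p} ret = go E id
    where
      go : ∀ F → F ⊆ E → ∃ λ R → ∀ {e} → e ∈ F → ∃ λ X → WalkIn E (tgt e) X p × length X ≤ R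
      go []      s = 0 , λ ()
      go (f ∷ F) s =
        let X , w = ret (s (here refl))
            R , h = go F (s ∘ there)
        in length X ℕ.+ R , λ where
             (here refl) → X , w , ℕₚ.m≤m+n _ R
             (there m)   → let Y , v , le = h m in Y , v , ℕₚ.≤-trans le (ℕₚ.m≤n+m R _)

  record Pump {n : ℕ} (W : Fin n → Edge → ℤ) (a : Fin n → ℕ) (p : State) : Set where
    field
      {loop}    : List Edge
      loop-walk : WalkIn E p loop p
      loop-safe : ∀ j → Safe (W j) (+ a j) loop
      loop-gain : ∀ j → 1ℤ ℤ.≤ ∑ (W j) loop

  Trapped : {n : ℕ} (W : Fin n → Edge → ℤ) (a : Fin n → ℕ) (p : State) (T : ℕ) → Set
  Trapped W a p T = ∀ {ρ t} → WalkIn E p ρ t → (∀ j → Safe (W j) (+ a j) ρ) → ∃ λ j → Below T (W j) (+ a j) ρ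

  -- The alternative is decided by a search among the finitely many words of length at most `L + R`.
  -- If none of them pumps, no walk exceeds `T` on every counter: Rackoff's extraction followed by a
  -- return to `p` would produce such a word.
  pump-or-trapped : ∀ {n} (W : Fin n → Edge → ℤ) (a : Fin n → ℕ) p →
    (∀ {e} → e ∈ E → ∃ λ X → WalkIn E (tgt e) X p) → Pump W a p ⊎ ∃ (Trapped W a p)
  pump-or-trapped {n} W a p ret with short-returns ret
  ... | R , back = decide
    where
      D C : ℕ
      D = total (λ j → norm (W j) E)
      -- A return of length at most `R` costs at most `R * D`, which leaves every counter at least
      -- one above its initial value `a j`.
      C = total a ℕ.+ 1 ℕ.+ R ℕ.* D
      open Thresholds (rackoff n W C)
      Good : List Edge → Set
      Good u = Walk p u p × (∀ j → Safe (W j) (+ a j) u × 1ℤ ℤ.≤ ∑ (W j) u)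
      good? : ∀ u → Dec (Good u)
      good? u = walk? p u p ×-dec all? λ j → along? (W j) (0ℤ ℤₚ.≤?_) (+ a j) u ×-dec (1ℤ ℤₚ.≤? ∑ (W j) u)
      extend : ∀ {t X} (r : ShortRun W C L p (λ j → + a j)) → ShortRun.final r ≡ t → WalkIn E t X p → length X ≤ R →
               ∃ λ u → u ∈ words E (L ℕ.+ R) × Good u
      extend {X = X} r refl (walkIn w s) le = word ++ X ,
          ∈-words (L ℕ.+ R) (word ++ X) (++-⊆ (edges-⊆ is-walk) s)
            (subst (_≤ L ℕ.+ R) (sym (Listₚ.length-++ word)) (ℕₚ.+-mono-≤ short le)) ,
          walk-++ (walk is-walk) w , λ j →
            along-++ (W j) word (is-safe j) (along-map (W j) (ℤₚ.≤-trans (+≤+ z≤n)) X (stays j)) ,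
            (begin
               1ℤ                                   ≡⟨ r₁ (+ a j) ⟩
               + (a j ℕ.+ 1) - + a j                ≤⟨ ℤₚ.+-monoˡ-≤ (- (+ a j)) (along-last (W j) X (stays j)) ⟩
               + a j + ∑ (W j) word + ∑ (W j) X - + a j ≡⟨ r₂ (+ a j) (∑ (W j) word) (∑ (W j) X) ⟩
               ∑ (W j) word + ∑ (W j) X             ≡⟨ sym (∑-++ (W j) word X) ⟩
               ∑ (W j) (word ++ X) ∎)
        where
          open ShortRun r
          open ℤₚ.≤-Reasoning
          r₁ : ∀ a → 1ℤ ≡ a + 1ℤ - a
          r₁ = solve-∀
          r₂ : ∀ a x y → a + x + y - a ≡ x + y
          r₂ = solve-∀
          r₃ : ∀ a n → n ≡ a + n - a
          r₃ = solve-∀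
          stays : ∀ j → Along (+ (a j ℕ.+ 1) ℤ.≤_) (W j) (+ a j + ∑ (W j) word) X
          stays j = along-high (W j) (+ (a j ℕ.+ 1)) X (begin
            + norm (W j) X            ≤⟨ +≤+ (norm-length (W j) X s) ⟩
            + (length X ℕ.* norm (W j) E) ≤⟨ +≤+ (ℕₚ.*-mono-≤ le (≤-total (λ j → norm (W j) E) j)) ⟩
            + (R ℕ.* D)               ≡⟨ r₃ (+ (a j ℕ.+ 1)) (+ (R ℕ.* D)) ⟩
            + (a j ℕ.+ 1 ℕ.+ R ℕ.* D) - + (a j ℕ.+ 1)
              ≤⟨ ℤₚ.+-monoˡ-≤ (- (+ (a j ℕ.+ 1))) (+≤+ (ℕₚ.+-monoˡ-≤ (R ℕ.* D) (ℕₚ.+-monoˡ-≤ 1 (≤-total a j)))) ⟩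
            + C - + (a j ℕ.+ 1)       ≤⟨ ℤₚ.+-monoˡ-≤ (- (+ (a j ℕ.+ 1))) (high j) ⟩
            + a j + ∑ (W j) word - + (a j ℕ.+ 1) ∎)
      decide : Pump W a p ⊎ ∃ (Trapped W a p)
      decide with Any.any? good? (words E (L ℕ.+ R))
      ... | yes y = let u , u∈ , w , h = find y in inj₁ (record
              { loop-walk = walkIn w (words-⊆ (L ℕ.+ R) u∈) ; loop-safe = proj₁ ∘ h ; loop-gain = proj₂ ∘ h })
      ... | no none = inj₂ (T , λ {ρ} w sf → trap ρ w sf)
        where
          trap : ∀ ρ {t} → WalkIn E p ρ t → (∀ j → Safe (W j) (+ a j) ρ) → ∃ λ j → Below T (W j) (+ a j) ρ
          trap ρ w sf with any? (λ j → along? (W j) (ℤₚ._<? + T) (+ a j) ρ)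
          ... | yes y = y
          ... | no ¬b with extract (λ j → + a j) w sf (λ j b → ¬b (j , b))
          ... | r with walk-end (walk (ShortRun.is-walk r)) (edges-⊆ (ShortRun.is-walk r))
          ... | inj₁ eq = let u , m , g = extend r eq (walkIn (nil refl) (λ ())) z≤n in ⊥-elim (none (Any.map (λ { refl → g }) m))
          ... | inj₂ (e , e∈ , eq) =
            let X , v , le = back e∈
                u , m , g = extend r eq v le
            in ⊥-elim (none (Any.map (λ { refl → g }) m))

module TwoWayPumping {State Edge : Set} (src tgt : Edge → State) (_≟_ : DecidableEquality State) (E : List Edge) where

  open Graph src tgt
  open Pumping src tgt _≟_ E public using (Pump; Trapped; pump-or-trapped)

  private
    module Bwd = Graph tgt src
    module BwdPumping = Pumping tgt src _≟_ E

  reverse-⊆ : ∀ {es F : List Edge} → es ⊆ F → reverse es ⊆ F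
  reverse-⊆ s m = s (Anyₚ.reverse⁻ m)

  walk-reverse : ∀ {p es q} → Walk p es q → Bwd.Walk q (reverse es) p
  walk-reverse (nil e) = Bwd.nil (sym e)
  walk-reverse {p} {e ∷ es} {q} (cons refl w) =
    subst (λ ys → Bwd.Walk q ys p) (sym (Listₚ.unfold-reverse e es)) (Bwd.walk-++ (walk-reverse w) (Bwd.walk-edge e))

  walk-reverse⁻ : ∀ {p es q} → Bwd.Walk p es q → Walk q (reverse es) p
  walk-reverse⁻ (Bwd.nil e) = nil (sym e)
  walk-reverse⁻ {p} {e ∷ es} {q} (Bwd.cons refl w) =
    subst (λ ys → Walk q ys p) (sym (Listₚ.unfold-reverse e es)) (walk-++ (walk-reverse⁻ w) (walk-edge e))

  along-cong : ∀ {P : ℤ → Set} {w w′ : Edge → ℤ} → (∀ e → w e ≡ w′ e) → ∀ {x x′} → x ≡ x′ → ∀ es → Along P w x es → Along P w′ x′ es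
  along-cong eq refl []       p       = p
  along-cong eq {x} refl (e ∷ es) (p , a) = p , along-cong eq (cong (_+_ x) (eq e)) es a

  record BackPump {n : ℕ} (W : Fin n → Edge → ℤ) (b : Fin n → ℕ) (q : State) : Set where
    field
      {loop}    : List Edge
      loop-walk : WalkIn E q loop q
      loop-safe : ∀ j → Safe (W j) (+ b j - ∑ (W j) loop) loop
      loop-loss : ∀ j → 1ℤ ℤ.≤ - ∑ (W j) loop

  BackTrapped : {n : ℕ} (W : Fin n → Edge → ℤ) (b : Fin n → ℕ) (q : State) (T : ℕ) → Set
  BackTrapped {n} W b q T = ∀ {ρ t} (x : Fin n → ℤ) → WalkIn E t ρ q → (∀ j → x j + ∑ (W j) ρ ≡ + b j) →
    (∀ j → Safe (W j) (x j) ρ) → ∃ λ j → Below T (W j) (x j) ρ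

  -- The forward dichotomy on the graph with `src` and `tgt` exchanged and effects negated;
  -- `along-reverse` carries loops and bounded runs across.
  back-pump-or-trapped : ∀ {n} (W : Fin n → Edge → ℤ) (b : Fin n → ℕ) q →
    (∀ {e} → e ∈ E → ∃ λ X → WalkIn E q X (src e)) → BackPump W b q ⊎ ∃ (BackTrapped W b q)
  back-pump-or-trapped W b q ret
    with BwdPumping.pump-or-trapped (λ j e → - W j e) b q
           (λ m → let X , walkIn w s = ret m in reverse X , Bwd.walkIn (walk-reverse w) (reverse-⊆ s))
  ... | inj₁ record { loop = u ; loop-walk = w ; loop-safe = sf ; loop-gain = g } = inj₁ record
        { loop = reverse u
        ; loop-walk = walkIn (walk-reverse⁻ (Bwd.walk w)) (reverse-⊆ (Bwd.edges-⊆ w))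
        ; loop-safe = λ j → along-cong (λ e → ℤₚ.neg-involutive (W j e))
            (cong (_+_ (+ b j)) (trans (∑-neg (W j) u) (cong -_ (sym (∑-reverse (W j) u))))) (reverse u)
            (along-reverse (λ e → - W j e) (+ b j) u (sf j))
        ; loop-loss = λ j → subst (1ℤ ℤ.≤_) (trans (∑-neg (W j) u) (cong -_ (sym (∑-reverse (W j) u)))) (g j) }
  ... | inj₂ (T , tr) = inj₂ (T , λ {ρ} x w eq sf →
        let j , bl = tr {reverse ρ} (Bwd.walkIn (walk-reverse (walk w)) (reverse-⊆ (edges-⊆ w)))
                        (λ j → subst (λ z → Safe (-_ ∘ W j) z (reverse ρ)) (eq j) (along-reverse (W j) (x j) ρ (sf j)))
        in j , subst (Below T (W j) (x j)) (Listₚ.reverse-involutive ρ)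
                 (along-cong (λ e → ℤₚ.neg-involutive (W j e))
                   (trans (cong₂ _+_ (sym (eq j)) (trans (∑-neg (W j) (reverse ρ)) (cong -_ (∑-reverse (W j) ρ)))) (r (x j) (∑ (W j) ρ)))
                   (reverse (reverse ρ))
                   (along-reverse (-_ ∘ W j) (+ b j) (reverse ρ) bl)))
    where r : ∀ x s → x + s + - s ≡ x
          r = solve-∀

-- Nonnegativity of iterated words

module _ {A : Set} (w : A → ℤ) where

  safe-mono : ∀ {x y} → x ℤ.≤ y → ∀ es → Safe w x es → Safe w y es
  safe-mono le []       p       = ℤₚ.≤-trans p le
  safe-mono le (e ∷ es) (p , a) = ℤₚ.≤-trans p le , safe-mono (ℤₚ.+-monoˡ-≤ (w e) le) es a

  safe-high : ∀ {x n} es → norm w es ≤ n → + n ℤ.≤ x → Safe w x es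
  safe-high {x} es le h = along-high w 0ℤ es (subst (+ norm w es ℤ.≤_) (sym (ℤₚ.+-identityʳ x)) (ℤₚ.≤-trans (+≤+ le) h))

  -- In the hypothesis, `j` copies of `u` precede the current one and `m` are still to come. Both
  -- numbers are supplied because values in between are estimated by combinations of the two ends.
  safe-times : ∀ n u x → (∀ m j → n ≡ suc m ℕ.+ j → Safe w (x + + j * ∑ w u) u) → 0ℤ ℤ.≤ x + + n * ∑ w u →
               Safe w x (times n u)
  safe-times zero    u x h e = subst (0ℤ ℤ.≤_) (ℤₚ.+-identityʳ x) e
  safe-times (suc n) u x h e = along-++ w u (subst (λ z → Safe w z u) (ℤₚ.+-identityʳ x) (h n 0 (cong suc (sym (ℕₚ.+-identityʳ n)))))
    (safe-times n u (x + ∑ w u)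
      (λ m j eq → subst (λ z → Safe w z u) (r x (+ j) (∑ w u)) (h m (suc j) (trans (cong suc eq) (cong suc (sym (ℕₚ.+-suc m j))))))
      (subst (0ℤ ℤ.≤_) (r x (+ n) (∑ w u)) e))
    where r : ∀ x j s → x + (1ℤ + j) * s ≡ x + s + j * s
          r = solve-∀

convex : ∀ (a m j : ℕ) {p q} → 1ℤ ℤ.≤ p → 1ℤ ℤ.≤ q → + (m ℕ.+ j) ℤ.≤ + a + (+ m * p + + j * q)
convex a m j {p} {q} 1≤p 1≤q = begin
  + m + + j                 ≡⟨ sym (cong₂ _+_ (ℤₚ.*-identityʳ (+ m)) (ℤₚ.*-identityʳ (+ j))) ⟩
  + m * 1ℤ + + j * 1ℤ       ≤⟨ ℤₚ.+-mono-≤ (ℤₚ.*-monoˡ-≤-nonNeg (+ m) 1≤p) (ℤₚ.*-monoˡ-≤-nonNeg (+ j) 1≤q) ⟩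
  + m * p + + j * q         ≡⟨ sym (ℤₚ.+-identityˡ _) ⟩
  0ℤ + (+ m * p + + j * q)  ≤⟨ ℤₚ.+-monoˡ-≤ (+ m * p + + j * q) (+≤+ (z≤n {a})) ⟩
  + a + (+ m * p + + j * q) ∎
  where open ℤₚ.≤-Reasoning

-- For positive `h` the factor `K` outweighs `s`; for `h` zero the sign of `s` must be known, and
-- this is where a pump enters.
dominated : ∀ (K h : ℕ) s → suc ∣ s ∣ ≤ K → (h ≡ 0 → 1ℤ ℤ.≤ s) → 1ℤ ℤ.≤ + K * + h + s
dominated K zero    s le f = subst (1ℤ ℤ.≤_) (sym (trans (cong (_+ s) (ℤₚ.*-zeroʳ (+ K))) (ℤₚ.+-identityˡ s))) (f refl)
dominated K (suc h) s le f = begin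
  1ℤ                         ≡⟨ r (+ ∣ s ∣) ⟩
  + suc ∣ s ∣ + - + ∣ s ∣    ≤⟨ ℤₚ.+-mono-≤ (+≤+ (ℕₚ.≤-trans le (ℕₚ.m≤m*n K (suc h)))) (-∣i∣≤i s) ⟩
  + (K ℕ.* suc h) + s        ≡⟨ cong (_+ s) (ℤₚ.pos-* K (suc h)) ⟩
  + K * + suc h + s ∎
  where
    open ℤₚ.≤-Reasoning
    r : ∀ z → 1ℤ ≡ 1ℤ + z + - z
    r = solve-∀

-- One counter along u ⁿ ℓ ⁿ W v ⁿ: at every loop boundary its value is a convex combination of
-- quantities that are at least n, unless the counter is bounded at the start (resp. at the end)
-- and u (resp. v) is safe for it.
module Counter {A : Set} (w : A → ℤ) (a b ha hb K n : ℕ) (u ℓ W v : List A) {σ : ℤ}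
  (spine-eq : + b ≡ + a + ∑ w W)
  (hom-eq   : + hb ≡ + ha + σ)
  (balance  : ∑ w u + ∑ w ℓ + ∑ w v ≡ + K * σ)
  (pump     : ha ≡ 0 → Safe w (+ a) u × 1ℤ ℤ.≤ ∑ w u)
  (back     : hb ≡ 0 → Safe w (+ b - ∑ w v) v × 1ℤ ℤ.≤ - ∑ w v)
  (K-u      : suc ∣ ∑ w u ∣ ≤ K)
  (K-v      : suc ∣ ∑ w v ∣ ≤ K)
  (n-u      : norm w u ≤ n) (n-ℓ : norm w ℓ ≤ n) (n-W : norm w W ≤ n) (n-v : norm w v ≤ n) where

  private
    -- Slopes in `n`: the counter is `a + n α` after `u ⁿ` and `a + n β` after `ℓ ⁿ`.
    α β : ℤ
    α = + K * + ha + ∑ w u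
    β = + K * + hb + - ∑ w v

    1≤α : 1ℤ ℤ.≤ α
    1≤α = dominated K ha (∑ w u) K-u (proj₂ ∘ pump)

    1≤β : 1ℤ ℤ.≤ β
    1≤β = dominated K hb (- ∑ w v) (subst (λ z → suc z ≤ K) (sym (ℤₚ.∣-i∣≡∣i∣ (∑ w v))) K-v) (proj₂ ∘ back)

    loop-effect : α + ∑ w ℓ ≡ β
    loop-effect = begin
      + K * + ha + ∑ w u + ∑ w ℓ                            ≡⟨ r₁ (+ K * + ha) (∑ w u) (∑ w ℓ) (∑ w v) ⟩
      + K * + ha + (∑ w u + ∑ w ℓ + ∑ w v) + - ∑ w v        ≡⟨ cong (λ z → + K * + ha + z + - ∑ w v) balance ⟩
      + K * + ha + + K * σ + - ∑ w v                        ≡⟨ r₂ (+ K) (+ ha) σ (- ∑ w v) ⟩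
      + K * (+ ha + σ) + - ∑ w v                            ≡⟨ cong (λ z → + K * z + - ∑ w v) (sym hom-eq) ⟩
      β ∎
      where
        open ≡-Reasoning
        r₁ : ∀ k u l v → k + u + l ≡ k + (u + l + v) + - v
        r₁ = solve-∀
        r₂ : ∀ k h s v → k * h + k * s + v ≡ k * (h + s) + v
        r₂ = solve-∀

    x₀ : ℤ
    x₀ = + a + + n * (+ K * + ha)

    1≤K* : ∀ h → h ≢ 0 → 1ℤ ℤ.≤ + K * + h
    1≤K* zero    h≢0 = contradiction refl h≢0
    1≤K* (suc h) _   = subst (1ℤ ℤ.≤_) (ℤₚ.pos-* K (suc h)) (+≤+ (ℕₚ.≤-trans (ℕₚ.≤-trans (s≤s z≤n) K-u) (ℕₚ.m≤m*n K (suc h))))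

    along-u : ∀ m j → n ≡ suc m ℕ.+ j → Safe w (x₀ + + j * ∑ w u) u
    along-u m j eq with ha ℕ.≟ 0
    ... | no ha≢0 = safe-high w u n-u (begin
        + n                                          ≡⟨ cong +_ eq ⟩
        + (suc m ℕ.+ j)                              ≤⟨ convex a (suc m) j (1≤K* ha ha≢0) 1≤α ⟩
        + a + (+ suc m * (+ K * + ha) + + j * α)     ≡⟨ r (+ a) (+ suc m) (+ j) (+ K * + ha) (∑ w u) ⟩
        + a + + (suc m ℕ.+ j) * (+ K * + ha) + + j * ∑ w u
          ≡⟨ cong (λ z → + a + + z * (+ K * + ha) + + j * ∑ w u) (sym eq) ⟩
        x₀ + + j * ∑ w u ∎)
      where
        open ℤₚ.≤-Reasoning
        r : ∀ a m j k s → a + (m * k + j * (k + s)) ≡ a + (m + j) * k + j * s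
        r = solve-∀
    ... | yes ha≡0 = safe-mono w (begin
        + a                                  ≡⟨ r (+ a) ⟩
        + a + 0ℤ + 0ℤ                        ≤⟨ ℤₚ.+-mono-≤ (ℤₚ.+-monoʳ-≤ (+ a) (ℤₚ.≤-reflexive (sym z))) gain ⟩
        x₀ + + j * ∑ w u ∎) u (proj₁ (pump ha≡0))
      where
        open ℤₚ.≤-Reasoning
        r : ∀ a → a ≡ a + 0ℤ + 0ℤ
        r = solve-∀
        z : + n * (+ K * + ha) ≡ 0ℤ
        z = trans (cong (λ h → + n * (+ K * + h)) ha≡0) (trans (cong (+ n *_) (ℤₚ.*-zeroʳ (+ K))) (ℤₚ.*-zeroʳ (+ n)))
        gain : 0ℤ ℤ.≤ + j * ∑ w u
        gain = subst (ℤ._≤ + j * ∑ w u) (ℤₚ.*-zeroʳ (+ j)) (ℤₚ.*-monoˡ-≤-nonNeg (+ j) (ℤₚ.≤-trans (+≤+ z≤n) (proj₂ (pump ha≡0))))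

    after-u : x₀ + + n * ∑ w u ≡ + a + + n * α
    after-u = r (+ a) (+ n) (+ K * + ha) (∑ w u)
      where r : ∀ a n k s → a + n * k + n * s ≡ a + n * (k + s)
            r = solve-∀

    large : ∀ a {p} → 1ℤ ℤ.≤ p → + n ℤ.≤ + a + + n * p
    large a {p} h = ℤₚ.≤-trans (convex a 0 n h h)
      (ℤₚ.≤-reflexive (cong (_+_ (+ a)) (trans (cong (_+ + n * p) (ℤₚ.*-zeroˡ p)) (ℤₚ.+-identityˡ (+ n * p)))))

    along-ℓ : ∀ m j → n ≡ suc m ℕ.+ j → Safe w (+ a + + n * α + + j * ∑ w ℓ) ℓ
    along-ℓ m j eq = safe-high w ℓ n-ℓ (begin
        + n                                        ≡⟨ cong +_ eq ⟩
        + (suc m ℕ.+ j)                            ≤⟨ convex a (suc m) j 1≤α 1≤β ⟩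
        + a + (+ suc m * α + + j * β)              ≡⟨ cong (λ z → + a + (+ suc m * α + + j * z)) (sym loop-effect) ⟩
        + a + (+ suc m * α + + j * (α + ∑ w ℓ))    ≡⟨ r (+ a) (+ suc m) (+ j) α (∑ w ℓ) ⟩
        + a + + (suc m ℕ.+ j) * α + + j * ∑ w ℓ    ≡⟨ cong (λ z → + a + + z * α + + j * ∑ w ℓ) (sym eq) ⟩
        + a + + n * α + + j * ∑ w ℓ ∎)
      where
        open ℤₚ.≤-Reasoning
        r : ∀ a m j k s → a + (m * k + j * (k + s)) ≡ a + (m + j) * k + j * s
        r = solve-∀

    after-ℓ : + a + + n * α + + n * ∑ w ℓ ≡ + a + + n * β
    after-ℓ = trans (r (+ a) (+ n) α (∑ w ℓ)) (cong (λ z → + a + + n * z) loop-effect)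
      where r : ∀ a n k s → a + n * k + n * s ≡ a + n * (k + s)
            r = solve-∀

    after-W : + a + + n * β + ∑ w W ≡ + b + + n * β
    after-W = trans (r (+ a) (+ n * β) (∑ w W)) (cong (_+ + n * β) (sym spine-eq))
      where r : ∀ a x s → a + x + s ≡ a + s + x
            r = solve-∀

    along-v : ∀ m j → n ≡ suc m ℕ.+ j → Safe w (+ b + + n * β + + j * ∑ w v) v
    along-v m j eq with hb ℕ.≟ 0
    ... | no hb≢0 = safe-high w v n-v (begin
        + n                                              ≡⟨ cong +_ eq ⟩
        + (suc m ℕ.+ j)                                  ≤⟨ convex b (suc m) j 1≤β (1≤K* hb hb≢0) ⟩
        + b + (+ suc m * β + + j * (+ K * + hb))         ≡⟨ r (+ b) (+ suc m) (+ j) (+ K * + hb) (∑ w v) ⟩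
        + b + + (suc m ℕ.+ j) * β + + j * ∑ w v          ≡⟨ cong (λ z → + b + + z * β + + j * ∑ w v) (sym eq) ⟩
        + b + + n * β + + j * ∑ w v ∎)
      where
        open ℤₚ.≤-Reasoning
        r : ∀ b m j k s → b + (m * (k + - s) + j * k) ≡ b + (m + j) * (k + - s) + j * s
        r = solve-∀
    -- Each of the `m` copies still to come lowers the counter, so this copy starts at least as high
    -- as the last one, which starts at `b - ∑ w v`.
    ... | yes hb≡0 = safe-mono w (begin
        + b - ∑ w v                              ≡⟨ r₁ (+ b) (∑ w v) ⟩
        + b + - ∑ w v + 0ℤ                       ≤⟨ ℤₚ.+-monoʳ-≤ (+ b + - ∑ w v) gain ⟩
        + b + - ∑ w v + + m * - ∑ w v            ≡⟨ r₂ (+ b) (+ m) (+ j) (∑ w v) ⟩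
        + b + (+ suc m + + j) * (0ℤ + - ∑ w v) + + j * ∑ w v
          ≡⟨ cong₂ (λ x y → + b + + x * (y + - ∑ w v) + + j * ∑ w v) (sym eq) (sym z) ⟩
        + b + + n * β + + j * ∑ w v ∎) v (proj₁ (back hb≡0))
      where
        open ℤₚ.≤-Reasoning
        r₁ : ∀ b s → b - s ≡ b + - s + 0ℤ
        r₁ = solve-∀
        r₂ : ∀ b m j s → b + - s + m * - s ≡ b + (1ℤ + m + j) * (0ℤ + - s) + j * s
        r₂ = solve-∀
        z : + K * + hb ≡ 0ℤ
        z = trans (cong (λ h → + K * + h) hb≡0) (ℤₚ.*-zeroʳ (+ K))
        gain : 0ℤ ℤ.≤ + m * - ∑ w v
        gain = subst (ℤ._≤ + m * - ∑ w v) (ℤₚ.*-zeroʳ (+ m)) (ℤₚ.*-monoˡ-≤-nonNeg (+ m) (ℤₚ.≤-trans (+≤+ z≤n) (proj₂ (back hb≡0))))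

    after-v : + b + + n * β + + n * ∑ w v ≡ + b + + n * (+ K * + hb)
    after-v = r (+ b) (+ n) (+ K * + hb) (∑ w v)
      where r : ∀ b n k s → b + n * (k + - s) + n * s ≡ b + n * k
            r = solve-∀

    nonneg : ∀ {z} → + n ℤ.≤ z → 0ℤ ℤ.≤ z
    nonneg = ℤₚ.≤-trans (+≤+ z≤n)

    0≤end : 0ℤ ℤ.≤ + b + + n * (+ K * + hb)
    0≤end = subst (λ z → 0ℤ ℤ.≤ + b + z)
      (trans (ℤₚ.pos-* n (K ℕ.* hb)) (cong (+ n *_) (ℤₚ.pos-* K hb))) (+≤+ z≤n)

  iterated-safe : Safe w x₀ (times n u ++ times n ℓ ++ W ++ times n v)
  iterated-safe = along-++ w (times n u)
    (safe-times w n u x₀ along-u (subst (0ℤ ℤ.≤_) (sym after-u) (nonneg (large a 1≤α))))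
    (subst (λ z → Safe w z (times n ℓ ++ W ++ times n v)) (sym (trans (cong (_+_ x₀) (∑-times w n u)) after-u))
      (along-++ w (times n ℓ)
        (safe-times w n ℓ (+ a + + n * α) along-ℓ (subst (0ℤ ℤ.≤_) (sym after-ℓ) (nonneg (large a 1≤β))))
        (subst (λ z → Safe w z (W ++ times n v)) (sym (trans (cong (_+_ (+ a + + n * α)) (∑-times w n ℓ)) after-ℓ))
          (along-++ w W (safe-high w W n-W (large a 1≤β))
            (subst (λ z → Safe w z (times n v)) (sym after-W)
              (safe-times w n v (+ b + + n * β) along-v (subst (0ℤ ℤ.≤_) (sym after-v) 0≤end)))))))

-- Sequences of control graphs and their refinements

module System {d : ℕ} (V : VAS d) where

  open VAS V public using (k; δ; x-in)

  -- A state records the values of the counters that a component keeps in its control graph;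
  -- the entries at the free counters are meaningless.
  State : Set
  State = Vec ℕ d

  Edge : Set
  Edge = State × Fin k × State

  src tgt : Edge → State
  src (s , _ , _) = s
  tgt (_ , _ , t) = t

  act : Edge → Fin k
  act (_ , a , _) = a

  effect : Fin d → Edge → ℤ
  effect i e = δ (act e) i

  _≟ˢ_ : DecidableEquality State
  _≟ˢ_ = Vecₚ.≡-dec ℕₚ._≟_

  _≟ᵉ_ : DecidableEquality Edge
  _≟ᵉ_ = ≡-dec _≟ˢ_ (≡-dec Finₚ._≟_ _≟ˢ_)

  open Graph src tgt public

  Consistent : List (Fin d) → Edge → Set
  Consistent F e = ∀ i → i ∉ F → + Vec.lookup (tgt e) i ≡ + Vec.lookup (src e) i + effect i e

  record Component : Set where
    field
      start end  : State
      free       : List (Fin d)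
      edges      : List Edge
      consistent : ∀ {e} → e ∈ edges → Consistent free e
  open Component public

  data Item : Set where
    step : Fin k → Item
    comp : Component → Item

  Matches : List (Fin d) → State → Vecℕ d → Set
  Matches F p x = ∀ i → i ∉ F → x i ≡ Vec.lookup p i

  Moves : Vecℕ d → List Edge → Vecℕ d → Set
  Moves x ρ z = ∀ i → + z i ≡ + x i + ∑ (effect i) ρ

  SafeRun : Vecℕ d → List Edge → Set
  SafeRun x ρ = ∀ i → Safe (effect i) (+ x i) ρ

  -- The labels are compared only at the entry; consistency of the edges carries the match to the
  -- exit, as `matches-end` shows.
  record Confined (F : List (Fin d)) (E : List Edge) (p q : State) (x : Vecℕ d) (ρ : List Edge) (z : Vecℕ d) : Set where
    constructor confined
    field
      path    : WalkIn E p ρ q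
      matches : Matches F p x
      safe    : SafeRun x ρ
      moves   : Moves x ρ z
  open Confined public

  CompRun : Component → Vecℕ d → List Edge → Vecℕ d → Set
  CompRun c = Confined (free c) (edges c) (start c) (end c)

  data Runs : List Item → Vecℕ d → Vecℕ d → Set where
    done    : ∀ {x y} → (∀ i → x i ≡ y i) → Runs [] x y
    by-step : ∀ {a M x y z} → Step V x a z → Runs M z y → Runs (step a ∷ M) x y
    by-comp : ∀ {c M x y z ρ} → CompRun c x ρ z → Runs M z y → Runs (comp c ∷ M) x y

  -- Vectors are functions without extensionality, so the endpoint is compared pointwise.
  Reach : Vecℕ d → Vecℕ d → Set
  Reach x y = ∃₂ λ u y′ → Run V x u y′ × (∀ i → y′ i ≡ y i)

  run-resp : ∀ {x x′ y u} → Run V x u y → (∀ i → x′ i ≡ x i) → ∃ λ y′ → Run V x′ u y′ × (∀ i → y′ i ≡ y i)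
  run-resp {x′ = x′} run-[] e = x′ , run-[] , e
  run-resp (run-∷ {y = y} {a = a} s r) e = _ , run-∷ {y = y} (λ i → trans (s i) (cong (λ n → + n + δ a i) (sym (e i)))) r , λ _ → refl

  reach-trans : ∀ {x y z} → Reach x y → Reach y z → Reach x z
  reach-trans (u , y′ , r , e) (v , z′ , r′ , e′) =
    let z″ , r″ , e″ = run-resp r′ e in u ++ v , z″ , go r r″ , λ i → trans (e″ i) (e′ i)
    where
      go : ∀ {x y z u v} → Run V x u y → Run V y v z → Run V x (u ++ v) z
      go run-[]      t = t
      go (run-∷ s r) t = run-∷ s (go r t)

  step-reach : ∀ {x a y} → Step V x a y → Reach x y
  step-reach s = _ , _ , run-∷ s run-[] , λ _ → refl

  safe-prefix : ∀ {x xs ys} → SafeRun x (xs ++ ys) → ∃ λ y → Moves x xs y × SafeRun x xs × SafeRun y ys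
  safe-prefix {x} {xs} {ys} sf = y , m , (λ i → proj₁ (cut i)) ,
    λ i → subst (λ z → Safe (effect i) z ys) (sym (m i)) (proj₂ (cut i))
    where
      cut : ∀ i → Safe (effect i) (+ x i) xs × Safe (effect i) (+ x i + ∑ (effect i) xs) ys
      cut i = along-++⁻ (effect i) xs (sf i)
      y : Vecℕ d
      y i = ∣ + x i + ∑ (effect i) xs ∣
      m : Moves x xs y
      m i = ℤₚ.0≤i⇒+∣i∣≡i (along-last (effect i) xs (proj₁ (cut i)))

  moves-rest : ∀ {x y z} xs ys → Moves x (xs ++ ys) z → Moves x xs y → Moves y ys z
  moves-rest {x} xs ys m n i = trans (m i) (trans (cong (_+_ (+ x i)) (∑-++ (effect i) xs ys))
    (trans (sym (ℤₚ.+-assoc (+ x i) (∑ (effect i) xs) (∑ (effect i) ys))) (cong (_+ ∑ (effect i) ys) (sym (n i)))))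

  moves-edge : ∀ {x e y} → Moves x [ e ] y → Step V x (act e) y
  moves-edge {x} {e} m i = trans (m i) (cong (_+_ (+ x i)) (ℤₚ.+-identityʳ (effect i e)))

  safe-reach : ∀ {x z} ρ → SafeRun x ρ → Moves x ρ z → Reach x z
  safe-reach {x} [] sf m = [] , x , run-[] , λ i → sym (ℤₚ.+-injective (trans (m i) (ℤₚ.+-identityʳ _)))
  safe-reach (e ∷ ρ) sf m =
    let y , my , _ , sf′ = safe-prefix {xs = [ e ]} {ρ} sf
    in reach-trans (step-reach {a = act e} (moves-edge {e = e} my)) (safe-reach ρ sf′ (moves-rest [ e ] ρ m my))

  module _ {F : List (Fin d)} {E : List Edge} (ok : ∀ {e} → e ∈ E → Consistent F e) where

    -- Along a consistent walk the states themselves display these counters, and states hold natural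
    -- numbers; hence safety comes for free.
    labels : ∀ {p q ρ} → WalkIn E p ρ q → ∀ i → i ∉ F →
             + Vec.lookup q i ≡ + Vec.lookup p i + ∑ (effect i) ρ × Safe (effect i) (+ Vec.lookup p i) ρ
    labels (walkIn (nil refl) s) i i∉ = sym (ℤₚ.+-identityʳ _) , +≤+ z≤n
    labels {ρ = e ∷ ρ} (walkIn (cons refl w) s) i i∉ =
      let eq , sf = labels (walkIn w (s ∘ there)) i i∉
          st = ok (s (here refl)) i i∉
      in trans eq (trans (cong (_+ ∑ (effect i) ρ) st) (ℤₚ.+-assoc (+ Vec.lookup (src e) i) (effect i e) _)) ,
         +≤+ z≤n , subst (λ z → Safe (effect i) z ρ) st sf

    matches-end : ∀ {p q x ρ z} → WalkIn E p ρ q → Matches F p x → Moves x ρ z → Matches F q z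
    matches-end {x = x} {ρ} w m mv i i∉ = ℤₚ.+-injective (trans (mv i)
      (trans (cong (λ n → + n + ∑ (effect i) ρ) (m i i∉)) (sym (proj₁ (labels w i i∉)))))

  infix 4 _◁_ _≺_

  data _◁_ : Item → Item → Set where
    fewer-free  : ∀ {c c′} → length (free c′) < length (free c) → comp c′ ◁ comp c
    fewer-edges : ∀ {c c′} → free c′ ≡ free c → length (edges c′) < length (edges c) → comp c′ ◁ comp c
    single-step    : ∀ {c a} → step a ◁ comp c

  ◁-wellFounded : WellFounded _◁_
  ◁-wellFounded (step a) = acc λ ()
  ◁-wellFounded (comp c) = go (<-wellFounded _) (<-wellFounded _) c refl refl
    where
      go : ∀ {m n} → Acc _<_ m → Acc _<_ n → ∀ c → length (free c) ≡ m → length (edges c) ≡ n → Acc _◁_ (comp c)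
      below : ∀ {m n} → Acc _<_ m → Acc _<_ n → ∀ c → length (free c) ≡ m → length (edges c) ≡ n →
              ∀ {it} → it ◁ comp c → Acc _◁_ it
      go a b c e f = acc λ lt → below a b c e f lt
      below (acc r) b       c refl refl (fewer-free lt)     = go (r lt) (<-wellFounded _) _ refl refl
      below a       (acc s) c refl refl (fewer-edges eq lt) = go a (s lt) _ (cong length eq) refl
      below a       b       c e    f    single-step         = acc λ ()

  data _≺_ : List Item → List Item → Set where
    replace : ∀ {it M} its → (∀ {jt} → jt ∈ its → jt ◁ it) → its ++ M ≺ it ∷ M
    later   : ∀ {it M M′} → M′ ≺ M → it ∷ M′ ≺ it ∷ M

  -- Accessibility of `it ∷ M` by nested induction, on `it` for `replace` and on `M` for `later`. A
  -- replacement is rebuilt by prepending its items one at a time, each of them below `it`.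
  ≺-wellFounded : WellFounded _≺_
  ≺-wellFounded []       = acc λ ()
  ≺-wellFounded (it ∷ M) = prepend (◁-wellFounded it) (≺-wellFounded M)
    where
      prepend : ∀ {it M} → Acc _◁_ it → Acc _≺_ M → Acc _≺_ (it ∷ M)
      below : ∀ {it M M′} → Acc _◁_ it → Acc _≺_ M → M′ ≺ it ∷ M → Acc _≺_ M′
      prepend-all : ∀ {it M} → Acc _◁_ it → ∀ its → (∀ {jt} → jt ∈ its → jt ◁ it) → Acc _≺_ M → Acc _≺_ (its ++ M)
      prepend a b = acc λ lt → below a b lt
      below a b       (replace its lt) = prepend-all a its lt b
      below a (acc s) (later lt)       = prepend a (s lt)
      prepend-all a       []         h b = b
      prepend-all (acc r) (jt ∷ its) h b = prepend (r (h (here refl))) (prepend-all (acc r) its (h ∘ there) b)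

  count : Edge → Edge → ℕ
  count e e′ with e ≟ᵉ e′
  ... | yes _ = 1
  ... | no _  = 0

  occurrences : Edge → List Edge → ℤ
  occurrences e = ∑ (λ e′ → + count e e′)

  occurrences-≥0 : ∀ e ρ → 0ℤ ℤ.≤ occurrences e ρ
  occurrences-≥0 e ρ = ∑-nonneg (λ e′ → + count e e′) ρ (λ _ → +≤+ z≤n)

  occurrences-∉ : ∀ e ρ → e ∉ ρ → occurrences e ρ ≡ 0ℤ
  occurrences-∉ e ρ e∉ = ∑-zero ρ absent
    where
        absent : ∀ {e′} → e′ ∈ ρ → + count e e′ ≡ 0ℤ
        absent {e′} m with e ≟ᵉ e′
        ... | yes refl = contradiction m e∉
        ... | no _     = refl

  count-self : ∀ e → count e e ≡ 1
  count-self e with e ≟ᵉ e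
  ... | yes _ = refl
  ... | no ¬p = contradiction refl ¬p

  first-occurrence : ∀ e ρ → e ∉ ρ ⊎ ∃₂ λ ρ₁ ρ₂ → ρ ≡ ρ₁ ++ e ∷ ρ₂ × e ∉ ρ₁
  first-occurrence e [] = inj₁ λ ()
  first-occurrence e (x ∷ ρ) with e ≟ᵉ x | first-occurrence e ρ
  ... | yes refl | _ = inj₂ ([] , ρ , refl , λ ())
  ... | no ¬eq | inj₁ ¬m = inj₁ λ { (here eq) → ¬eq eq ; (there m) → ¬m m }
  ... | no ¬eq | inj₂ (ρ₁ , ρ₂ , refl , ¬m) =
    inj₂ (x ∷ ρ₁ , ρ₂ , refl , λ { (here eq) → ¬eq eq ; (there m) → ¬m m })

  module Unfold (c : Component) (e : Edge) where

    _without : List Edge → List Edge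
    E without = filter (λ e′ → ¬? (e′ ≟ᵉ e)) E

    segment : State → State → Component
    segment p q = record
      { start = p ; end = q ; free = free c ; edges = edges c without
      ; consistent = consistent c ∘ proj₁ ∘ ∈-filter⁻ (λ e′ → ¬? (e′ ≟ᵉ e)) }

    -- The sequence obtained from `n` passages through `e`. The passages become single steps, and
    -- they force the inner entry and exit states to be `tgt e` and `src e`.
    unfold : State → ℕ → List Item
    unfold p zero    = [ comp (segment p (end c)) ]
    unfold p (suc n) = comp (segment p (src e)) ∷ step (act e) ∷ unfold (tgt e) n

    unfold-◁ : e ∈ edges c → ∀ p n {it} → it ∈ unfold p n → it ◁ comp c
    unfold-◁ e∈ p n m = go n m
      where
        smaller : length (edges c without) < length (edges c)
        smaller = Listₚ.filter-notAll (λ e′ → ¬? (e′ ≟ᵉ e)) (edges c) (Any.map (λ { refl f → f refl }) e∈)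
        go : ∀ {p} n {it} → it ∈ unfold p n → it ◁ comp c
        go zero    (here refl)         = fewer-edges refl smaller
        go (suc n) (here refl)         = fewer-edges refl smaller
        go (suc n) (there (here refl)) = single-step
        go (suc n) (there (there m))   = go n m

    avoids : ∀ {ρ} → ρ ⊆ edges c → e ∉ ρ → ρ ⊆ edges c without
    avoids s e∉ m = ∈-filter⁺ (λ e′ → ¬? (e′ ≟ᵉ e)) (s m) (λ { refl → e∉ m })

    unfold-runs : ∀ n {p x ρ z M y} → Confined (free c) (edges c) p (end c) x ρ z →
                  occurrences e ρ ≡ + n → Runs M z y → Runs (unfold p n ++ M) x y
    unfold-runs n {p} {x} {ρ} (confined (walkIn w s) mt sf mv) occ r with first-occurrence e ρ
    unfold-runs zero {x = x} {ρ} (confined (walkIn w s) mt sf mv) occ r | inj₁ e∉ =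
      by-comp {ρ = ρ} (confined (walkIn w (avoids s e∉)) mt sf mv) r
    unfold-runs (suc n) {ρ = ρ} _ occ r | inj₁ e∉ = contradiction (trans (sym occ) (occurrences-∉ e ρ e∉)) λ ()
    unfold-runs n {p} {x} {z = z} (confined (walkIn w s) mt sf mv) occ r | inj₂ (ρ₁ , ρ₂ , refl , e∉)
      with walk-++⁻ ρ₁ w | safe-prefix {xs = ρ₁} {e ∷ ρ₂} sf
    ... | _ , w₁ , cons refl w₂ | y₁ , m₁ , sf₁ , sf₁′ with safe-prefix {xs = [ e ]} {ρ₂} sf₁′
    ... | y₂ , m₂ , _ , sf₂ = finish n occ
      where
        s₁ : ρ₁ ⊆ edges c
        s₁ = s ∘ ∈-++⁺ˡ
        s₂ : e ∷ ρ₂ ⊆ edges c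
        s₂ = s ∘ ∈-++⁺ʳ ρ₁
        mt₁ : Matches (free c) (src e) y₁
        mt₁ = matches-end (consistent c) (walkIn w₁ s₁) mt m₁
        mt₂ : Matches (free c) (tgt e) y₂
        mt₂ = matches-end (consistent c) (walkIn (walk-edge e) (λ { (here refl) → s₂ (here refl) })) mt₁ m₂
        occ₂ : occurrences e (ρ₁ ++ e ∷ ρ₂) ≡ occurrences e ρ₁ + (1ℤ + occurrences e ρ₂)
        occ₂ = trans (∑-++ (λ e′ → + count e e′) ρ₁ (e ∷ ρ₂)) (cong (λ j → occurrences e ρ₁ + (+ j + occurrences e ρ₂)) (count-self e))
        occ₃ : occurrences e (ρ₁ ++ e ∷ ρ₂) ≡ 1ℤ + occurrences e ρ₂
        occ₃ = trans occ₂ (trans (cong (_+ (1ℤ + occurrences e ρ₂)) (occurrences-∉ e ρ₁ e∉)) (ℤₚ.+-identityˡ _))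
        finish : ∀ n → occurrences e (ρ₁ ++ e ∷ ρ₂) ≡ + n → Runs (unfold p n ++ _) x _
        finish zero occ = contradiction (trans (sym occ₃) occ) (positive (occurrences-≥0 e ρ₂))
          where positive : ∀ {z} → 0ℤ ℤ.≤ z → 1ℤ + z ≢ 0ℤ
                positive (+≤+ _) ()
        finish (suc n) occ = by-comp {ρ = ρ₁} (confined (walkIn w₁ (avoids s₁ e∉)) mt sf₁ m₁)
          (by-step (moves-edge {e = e} m₂)
            (unfold-runs n {ρ = ρ₂} (confined (walkIn w₂ (s₂ ∘ there)) mt₂ sf₂ (moves-rest [ e ] ρ₂ (moves-rest ρ₁ (e ∷ ρ₂) mv m₁) m₂))
              (cancel (trans (sym occ₃) occ)) r))
          where cancel : ∀ {z} → 1ℤ + z ≡ + suc n → z ≡ + n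
                cancel {z} eq = trans (sym (ℤₚ.pred-suc z)) (cong ℤ.pred eq)

  module Freeze (c : Component) (j : Fin d) (T : ℕ) where

    relabel : Edge × ℕ × ℕ → Edge
    relabel ((s , a , t) , m , n) = s [ j ]≔ m , a , t [ j ]≔ n

    candidates : List (Edge × ℕ × ℕ)
    candidates = cartesianProduct (edges c) (cartesianProduct (upTo T) (upTo T))

    Fits : Edge × ℕ × ℕ → Set
    Fits (e , m , n) = + n ≡ + m + effect j e

    fits? : ∀ t → Dec (Fits t)
    fits? (e , m , n) = + n ℤₚ.≟ + m + effect j e

    free′ : List (Fin d)
    free′ = filter (λ i → ¬? (i Finₚ.≟ j)) (free c)

    -- Product of the graph with the values of counter `j` below `T`: an edge survives for each pair
    -- of values compatible with its effect.
    edges′ : List Edge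
    edges′ = map relabel (filter fits? candidates)

    free-∉ : ∀ {i} → i ∉ free′ → i ≢ j → i ∉ free c
    free-∉ i∉ i≢j m = i∉ (∈-filter⁺ (λ i → ¬? (i Finₚ.≟ j)) m i≢j)

    edges′-consistent : ∀ {e} → e ∈ edges′ → Consistent free′ e
    edges′-consistent m i i∉ with ∈-map⁻ relabel m
    ... | ((s , a , t) , v , v′) , u , refl with ∈-filter⁻ fits? {xs = candidates} u
    ... | u′ , fit with i Finₚ.≟ j
    ... | yes refl = trans (cong +_ (Vecₚ.lookup∘updateAt j t)) (trans fit (cong (λ n → + n + δ a j) (sym (Vecₚ.lookup∘updateAt j s))))
    ... | no i≢j   = trans (cong +_ (Vecₚ.lookup∘update′ i≢j t v′))
                       (trans (consistent c (proj₁ (∈-cartesianProduct⁻ (edges c) _ u′)) i (free-∉ i∉ i≢j))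
                              (cong (λ n → + n + δ a i) (sym (Vecₚ.lookup∘update′ i≢j s v))))

    frozen : ℕ → ℕ → Component
    frozen v v′ = record
      { start = start c [ j ]≔ v ; end = end c [ j ]≔ v′ ; free = free′ ; edges = edges′ ; consistent = edges′-consistent }

    frozen-◁ : j ∈ free c → ∀ {v v′} → comp (frozen v v′) ◁ comp c
    frozen-◁ m = fewer-free (Listₚ.filter-notAll (λ i → ¬? (i Finₚ.≟ j)) (free c) (Any.map (λ { refl f → f refl }) m))

    record Relabelled (p : State) (x : ℕ) (ρ : List Edge) (q : State) (z : ℕ) : Set where
      field
        {word} : List Edge
        is-walk : WalkIn edges′ (p [ j ]≔ x) word (q [ j ]≔ z)
        same-∑  : ∀ i → ∑ (effect i) word ≡ ∑ (effect i) ρ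
        same-along : ∀ i {y} → Safe (effect i) y ρ → Safe (effect i) y word

    relabel-walk : ∀ {p q x z} ρ → WalkIn (edges c) p ρ q → Safe (effect j) (+ x) ρ → Below T (effect j) (+ x) ρ →
                   + z ≡ + x + ∑ (effect j) ρ → Relabelled p x ρ q z
    relabel-walk {p} {x = x} {z} [] (walkIn (nil refl) s) sf b eq = record
      { is-walk = walkIn (nil (cong (p [ j ]≔_) (sym (ℤₚ.+-injective (trans eq (ℤₚ.+-identityʳ _)))))) (λ ())
      ; same-∑ = λ _ → refl ; same-along = λ _ → id }
    relabel-walk {x = x} {z} (e@(s , a , t) ∷ ρ) (walkIn (cons refl w) s⊆) (p , sf) (lt , b) eq = record
      { is-walk = walkIn (cons refl (walk (is-walk R))) λ where
          (here refl) → ∈-map⁺ relabel (∈-filter⁺ fits? {x = e , x , y}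
            (∈-cartesianProduct⁺ (s⊆ (here refl)) (∈-cartesianProduct⁺ (∈-upTo⁺ (ℤₚ.drop‿+<+ lt)) (∈-upTo⁺ y<T))) y-eq)
          (there m)   → edges-⊆ (is-walk R) m
      ; same-∑ = λ i → cong (_+_ (effect i e)) (same-∑ R i)
      ; same-along = λ { i (q , sf) → q , same-along R i sf } }
      where
        open Relabelled
        y : ℕ
        y = ∣ + x + effect j e ∣
        y-eq : + y ≡ + x + effect j e
        y-eq = ℤₚ.0≤i⇒+∣i∣≡i (along-head (effect j) ρ sf)
        y<T : y < T
        y<T = ℤₚ.drop‿+<+ (subst (ℤ._< + T) (sym y-eq) (along-head (effect j) ρ b))
        R : Relabelled t y ρ _ z
        R = relabel-walk ρ (walkIn w (s⊆ ∘ there)) (subst (λ z → Safe (effect j) z ρ) (sym y-eq) sf)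
              (subst (λ z → Below T (effect j) z ρ) (sym y-eq) b)
              (trans eq (trans (sym (ℤₚ.+-assoc (+ x) (effect j e) _)) (cong (_+ ∑ (effect j) ρ) (sym y-eq))))

    options : List Component
    options = map (λ { (v , v′) → frozen v v′ }) (cartesianProduct (upTo T) (upTo T))

    options-◁ : j ∈ free c → ∀ {c′} → c′ ∈ options → comp c′ ◁ comp c
    options-◁ j∈ m with ∈-map⁻ (λ { (v , v′) → frozen v v′ }) m
    ... | _ , _ , refl = frozen-◁ j∈

    freeze-run : ∀ {x ρ z} → CompRun c x ρ z → Below T (effect j) (+ x j) ρ →
                 ∃₂ λ c′ ρ′ → c′ ∈ options × CompRun c′ x ρ′ z
    freeze-run {x} {ρ} {z} (confined w mt sf mv) b =
      frozen (x j) (z j) , word ,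
      ∈-map⁺ (λ { (v , v′) → frozen v v′ }) (∈-cartesianProduct⁺ (∈-upTo⁺ (ℤₚ.drop‿+<+ (along-head (effect j) ρ b)))
        (∈-upTo⁺ (ℤₚ.drop‿+<+ (subst (ℤ._< + T) (sym (mv j)) (along-last (effect j) ρ b))))) ,
      confined is-walk mt′ (λ i → same-along i (sf i)) (λ i → trans (mv i) (cong (_+_ (+ x i)) (sym (same-∑ i))))
      where
        open Relabelled (relabel-walk ρ w (sf j) b (mv j))
        mt′ : Matches free′ (start c [ j ]≔ x j) x
        mt′ i i∉ with i Finₚ.≟ j
        ... | yes refl = sym (Vecₚ.lookup∘updateAt j (start c))
        ... | no i≢j   = trans (mt i (free-∉ i∉ i≢j)) (sym (Vecₚ.lookup∘update′ i≢j (start c) (x j)))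

  -- A single state with one loop per action; all counters are free, so the zero labels carry no
  -- information.
  whole : Component
  whole = record
    { start = Vec.replicate d 0 ; end = Vec.replicate d 0 ; free = allFin d
    ; edges = map (λ a → Vec.replicate d 0 , a , Vec.replicate d 0) (allFin k)
    ; consistent = λ _ i i∉ → contradiction (∈-allFin i) i∉ }

  run-whole : ∀ {x u y} → Run V x u y → ∃ λ ρ → CompRun whole x ρ y
  run-whole run-[] = [] , confined (walkIn (nil refl) (λ ())) (λ i i∉ → contradiction (∈-allFin i) i∉) (λ i → +≤+ z≤n) (λ i → sym (ℤₚ.+-identityʳ _))
  run-whole {x} (run-∷ {a = a} s r) with run-whole r
  ... | ρ , confined (walkIn w s⊆) _ sf mv = (Vec.replicate d 0 , a , Vec.replicate d 0) ∷ ρ , confined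
    (walkIn (cons refl w) (λ { (here refl) → ∈-map⁺ _ (∈-allFin a) ; (there m) → s⊆ m }))
    (λ i i∉ → contradiction (∈-allFin i) i∉)
    (λ i → +≤+ z≤n , subst (λ z → Safe (effect i) z ρ) (s i) (sf i))
    (λ i → trans (mv i) (trans (cong (_+ ∑ (effect i) ρ) (s i)) (ℤₚ.+-assoc (+ x i) (δ a i) _)))

-- Runs for all large multiples of a homogeneous solution

module Scaling {d : ℕ} (V : VAS d) where

  open System V
  open Cyclic src tgt

  scaled : Vecℕ d → Vecℕ d → ℕ → ℕ → Vecℕ d
  scaled a h K n i = a i ℕ.+ n ℕ.* (K ℕ.* h i)

  -- `n` is bounded below only after `K` is fixed, because the loop `ℓ` of a component depends on
  -- `K` and its norm must not exceed `n`. Allowing all values beyond a threshold lets the items of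
  -- a sequence share one `K` and one `n`.
  Scalable : (a b ha hb : Vecℕ d) → Set
  Scalable a b ha hb = ∃ λ K₀ → ∀ K → K₀ ≤ K → ∃ λ N₀ → ∀ n → N₀ ≤ n → Reach (scaled a ha K n) (scaled b hb K n)

  scaled-ℤ : ∀ a h K n i → + scaled a h K n i ≡ + a i + + n * (+ K * + h i)
  scaled-ℤ a h K n i = cong (_+_ (+ a i)) (trans (ℤₚ.pos-* n (K ℕ.* h i)) (cong (+ n *_) (ℤₚ.pos-* K (h i))))

  scalable-refl : ∀ {a h} → Scalable a a h h
  scalable-refl = 0 , λ _ _ → 0 , λ _ _ → [] , _ , run-[] , λ _ → refl

  scalable-trans : ∀ {a b c ha hb hc} → Scalable a b ha hb → Scalable b c hb hc → Scalable a c ha hc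
  scalable-trans (K₁ , s₁) (K₂ , s₂) = K₁ ℕ.+ K₂ , λ K le →
    let N₁ , r₁ = s₁ K (ℕₚ.≤-trans (ℕₚ.m≤m+n K₁ K₂) le)
        N₂ , r₂ = s₂ K (ℕₚ.≤-trans (ℕₚ.m≤n+m K₂ K₁) le)
    in N₁ ℕ.+ N₂ , λ n le′ → reach-trans (r₁ n (ℕₚ.≤-trans (ℕₚ.m≤m+n N₁ N₂) le′)) (r₂ n (ℕₚ.≤-trans (ℕₚ.m≤n+m N₂ N₁) le′))

  scalable-step : ∀ {a b ha hb : Vecℕ d} t → (∀ i → + b i ≡ + a i + δ t i) → (∀ i → hb i ≡ ha i) → Scalable a b ha hb
  scalable-step {a} {b} {ha} {hb} t eq heq = 0 , λ K _ → 0 , λ n _ → step-reach {a = t} λ i → begin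
    + scaled b hb K n i                          ≡⟨ scaled-ℤ b hb K n i ⟩
    + b i + + n * (+ K * + hb i)                 ≡⟨ cong₂ (λ x y → x + + n * (+ K * + y)) (eq i) (heq i) ⟩
    + a i + δ t i + + n * (+ K * + ha i)         ≡⟨ r (+ a i) (δ t i) (+ n * (+ K * + ha i)) ⟩
    + a i + + n * (+ K * + ha i) + δ t i         ≡⟨ cong (_+ δ t i) (sym (scaled-ℤ a ha K n i)) ⟩
    + scaled a ha K n i + δ t i ∎
    where
      open ≡-Reasoning
      r : ∀ a b c → a + b + c ≡ a + c + b
      r = solve-∀

  walk-times : ∀ {E p u} n → WalkIn E p u p → WalkIn E p (times n u) p
  walk-times zero    w = walkIn (nil refl) (λ ())
  walk-times (suc n) w = walkIn (walk-++ (walk w) (walk (walk-times n w))) (++-⊆ (edges-⊆ w) (edges-⊆ (walk-times n w)))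

  module _ (c : Component) (a b ha hb : Vecℕ d) {W : List Edge} {Cs : List (List Edge)}
           (cs : CycleSystem (edges c) (start c) W (end c) Cs)
           (at-start : Matches (free c) (start c) a)
           (spine-moves : Moves a W b)
           (cycle-moves : Moves ha (concat Cs) hb)
           (rigid : ∀ i → i ∉ free c → ha i ≡ 0)
           {u v : List Edge} (hu : WalkIn (edges c) (start c) u (start c)) (hv : WalkIn (edges c) (end c) v (end c))
           (pump : ∀ i → i ∈ free c → ha i ≡ 0 → Safe (effect i) (+ a i) u × 1ℤ ℤ.≤ ∑ (effect i) u)
           (back : ∀ i → i ∈ free c → hb i ≡ 0 → Safe (effect i) (+ b i - ∑ (effect i) v) v × 1ℤ ℤ.≤ - ∑ (effect i) v)
           where

    open CycleSystem cs
    open import Data.List.Membership.DecPropositional (Finₚ._≟_ {d}) using (_∈?_)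

    scalable-component : Scalable a b ha hb
    scalable-component with balancing-loop hu hv
    ... | K₁ , loops = K₁ ℕ.+ total ku ℕ.+ total kv , λ K le →
      let ℓ , hℓ , bal = loops K (ℕₚ.≤-trans (ℕₚ.≤-trans (ℕₚ.m≤m+n K₁ (total ku)) (ℕₚ.m≤m+n _ (total kv))) le)
      in total (bounds ℓ) , λ n le′ → safe-reach (word ℓ n)
           (λ i → subst (λ z → Safe (effect i) z (word ℓ n)) (sym (scaled-ℤ a ha K n i)) (word-safe K le ℓ hℓ bal n le′ i))
           (λ i → trans (scaled-ℤ b hb K n i) (trans (counter-effect K le ℓ bal n le′ i) (cong (_+ ∑ (effect i) (word ℓ n)) (sym (scaled-ℤ a ha K n i)))))
      where
        -- `K` has to exceed the effects of `u` and `v` on every counter, so that a positive `ha i`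
        -- or `hb i` outweighs them.
        ku kv : Fin d → ℕ
        ku i = suc ∣ ∑ (effect i) u ∣
        kv i = suc ∣ ∑ (effect i) v ∣
        bounds : List Edge → Fin d → ℕ
        bounds ℓ i = norm (effect i) u ℕ.+ norm (effect i) ℓ ℕ.+ norm (effect i) W ℕ.+ norm (effect i) v
        word : List Edge → ℕ → List Edge
        word ℓ n = times n u ++ times n ℓ ++ W ++ times n v
        Bal : ℕ → List Edge → Set
        Bal K ℓ = ∀ f → ∑ f u + ∑ f ℓ + ∑ f v ≡ + K * ∑ f (concat Cs)
        module _ (K : ℕ) (le : K₁ ℕ.+ total ku ℕ.+ total kv ≤ K) (ℓ : List Edge) (bal : Bal K ℓ)
                 (n : ℕ) (le′ : total (bounds ℓ) ≤ n) (i : Fin d) where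
          n≥ : bounds ℓ i ≤ n
          n≥ = ℕₚ.≤-trans (≤-total (bounds ℓ) i) le′
          n₃ : norm (effect i) u ℕ.+ norm (effect i) ℓ ℕ.+ norm (effect i) W ≤ n
          n₃ = ℕₚ.≤-trans (ℕₚ.m≤m+n _ _) n≥
          n₂ : norm (effect i) u ℕ.+ norm (effect i) ℓ ≤ n
          n₂ = ℕₚ.≤-trans (ℕₚ.m≤m+n _ _) n₃
          module At (pu : ha i ≡ 0 → Safe (effect i) (+ a i) u × 1ℤ ℤ.≤ ∑ (effect i) u)
                    (pv : hb i ≡ 0 → Safe (effect i) (+ b i - ∑ (effect i) v) v × 1ℤ ℤ.≤ - ∑ (effect i) v) =
            Counter (effect i) (a i) (b i) (ha i) (hb i) K n u ℓ W v (spine-moves i) (cycle-moves i) (bal (effect i)) pu pv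
              (ℕₚ.≤-trans (ℕₚ.≤-trans (≤-total ku i) (ℕₚ.≤-trans (ℕₚ.m≤n+m (total ku) K₁) (ℕₚ.m≤m+n _ (total kv)))) le)
              (ℕₚ.≤-trans (ℕₚ.≤-trans (≤-total kv i) (ℕₚ.m≤n+m (total kv) _)) le)
              (ℕₚ.≤-trans (ℕₚ.m≤m+n _ _) n₂)
              (ℕₚ.≤-trans (ℕₚ.m≤n+m _ _) n₂)
              (ℕₚ.≤-trans (ℕₚ.m≤n+m _ _) n₃)
              (ℕₚ.≤-trans (ℕₚ.m≤n+m _ _) n≥)
          counter-effect : + b i + + n * (+ K * + hb i) ≡ + a i + + n * (+ K * + ha i) + ∑ (effect i) (word ℓ n)
          counter-effect = iterate (+ n) (+ K) (+ ha i) {a = + a i} {s = ∑ (effect i) W} (spine-moves i) (cycle-moves i) (bal (effect i))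
            (trans (∑-++₄ (effect i) (times n u) (times n ℓ) W (times n v))
              (cong₂ _+_ (∑-times (effect i) n u) (cong₂ _+_ (∑-times (effect i) n ℓ) (cong (_+_ (∑ (effect i) W)) (∑-times (effect i) n v)))))
            where
              iterate : ∀ n k h {a b h′ σ s x y z t} → b ≡ a + s → h′ ≡ h + σ → x + y + z ≡ k * σ → t ≡ n * x + (n * y + (s + n * z)) →
                        b + n * (k * h′) ≡ a + n * (k * h) + t
              iterate n k h {a} {σ = σ} {s} {x} {y} {z} refl refl e refl = trans (r₁ a s n k h σ) (trans (cong (λ w → a + s + n * (k * h + w)) (sym e)) (r₂ a s n k h x y z))
                where
                  r₁ : ∀ a s n k h σ → a + s + n * (k * (h + σ)) ≡ a + s + n * (k * h + k * σ)
                  r₁ = solve-∀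
                  r₂ : ∀ a s n k h x y z → a + s + n * (k * h + (x + y + z)) ≡ a + n * (k * h) + (n * x + (n * y + (s + n * z)))
                  r₂ = solve-∀
          word-safe′ : WalkIn (edges c) (start c) ℓ (start c) → Safe (effect i) (+ a i + + n * (+ K * + ha i)) (word ℓ n)
          word-safe′ hℓ with i ∈? free c
          ... | yes i∈ = At.iterated-safe (pump i i∈) (back i i∈)
          -- The states along the word hold the values of this counter, and since `ha i` is zero the
          -- scaled entry value is still the label of `start c`.
          ... | no  i∉ = subst (λ z → Safe (effect i) z (word ℓ n)) start-value (proj₂ (labels (consistent c) word-walk i i∉))
            where
              word-walk : WalkIn (edges c) (start c) (word ℓ n) (end c)
              word-walk = walkIn
                (walk-++ (walk (walk-times n hu)) (walk-++ (walk (walk-times n hℓ)) (walk-++ (walk spine-walk) (walk (walk-times n hv)))))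
                (++-⊆ (edges-⊆ (walk-times n hu)) (++-⊆ (edges-⊆ (walk-times n hℓ)) (++-⊆ (edges-⊆ spine-walk) (edges-⊆ (walk-times n hv)))))
              start-value : + Vec.lookup (start c) i ≡ + a i + + n * (+ K * + ha i)
              start-value = sym (trans (sym (scaled-ℤ a ha K n i)) (cong +_
                (trans (cong₂ (λ x h → x ℕ.+ n ℕ.* (K ℕ.* h)) (at-start i i∉) (rigid i i∉))
                  (trans (cong (ℕ._+_ (Vec.lookup (start c) i)) (trans (cong (n ℕ.*_) (ℕₚ.*-zeroʳ K)) (ℕₚ.*-zeroʳ n))) (ℕₚ.+-identityʳ _)))))
        word-safe : ∀ K → K₁ ℕ.+ total ku ℕ.+ total kv ≤ K → ∀ ℓ → WalkIn (edges c) (start c) ℓ (start c) → Bal K ℓ →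
                    ∀ n → total (bounds ℓ) ≤ n → ∀ i → Safe (effect i) (+ a i + + n * (+ K * + ha i)) (word ℓ n)
        word-safe K le ℓ hℓ bal n le′ i = word-safe′ K le ℓ bal n le′ i hℓ

-- Linear systems and constant weights

LinearEquation : Set → Set
LinearEquation A = (A → ℤ) × ℤ

Holds Vanishes : {A : Set} → List A → LinearEquation A → Set
Holds    x (w , v) = ∑ w x ≡ v
Vanishes x (w , v) = ∑ w x ≡ 0ℤ

AllHold AllVanish : {A : Set} → List (LinearEquation A) → List A → Set
AllHold   eqs x = ∀ q → q ∈ eqs → Holds x q
AllVanish eqs x = ∀ q → q ∈ eqs → Vanishes x q

-- The equations are solved one after another. Those already solved travel in `B` and `D`: adding
-- null periods to a solution preserves them.
solve-system : {A : Set} (eqs : List (LinearEquation A)) (B D : List A → Set) →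
  (∀ {c p} → B c → D p → B (c ++ p)) → (∀ {p q} → D p → D q → D (p ++ q)) → D [] →
  (L : LinearSet A) → B (base L) → (∀ {p} → p ∈ periods L → D p) →
  FinCover _∈ᴸ_
    (λ K → (B (base K) × AllHold eqs (base K)) × (∀ {p} → p ∈ periods K → D p × AllVanish eqs p))
    (λ x → x ∈ᴸ L × AllHold eqs x)
solve-system [] B D B-++ D-++ D-[] L b h =
  cover-one L ((b , λ _ ()) , λ m → h m , λ _ ()) (λ _ → proj₁)
solve-system {A} ((w , v) ∷ eqs) B D B-++ D-++ D-[] L b h =
  cover-bind {R = _∈ᴸ_} {Q = Solution} {P = λ x → x ∈ᴸ L × AllHold ((w , v) ∷ eqs) x}
    (cover-⊆ (λ x (l , s) → l , s (w , v) (here refl)) (solve-equation L b h))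
    λ K (b′ , h′) → let
        c = solve-system eqs (λ c → B c × ∑ w c ≡ v) (λ p → D p × ∑ w p ≡ 0ℤ)
              (λ {c} {p} (x , e) (y , g) → B-++ x y , trans (∑-++ w c p) (trans (cong₂ _+_ e g) (ℤₚ.+-identityʳ v)))
              (λ {p} {q} (x , e) (y , g) → D-++ x y , trans (∑-++ w p q) (cong₂ _+_ e g))
              (D-[] , refl) K b′ h′
      in mkCover (elems c)
           (λ m → let ((x , e) , s) , t = good c m in
              (x , λ { _ (here refl) → e ; q (there i) → s q i }) ,
              λ i → let (y , g) , r = t i in y , λ { _ (here refl) → g ; q (there j) → r q j })
           (λ x ((l , s) , k) → covers c x (k , λ q i → s q (there i)))
  where open Equation w v B D B-++ D-++ D-[]

∑-nonneg-zero : {A : Set} (w : A → ℤ) (xs : List A) → (∀ x → 0ℤ ℤ.≤ w x) → ∑ w xs ≡ 0ℤ → ∀ {x} → x ∈ xs → w x ≡ 0ℤ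
∑-nonneg-zero w (x ∷ xs) nn e m = case m of λ where
    (here refl) → proj₁ both
    (there k)   → ∑-nonneg-zero w xs nn (proj₂ both) k
  where
    zero-sum : ∀ {a b} → 0ℤ ℤ.≤ a → 0ℤ ℤ.≤ b → a + b ≡ 0ℤ → a ≡ 0ℤ × b ≡ 0ℤ
    zero-sum (+≤+ {n = zero} _) (+≤+ {n = zero} _) _ = refl , refl
    both : w x ≡ 0ℤ × ∑ w xs ≡ 0ℤ
    both = zero-sum (nn x) (∑-nonneg w xs (λ _ → nn _)) e

-- All that is kept of a linear set with base `c` and sum of periods `H`. Arbitrary natural weights
-- are allowed, and not only the multiplicities of single tokens, so as to cover derived quantities
-- such as the number of occurrences of an edge.
Agrees : {A : Set} → List A → List A → List A → Set
Agrees {A} c H x = ∀ (w : A → ℕ) → ∑ (λ τ → + w τ) H ≡ 0ℤ → ∑ (λ τ → + w τ) x ≡ ∑ (λ τ → + w τ) c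

-- A nonnegative weight with total zero over all periods is zero on each of them, so no choice of
-- multiplicities changes it.
agrees-linear : {A : Set} {x : List A} (L : LinearSet A) → x ∈ᴸ L → Agrees (base L) (concat (periods L)) x
agrees-linear {A} {x} L (pss , s , e) w z = trans (at-concat (base L) pss e u)
  (trans (cong (_+_ (∑ u (base L))) (∑-zero pss λ m →
      ∑-nonneg-zero (∑ u) (periods L) (λ p → ∑-nonneg u p (λ _ → +≤+ z≤n)) (trans (sym (∑-concat u (periods L))) z) (s m)))
    (ℤₚ.+-identityʳ _))
  where u : A → ℤ
        u τ = + w τ

-- The linear system of a sequence of items

module Tokens {d : ℕ} (V : VAS d) (f : Vecω d) where

  open System V

  -- For a sequence of items: slack i is one unit of counter i at the entry of the first item,
  -- cycle C one use of the cycle C in the first item, and below τ a token of the remaining items.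
  data Token : Set where
    slack : Fin d → Token
    cycle : List Edge → Token
    below : Token → Token

  uses : List Token → List (List Edge)
  uses []            = []
  uses (cycle C ∷ X) = C ∷ uses X
  uses (slack _ ∷ X) = uses X
  uses (below _ ∷ X) = uses X

  lower : List Token → List Token
  lower []            = []
  lower (below τ ∷ X) = τ ∷ lower X
  lower (slack _ ∷ X) = lower X
  lower (cycle _ ∷ X) = lower X

  slack-weight : Fin d → Token → ℕ
  slack-weight i (slack j) with i Finₚ.≟ j
  ... | yes _ = 1
  ... | no _  = 0
  slack-weight i (cycle _) = 0
  slack-weight i (below _) = 0

  amount : List Token → Vecℕ d
  amount []      i = 0
  amount (τ ∷ X) i = slack-weight i τ ℕ.+ amount X i

  -- The number type is left open because equations use integer weights and `Agrees` natural ones.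
  module _ {N : Set} (z : N) where

    on-uses : (List Edge → N) → Token → N
    on-uses w (cycle C) = w C
    on-uses w (slack _) = z
    on-uses w (below _) = z

    on-lower : (Token → N) → Token → N
    on-lower w (below τ) = w τ
    on-lower w (slack _) = z
    on-lower w (cycle _) = z

  ∑-amount : ∀ X i → ∑ (λ τ → + slack-weight i τ) X ≡ + amount X i
  ∑-amount []      i = refl
  ∑-amount (τ ∷ X) i = cong (_+_ (+ slack-weight i τ)) (∑-amount X i)

  ∑-uses : ∀ w X → ∑ (on-uses 0ℤ w) X ≡ ∑ w (uses X)
  ∑-uses w []            = refl
  ∑-uses w (cycle C ∷ X) = cong (_+_ (w C)) (∑-uses w X)
  ∑-uses w (slack _ ∷ X) = trans (ℤₚ.+-identityˡ _) (∑-uses w X)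
  ∑-uses w (below _ ∷ X) = trans (ℤₚ.+-identityˡ _) (∑-uses w X)

  ∑-lower : ∀ w X → ∑ (on-lower 0ℤ w) X ≡ ∑ w (lower X)
  ∑-lower w []            = refl
  ∑-lower w (below τ ∷ X) = cong (_+_ (w τ)) (∑-lower w X)
  ∑-lower w (slack _ ∷ X) = trans (ℤₚ.+-identityˡ _) (∑-lower w X)
  ∑-lower w (cycle _ ∷ X) = trans (ℤₚ.+-identityˡ _) (∑-lower w X)

  on-lower-+ : ∀ (w : Token → ℕ) τ → + on-lower 0 w τ ≡ on-lower 0ℤ (λ τ → + w τ) τ
  on-lower-+ w (slack _) = refl
  on-lower-+ w (cycle _) = refl
  on-lower-+ w (below _) = refl

  on-uses-+ : ∀ (w : List Edge → ℕ) τ → + on-uses 0 w τ ≡ on-uses 0ℤ (λ C → + w C) τ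
  on-uses-+ w (slack _) = refl
  on-uses-+ w (cycle _) = refl
  on-uses-+ w (below _) = refl

  agrees-lower : ∀ {c H X} → Agrees c H X → Agrees (lower c) (lower H) (lower X)
  agrees-lower {c} {H} {X} ag w z = trans (sym (e X)) (trans (ag (on-lower 0 w) (trans (e H) z)) (e c))
    where e : ∀ Y → ∑ (λ τ → + on-lower 0 w τ) Y ≡ ∑ (λ τ → + w τ) (lower Y)
          e Y = trans (∑-cong (on-lower-+ w) Y) (∑-lower (λ τ → + w τ) Y)

  agrees-uses : ∀ {c H X} → Agrees c H X → Agrees (uses c) (uses H) (uses X)
  agrees-uses {c} {H} {X} ag w z = trans (sym (e X)) (trans (ag (on-uses 0 w) (trans (e H) z)) (e c))
    where e : ∀ Y → ∑ (λ τ → + on-uses 0 w τ) Y ≡ ∑ (λ C → + w C) (uses Y)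
          e Y = trans (∑-cong (on-uses-+ w) Y) (∑-uses (λ C → + w C) Y)

  agrees-amount : ∀ {c H X} → Agrees c H X → ∀ i → amount H i ≡ 0 → amount X i ≡ amount c i
  agrees-amount {c} {H} {X} ag i z = ℤₚ.+-injective (trans (sym (∑-amount X i))
    (trans (ag (slack-weight i) (trans (∑-amount H i) (cong +_ z))) (∑-amount c i)))

  data Choice : Set where
    step : Fin k → Choice
    comp : (c : Component) (L : LinearSet Edge) → WalkPiece (edges c) (start c) (end c) L → Choice

  item : Choice → Item
  item (step a)     = step a
  item (comp c _ _) = comp c

  drift : Choice → Fin d → ℤ
  drift (step a)     i = δ a i
  drift (comp c L _) i = ∑ (effect i) (base L)

  tokens : List Choice → List Token
  tokens []                  = map slack (allFin d)
  tokens (step a ∷ χs)       = map slack (allFin d) ++ map below (tokens χs)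
  tokens (comp c L _ ∷ χs) = map slack (allFin d) ++ map cycle (periods L) ++ map below (tokens χs)

  slack-weightᶻ : Fin d → Token → ℤ
  slack-weightᶻ i τ = + slack-weight i τ

  -- Balance of counter `i` across the item: exit minus entry minus the effect of the cycles used
  -- equals the effect of the step or base walk. The exit amount is the entry amount of what
  -- follows, found among the lowered tokens.
  flow : Choice → Fin d → LinearEquation Token
  flow χ i = (λ τ → on-lower 0ℤ (slack-weightᶻ i) τ - slack-weightᶻ i τ - on-uses 0ℤ (∑ (effect i)) τ) , drift χ i

  -- A placeholder, so that each family of equations has exactly one member per counter and is
  -- indexed by `allFin d`.
  trivial : LinearEquation Token
  trivial = (λ _ → 0ℤ) , 0ℤ

  open import Data.List.Membership.DecPropositional (Finₚ._≟_ {d}) using (_∈?_)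

  label : Choice → Fin d → LinearEquation Token
  label (step a) i = trivial
  label (comp c _ _) i with i ∈? free c
  ... | yes _ = trivial
  ... | no _  = slack-weightᶻ i , + Vec.lookup (start c) i

  target : Fin d → LinearEquation Token
  target i with f i
  ... | fin n = slack-weightᶻ i , + n
  ... | ω     = trivial

  lift : LinearEquation Token → LinearEquation Token
  lift (w , v) = on-lower 0ℤ w , v

  equations : List Choice → List (LinearEquation Token)
  equations []       = map target (allFin d)
  equations (χ ∷ χs) = map (flow χ) (allFin d) ++ map (label χ) (allFin d) ++ map lift (equations χs)

  initial : Fin d → LinearEquation Token
  initial i = slack-weightᶻ i , + x-in i

  trivial-holds : ∀ X → Holds X trivial
  trivial-holds X = ∑-zero X (λ _ → refl)

  flow-value : ∀ X i → ∑ (λ τ → on-lower 0ℤ (slack-weightᶻ i) τ - slack-weightᶻ i τ - on-uses 0ℤ (∑ (effect i)) τ) X ≡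
               + amount (lower X) i - + amount X i - ∑ (effect i) (concat (uses X))
  flow-value X i = trans (∑-diff _ (on-uses 0ℤ (∑ (effect i))) X)
    (cong₂ _-_ (trans (∑-diff (on-lower 0ℤ (slack-weightᶻ i)) (slack-weightᶻ i) X)
                 (cong₂ _-_ (trans (∑-lower (slack-weightᶻ i) X) (∑-amount (lower X) i)) (∑-amount X i)))
               (trans (∑-uses (∑ (effect i)) X) (sym (∑-concat (effect i) (uses X)))))

  module _ (P : List Token → LinearEquation Token → Set) (χ : Choice) (χs : List Choice) (X : List Token)
           (all : ∀ q → q ∈ equations (χ ∷ χs) → P X q) where

    in-flow : ∀ i → P X (flow χ i)
    in-flow i = all _ (∈-++⁺ˡ (∈-map⁺ (flow χ) (∈-allFin i)))

    in-label : ∀ i → P X (label χ i)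
    in-label i = all _ (∈-++⁺ʳ (map (flow χ) (allFin d)) (∈-++⁺ˡ (∈-map⁺ (label χ) (∈-allFin i))))

    in-lower : (∀ q → P X (lift q) → P (lower X) q) → ∀ q → q ∈ equations χs → P (lower X) q
    in-lower P-lower q m = P-lower q (all _ (∈-++⁺ʳ (map (flow χ) (allFin d)) (∈-++⁺ʳ (map (label χ) (allFin d)) (∈-map⁺ lift m))))

  hold-lower : ∀ χ χs X → AllHold (equations (χ ∷ χs)) X → AllHold (equations χs) (lower X)
  hold-lower χ χs X h = in-lower Holds χ χs X h (λ q e → trans (sym (∑-lower (proj₁ q) X)) e)

  vanish-lower : ∀ χ χs X → AllVanish (equations (χ ∷ χs)) X → AllVanish (equations χs) (lower X)
  vanish-lower χ χs X h = in-lower Vanishes χ χs X h (λ q e → trans (sym (∑-lower (proj₁ q) X)) e)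

  hold-flow : ∀ χ χs X → AllHold (equations (χ ∷ χs)) X →
              ∀ i → + amount (lower X) i ≡ + amount X i + (drift χ i + ∑ (effect i) (concat (uses X)))
  hold-flow χ χs X h i = trans (r (+ amount (lower X) i) (+ amount X i) (∑ (effect i) (concat (uses X))))
      (cong (λ z → + amount X i + (z + ∑ (effect i) (concat (uses X))))
        (trans (sym (flow-value X i)) (in-flow Holds χ χs X h i)))
    where r : ∀ b a s → b ≡ a + (b - a - s + s)
          r = solve-∀

  vanish-flow : ∀ χ χs X → AllVanish (equations (χ ∷ χs)) X →
                ∀ i → + amount (lower X) i ≡ + amount X i + ∑ (effect i) (concat (uses X))
  vanish-flow χ χs X h i = trans (r (+ amount (lower X) i) (+ amount X i) (∑ (effect i) (concat (uses X))))
      (trans (cong (λ z → + amount X i + (z + ∑ (effect i) (concat (uses X))))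
        (trans (sym (flow-value X i)) (in-flow Vanishes χ χs X h i)))
        (cong (_+_ (+ amount X i)) (ℤₚ.+-identityˡ (∑ (effect i) (concat (uses X))))))
    where r : ∀ b a s → b ≡ a + (b - a - s + s)
          r = solve-∀

  hold-label : ∀ c L g χs X → AllHold (equations (comp c L g ∷ χs)) X → Matches (free c) (start c) (amount X)
  hold-label c L g χs X h i i∉ with i ∈? free c | in-label Holds (comp c L g) χs X h i
  ... | yes i∈ | _ = contradiction i∈ i∉
  ... | no _   | e = ℤₚ.+-injective (trans (sym (∑-amount X i)) e)

  vanish-label : ∀ c L g χs X → AllVanish (equations (comp c L g ∷ χs)) X → ∀ i → i ∉ free c → amount X i ≡ 0
  vanish-label c L g χs X h i i∉ with i ∈? free c | in-label Vanishes (comp c L g) χs X h i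
  ... | yes i∈ | _ = contradiction i∈ i∉
  ... | no _   | e = ℤₚ.+-injective (trans (sym (∑-amount X i)) e)

  -- A run together with tokens that account for it: amounts are the junction values, uses the
  -- cycles of a Parikh decomposition of each walk.
  data Traced : List Choice → Vecℕ d → Vecℕ d → List Token → Set where
    traced-[]   : ∀ {x y X} → (∀ i → amount X i ≡ x i) → (∀ i → x i ≡ y i) → Traced [] x y X
    traced-step : ∀ {a χs x y z X} → (∀ i → amount X i ≡ x i) → uses X ≡ [] → Step V x a z →
                  Traced χs z y (lower X) → Traced (step a ∷ χs) x y X
    traced-comp : ∀ {c L g χs x y z ρ X} → (∀ i → amount X i ≡ x i) → CompRun c x ρ z →
                  ρ ≈ base L ++ concat (uses X) →
                  Traced χs z y (lower X) → Traced (comp c L g ∷ χs) x y X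

  traced-amount : ∀ {χs x y X} → Traced χs x y X → ∀ i → amount X i ≡ x i
  traced-amount (traced-[] a _)       = a
  traced-amount (traced-step a _ _ _) = a
  traced-amount (traced-comp a _ _ _) = a

  traced-runs : ∀ {χs x y X} → Traced χs x y X → Runs (map item χs) x y
  traced-runs (traced-[] _ e)       = done e
  traced-runs (traced-step _ _ s t) = by-step s (traced-runs t)
  traced-runs (traced-comp _ r _ t) = by-comp r (traced-runs t)

  OnTarget : Vecℕ d → Set
  OnTarget y = ∀ i n → f i ≡ fin n → y i ≡ n

  equations-∷ : ∀ χ χs {X} → (∀ i → Holds X (flow χ i)) → (∀ i → Holds X (label χ i)) → AllHold (equations χs) (lower X) →
                AllHold (equations (χ ∷ χs)) X
  equations-∷ χ χs {X} hf hl ht q m with ∈-++⁻ (map (flow χ) (allFin d)) m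
  ... | inj₁ j with ∈-map⁻ (flow χ) j
  ... | i , _ , refl = hf i
  equations-∷ χ χs {X} hf hl ht q m | inj₂ j with ∈-++⁻ (map (label χ) (allFin d)) j
  ... | inj₁ l with ∈-map⁻ (label χ) l
  ... | i , _ , refl = hl i
  equations-∷ χ χs {X} hf hl ht q m | inj₂ j | inj₂ l with ∈-map⁻ lift l
  ... | (w , v) , n , refl = trans (∑-lower w X) (ht (w , v) n)

  -- Runs give solutions, but not conversely: a solution says nothing about the signs of counters
  -- inside an item.
  traced-equations : ∀ {χs x y X} → Traced χs x y X → OnTarget y → AllHold (equations χs) X
  traced-equations {X = X} (traced-[] {x} {y} a e) ot q m with ∈-map⁻ target m
  ... | i , _ , refl with f i in eq
  ... | fin n = trans (∑-amount X i) (cong +_ (trans (a i) (trans (e i) (ot i n eq))))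
  ... | ω     = trivial-holds X
  traced-equations {X = X} (traced-step {t} {χs} {x} {y} {z} a nc s tr) ot =
    equations-∷ (step t) χs {X}
      (λ i → trans (flow-value X i) (trans
        (cong₂ (λ u C → u - + amount X i - ∑ (effect i) (concat C)) (trans (cong +_ (traced-amount tr i)) (trans (s i) (cong (λ n → + n + δ t i) (sym (a i))))) nc)
        (r (+ amount X i) (δ t i))))
      (λ i → trivial-holds X) (traced-equations tr ot)
    where r : ∀ a s → a + s - a - 0ℤ ≡ s
          r = solve-∀
  traced-equations {X = X} (traced-comp {c} {L} {g} {χs} {x} {y} {z} {ρ} a rn e tr) ot =
    equations-∷ (comp c L g) χs {X}
      (λ i → trans (flow-value X i) (trans
        (cong (λ u → u - + amount X i - ∑ (effect i) (concat (uses X)))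
          (trans (cong +_ (traced-amount tr i)) (trans (moves rn i)
            (cong₂ (λ n s → + n + s) (sym (a i)) (trans (at e (effect i)) (∑-++ (effect i) (base L) _))))))
        (r (+ amount X i) (∑ (effect i) (base L)) (∑ (effect i) (concat (uses X))))))
      lab (traced-equations tr ot)
    where
      r : ∀ a b s → a + (b + s) - a - s ≡ b
      r = solve-∀
      lab : ∀ i → Holds X (label (comp c L g) i)
      lab i with i ∈? free c
      ... | yes _ = trivial-holds X
      ... | no i∉ = trans (∑-amount X i) (cong +_ (trans (a i) (matches rn i i∉)))

  amount-++ : ∀ X Y i → amount (X ++ Y) i ≡ amount X i ℕ.+ amount Y i
  amount-++ []      Y i = refl
  amount-++ (τ ∷ X) Y i = trans (cong (ℕ._+_ (slack-weight i τ)) (amount-++ X Y i)) (sym (ℕₚ.+-assoc (slack-weight i τ) _ _))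

  uses-++ : ∀ X Y → uses (X ++ Y) ≡ uses X ++ uses Y
  uses-++ []            Y = refl
  uses-++ (cycle C ∷ X) Y = cong (C ∷_) (uses-++ X Y)
  uses-++ (slack _ ∷ X) Y = uses-++ X Y
  uses-++ (below _ ∷ X) Y = uses-++ X Y

  lower-++ : ∀ X Y → lower (X ++ Y) ≡ lower X ++ lower Y
  lower-++ []            Y = refl
  lower-++ (below τ ∷ X) Y = cong (τ ∷_) (lower-++ X Y)
  lower-++ (slack _ ∷ X) Y = lower-++ X Y
  lower-++ (cycle _ ∷ X) Y = lower-++ X Y

  -- The enumeration `g` is a parameter so that the induction on `m` can pass to `g ∘ suc`; the
  -- intended instance is `id`.
  slacks : ∀ {m} → (Fin m → Fin d) → (Fin m → ℕ) → List Token
  slacks {zero}  g x = []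
  slacks {suc m} g x = replicate (x zero) (slack (g zero)) ++ slacks (g ∘ suc) (x ∘ suc)

  amount-replicate : ∀ n i j → amount (replicate n (slack j)) i ≡ n ℕ.* slack-weight i (slack j)
  amount-replicate zero    i j = refl
  amount-replicate (suc n) i j = cong (ℕ._+_ (slack-weight i (slack j))) (amount-replicate n i j)

  slack-weight-other : ∀ {i j} → i ≢ j → slack-weight i (slack j) ≡ 0
  slack-weight-other {i} {j} i≢j with i Finₚ.≟ j
  ... | yes e = contradiction e i≢j
  ... | no _  = refl

  slack-weight-self : ∀ i → slack-weight i (slack i) ≡ 1
  slack-weight-self i with i Finₚ.≟ i
  ... | yes _ = refl
  ... | no ¬e = contradiction refl ¬e

  amount-slacks-∉ : ∀ {m} (g : Fin m → Fin d) x i → (∀ j → i ≢ g j) → amount (slacks g x) i ≡ 0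
  amount-slacks-∉ {zero}  g x i ne = refl
  amount-slacks-∉ {suc m} g x i ne = trans (amount-++ (replicate (x zero) (slack (g zero))) _ i)
    (cong₂ ℕ._+_ (trans (amount-replicate (x zero) i (g zero)) (trans (cong (x zero ℕ.*_) (slack-weight-other (ne zero))) (ℕₚ.*-zeroʳ (x zero))))
                 (amount-slacks-∉ (g ∘ suc) (x ∘ suc) i (ne ∘ suc)))

  amount-slacks : ∀ {m} (g : Fin m → Fin d) x → (∀ {j l} → g j ≡ g l → j ≡ l) → ∀ j → amount (slacks g x) (g j) ≡ x j
  amount-slacks {suc m} g x inj zero = trans (amount-++ (replicate (x zero) (slack (g zero))) _ (g zero))
    (trans (cong₂ ℕ._+_ (trans (amount-replicate (x zero) (g zero) (g zero)) (trans (cong (x zero ℕ.*_) (slack-weight-self (g zero))) (ℕₚ.*-identityʳ (x zero))))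
                        (amount-slacks-∉ (g ∘ suc) (x ∘ suc) (g zero) (λ j e → case inj e of λ ())))
           (ℕₚ.+-identityʳ (x zero)))
  amount-slacks {suc m} g x inj (suc j) = trans (amount-++ (replicate (x zero) (slack (g zero))) _ (g (suc j)))
    (cong₂ ℕ._+_ (trans (amount-replicate (x zero) (g (suc j)) (g zero)) (trans (cong (x zero ℕ.*_) (slack-weight-other (λ e → case inj e of λ ()))) (ℕₚ.*-zeroʳ (x zero))))
                 (amount-slacks (g ∘ suc) (x ∘ suc) (λ e → Finₚ.suc-injective (inj e)) j))

  slacks-⊆ : ∀ {m} (g : Fin m → Fin d) x → slacks g x ⊆ map slack (allFin d)
  slacks-⊆ {suc m} g x t with ∈-++⁻ (replicate (x zero) (slack (g zero))) t
  ... | inj₁ u = from-replicate (x zero) u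
    where from-replicate : ∀ n {τ} → τ ∈ replicate n (slack (g zero)) → τ ∈ map slack (allFin d)
          from-replicate (suc n) (here refl) = ∈-map⁺ slack (∈-allFin (g zero))
          from-replicate (suc n) (there t)   = from-replicate n t
  ... | inj₂ u = slacks-⊆ (g ∘ suc) (x ∘ suc) u

  uses-slacks : ∀ {m} (g : Fin m → Fin d) x → uses (slacks g x) ≡ []
  uses-slacks {zero}  g x = refl
  uses-slacks {suc m} g x = trans (uses-++ (replicate (x zero) (slack (g zero))) _) (cong₂ _++_ (rep (x zero)) (uses-slacks (g ∘ suc) (x ∘ suc)))
    where rep : ∀ n → uses (replicate n (slack (g zero))) ≡ []
          rep zero    = refl
          rep (suc n) = rep n

  lower-slacks : ∀ {m} (g : Fin m → Fin d) x → lower (slacks g x) ≡ []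
  lower-slacks {zero}  g x = refl
  lower-slacks {suc m} g x = trans (lower-++ (replicate (x zero) (slack (g zero))) _) (cong₂ _++_ (rep (x zero)) (lower-slacks (g ∘ suc) (x ∘ suc)))
    where rep : ∀ n → lower (replicate n (slack (g zero))) ≡ []
          rep zero    = refl
          rep (suc n) = rep n

  assemble : Vecℕ d → List (List Edge) → List Token → List Token
  assemble x Cs X = slacks id x ++ map cycle Cs ++ map below X

  private
    map-cycle : ∀ Cs → uses (map cycle Cs) ≡ Cs × lower (map cycle Cs) ≡ [] × (∀ i → amount (map cycle Cs) i ≡ 0)
    map-cycle []       = refl , refl , λ _ → refl
    map-cycle (C ∷ Cs) = let a , b , e = map-cycle Cs in cong (C ∷_) a , b , e

    map-below : ∀ X → uses (map below X) ≡ [] × lower (map below X) ≡ X × (∀ i → amount (map below X) i ≡ 0)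
    map-below []      = refl , refl , λ _ → refl
    map-below (τ ∷ X) = let a , b , e = map-below X in a , cong (τ ∷_) b , e

  uses-assemble : ∀ x Cs X → uses (assemble x Cs X) ≡ Cs
  uses-assemble x Cs X = trans (uses-++ (slacks id x) _) (trans (cong₂ _++_ (uses-slacks id x) (uses-++ (map cycle Cs) _))
    (trans (cong₂ _++_ (proj₁ (map-cycle Cs)) (proj₁ (map-below X))) (Listₚ.++-identityʳ Cs)))

  lower-assemble : ∀ x Cs X → lower (assemble x Cs X) ≡ X
  lower-assemble x Cs X = trans (lower-++ (slacks id x) _) (trans (cong₂ _++_ (lower-slacks id x) (lower-++ (map cycle Cs) _))
    (cong₂ _++_ (proj₁ (proj₂ (map-cycle Cs))) (proj₁ (proj₂ (map-below X)))))

  amount-assemble : ∀ x Cs X i → amount (assemble x Cs X) i ≡ x i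
  amount-assemble x Cs X i = trans (amount-++ (slacks id x) _ i) (trans (cong₂ ℕ._+_ (amount-slacks id x id i)
    (trans (amount-++ (map cycle Cs) _ i) (cong₂ ℕ._+_ (proj₂ (proj₂ (map-cycle Cs)) i) (proj₂ (proj₂ (map-below X)) i)))) (ℕₚ.+-identityʳ (x i)))

  Trace : Vecℕ d × Vecℕ d → List Choice → Set
  Trace (x , y) χs = ∃ λ X → Traced χs x y X × X ⊆ tokens χs

  -- Fixing one linear set of the Parikh image for every component turns the walks into lists of
  -- cycles, so that a whole run becomes a list of tokens.
  choices : ∀ M → FinCover Trace (λ χs → map item χs ≡ M) (λ (x , y) → Runs M x y)
  choices [] = cover-one [] refl λ { (x , y) (done e) → slacks id x , traced-[] (amount-slacks id x id) e , slacks-⊆ id x }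
  choices (step a ∷ M) = mkCover (map (step a ∷_) (elems (choices M)))
    (λ m → case ∈-map⁻ (step a ∷_) m of λ { (χs , j , refl) → cong (step a ∷_) (good (choices M) j) })
    λ { (x , y) (by-step {z = z} s r) →
      let χs , m , X , t , i = covers (choices M) (z , y) r
      in step a ∷ χs , ∈-map⁺ (step a ∷_) m , assemble x [] X ,
         traced-step (amount-assemble x [] X) (uses-assemble x [] X) s (subst (Traced χs z y) (sym (lower-assemble x [] X)) t) ,
         ++-⊆ {xs = slacks id x} (λ m → ∈-++⁺ˡ (slacks-⊆ id x m)) (λ m → ∈-++⁺ʳ (map slack (allFin d)) (Subsetₚ.map⁺ below i m)) }
  choices (comp c ∷ M) = cover-⋃ {P = λ (x , y) → Runs (comp c ∷ M) x y}
      {S = λ L (x , y) → ∃₂ λ ρ z → ρ ∈ᴸ L × CompRun c x ρ z × Runs M z y} (elems pieces)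
      (λ {L} mL → mkCover (map (comp c L (good pieces mL) ∷_) (elems (choices M)))
        (λ m → case ∈-map⁻ (comp c L (good pieces mL) ∷_) m of λ { (χs , j , refl) → cong (comp c ∷_) (good (choices M) j) })
        (cov L (good pieces mL)))
      λ { (x , y) (by-comp {z = z} {ρ = ρ} rn r) →
        let L , mL , l = covers pieces ρ (Confined.path rn) in L , mL , ρ , z , l , rn , r }
    where
      pieces : WalkCover (edges c) (start c) (end c) (λ ρ → WalkIn (edges c) (start c) ρ (end c))
      pieces = parikh _≟ˢ_ (edges c) (start c) (end c)
      cov : ∀ L (g : WalkPiece (edges c) (start c) (end c) L) (p : Vecℕ d × Vecℕ d) →
            (∃₂ λ ρ z → ρ ∈ᴸ L × CompRun c (proj₁ p) ρ z × Runs M z (proj₂ p)) →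
            Σ (List Choice) λ χs → χs ∈ map (comp c L g ∷_) (elems (choices M)) × Trace p χs
      cov L g (x , y) (ρ , z , (Cs , s , e) , rn , r) =
        let χs , m , X , t , i = covers (choices M) (z , y) r
        in comp c L g ∷ χs , ∈-map⁺ (comp c L g ∷_) m , assemble x Cs X ,
           traced-comp (amount-assemble x Cs X) rn (subst (λ Ds → ρ ≈ base L ++ concat Ds) (sym (uses-assemble x Cs X)) e)
             (subst (Traced χs z y) (sym (lower-assemble x Cs X)) t) ,
           ++-⊆ {xs = slacks id x} (λ m → ∈-++⁺ˡ (slacks-⊆ id x m))
             (++-⊆ {xs = map cycle Cs} (λ m → ∈-++⁺ʳ (map slack (allFin d)) (∈-++⁺ˡ (Subsetₚ.map⁺ cycle s m)))
                   (λ m → ∈-++⁺ʳ (map slack (allFin d)) (∈-++⁺ʳ (map cycle (periods L)) (Subsetₚ.map⁺ below i m))))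

-- A solution set is scalable or its sequence is refined

module Analysis {d : ℕ} (V : VAS d) (f : Vecω d) where

  open System V
  open Scaling V
  open Cyclic src tgt
  open Tokens V f

  system : List Choice → List (LinearEquation Token)
  system χs = map initial (allFin d) ++ equations χs

  Solved : List Choice → List Token × List Token → Set
  Solved χs (c , H) = (c ⊆ tokens χs × AllHold (system χs) c) × (H ⊆ tokens χs × AllVanish (system χs) H)

  solutions : ∀ χs → FinCover (λ X (c , H) → Agrees c H X) (Solved χs) (λ X → X ⊆ tokens χs × AllHold (system χs) X)
  solutions χs = mkCover (map pair (elems K)) ok cov
    where
      T : List Token
      T = tokens χs
      -- All multisets of tokens.
      L₀ : LinearSet Token
      L₀ = [] +⟨ map [_] T ⟩*
      -- The sum of all periods is again homogeneous, and a natural weight vanishes on it only if it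
      -- vanishes on each period.
      pair : LinearSet Token → List Token × List Token
      pair K = base K , concat (periods K)
      K : FinCover _∈ᴸ_ (λ K → (base K ⊆ T × AllHold (system χs) (base K)) × (∀ {p} → p ∈ periods K → p ⊆ T × AllVanish (system χs) p))
                   (λ x → x ∈ᴸ L₀ × AllHold (system χs) x)
      K = solve-system (system χs) (_⊆ T) (_⊆ T) (λ {c} p q → ++-⊆ {xs = c} p q) (λ {c} p q → ++-⊆ {xs = c} p q) (λ ()) L₀ (λ ())
            single-⊆
        where
          single-⊆ : ∀ {p} → p ∈ map [_] T → p ⊆ T
          single-⊆ m j with ∈-map⁻ [_] m | j
          ... | t , t∈ , refl | here refl = t∈
      ok : ∀ {p} → p ∈ map pair (elems K) → Solved χs p
      ok m with ∈-map⁻ pair m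
      ... | S , S∈ , refl = proj₁ (good K S∈) ,
        (λ t → let xs , t∈ , xs∈ = ∈-concat⁻′ (periods S) t in proj₁ (proj₂ (good K S∈) xs∈) t∈) ,
        λ (w , v) q∈ → trans (∑-concat w (periods S)) (∑-zero (periods S) λ p∈ → proj₂ (proj₂ (good K S∈) p∈) (w , v) q∈)
      cov : ∀ X → X ⊆ T × AllHold (system χs) X → Σ (List Token × List Token) λ (c , H) → (c , H) ∈ map pair (elems K) × Agrees c H X
      cov X (s , h) =
        let S , S∈ , l = covers K X ((map [_] X , Subsetₚ.map⁺ [_] s , ≡⇒≈ (sym (Listₚ.concat-map-[_] X))) , h)
        in pair S , ∈-map⁺ pair S∈ , agrees-linear S l

  uses-∈ : ∀ {C} X → C ∈ uses X → cycle C ∈ X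
  uses-∈ (cycle C ∷ X) (here refl) = here refl
  uses-∈ (cycle C ∷ X) (there m)   = there (uses-∈ X m)
  uses-∈ (slack _ ∷ X) m           = there (uses-∈ X m)
  uses-∈ (below _ ∷ X) m           = there (uses-∈ X m)

  lower-∈ : ∀ {τ} X → τ ∈ lower X → below τ ∈ X
  lower-∈ (below τ ∷ X) (here refl) = here refl
  lower-∈ (below τ ∷ X) (there m)   = there (lower-∈ X m)
  lower-∈ (slack _ ∷ X) m           = there (lower-∈ X m)
  lower-∈ (cycle _ ∷ X) m           = there (lower-∈ X m)

  uses-step : ∀ {t χs X} → X ⊆ tokens (step t ∷ χs) → uses X ≡ []
  uses-step {t} {χs} {X} s with uses X in eq
  ... | []     = refl
  ... | C ∷ Cs with ∈-++⁻ (map slack (allFin d)) (s (uses-∈ X (subst (C ∈_) (sym eq) (here refl))))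
  ... | inj₁ m = case ∈-map⁻ slack m of λ { (_ , _ , ()) }
  ... | inj₂ m = case ∈-map⁻ below m of λ { (_ , _ , ()) }

  uses-comp : ∀ {c L g χs X} → X ⊆ tokens (comp c L g ∷ χs) → uses X ⊆ periods L
  uses-comp {L = L} {X = X} s m with ∈-++⁻ (map slack (allFin d)) (s (uses-∈ X m))
  ... | inj₁ j = case ∈-map⁻ slack j of λ { (_ , _ , ()) }
  ... | inj₂ j with ∈-++⁻ (map cycle (periods L)) j
  ... | inj₁ l = case ∈-map⁻ cycle l of λ { (_ , l∈ , refl) → l∈ }
  ... | inj₂ l = case ∈-map⁻ below l of λ { (_ , _ , ()) }

  lower-⊆ : ∀ χ {χs X} → X ⊆ tokens (χ ∷ χs) → lower X ⊆ tokens χs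
  lower-⊆ (step t) {X = X} s m with ∈-++⁻ (map slack (allFin d)) (s (lower-∈ X m))
  ... | inj₁ j = case ∈-map⁻ slack j of λ { (_ , _ , ()) }
  ... | inj₂ j = case ∈-map⁻ below j of λ { (_ , l∈ , refl) → l∈ }
  lower-⊆ (comp c L g) {X = X} s m with ∈-++⁻ (map slack (allFin d)) (s (lower-∈ X m))
  ... | inj₁ j = case ∈-map⁻ slack j of λ { (_ , _ , ()) }
  ... | inj₂ j with ∈-++⁻ (map cycle (periods L)) j
  ... | inj₁ l = case ∈-map⁻ cycle l of λ { (_ , _ , ()) }
  ... | inj₂ l = case ∈-map⁻ below l of λ { (_ , l∈ , refl) → l∈ }

  final : List Choice → List Token → Vecℕ d
  final []       X = amount X
  final (_ ∷ χs) X = final χs (lower X)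

  traced-final : ∀ {χs x y X} → Traced χs x y X → ∀ i → final χs X i ≡ y i
  traced-final (traced-[] a e) i       = trans (a i) (e i)
  traced-final (traced-step _ _ _ t) i = traced-final t i
  traced-final (traced-comp _ _ _ t) i = traced-final t i

  agrees-final : ∀ χs {c H X} → Agrees c H X → ∀ i → final χs H i ≡ 0 → final χs X i ≡ final χs c i
  agrees-final []       {c} {H} {X} ag i z = agrees-amount {c} {H} {X} ag i z
  agrees-final (χ ∷ χs) {c} {H} {X} ag i z = agrees-final χs (agrees-lower {c} {H} {X} ag) i z

  target-holds : ∀ χs {X i n} → AllHold (equations χs) X → f i ≡ fin n → final χs X i ≡ n
  target-holds [] {X} {i} h eq with f i | h (target i) (∈-map⁺ target (∈-allFin i))
  target-holds [] {X} {i} h refl | .(fin _) | e = ℤₚ.+-injective (trans (sym (∑-amount X i)) e)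
  target-holds (χ ∷ χs) {X} h eq = target-holds χs (hold-lower χ χs X h) eq

  target-vanishes : ∀ χs {X i n} → AllVanish (equations χs) X → f i ≡ fin n → final χs X i ≡ 0
  target-vanishes [] {X} {i} h eq with f i | h (target i) (∈-map⁺ target (∈-allFin i))
  target-vanishes [] {X} {i} h refl | .(fin _) | e = ℤₚ.+-injective (trans (sym (∑-amount X i)) e)
  target-vanishes (χ ∷ χs) {X} h eq = target-vanishes χs (vanish-lower χ χs X h) eq

  -- `complete` speaks only of runs agreeing with `(c , H)`: the constancy of certain quantities on
  -- this solution set is what makes finitely many options enough.
  record Refinement (χs : List Choice) (c H : List Token) : Set where
    field
      options  : List (List Item)
      smaller  : ∀ {M} → M ∈ options → M ≺ map item χs
      complete : ∀ {x y X} → Traced χs x y X → Agrees c H X → ∃ λ M → M ∈ options × Runs M x y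

  refine-later : ∀ χ {χs c H} → Refinement χs (lower c) (lower H) → Refinement (χ ∷ χs) c H
  refine-later χ {χs} {c} {H} r = record
    { options  = map (item χ ∷_) options
    ; smaller  = λ m → case ∈-map⁻ (item χ ∷_) m of λ { (M , M∈ , refl) → later (smaller M∈) }
    ; complete = extend }
    where
      open Refinement r
      extend : ∀ {x y X} → Traced (χ ∷ χs) x y X → Agrees c H X → ∃ λ M → M ∈ map (item χ ∷_) options × Runs M x y
      extend {X = X} (traced-step _ _ s t) ag =
        let M , M∈ , rs = complete t (agrees-lower {c} {H} {X} ag) in _ , ∈-map⁺ (item χ ∷_) M∈ , by-step s rs
      extend {X = X} (traced-comp _ rn _ t) ag =
        let M , M∈ , rs = complete t (agrees-lower {c} {H} {X} ag) in _ , ∈-map⁺ (item χ ∷_) M∈ , by-comp rn rs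

  module AtComponent (c : Component) (L : LinearSet Edge) (g : WalkPiece (edges c) (start c) (end c) L) (χs : List Choice)
                     (b H : List Token)
                     (b-ok : b ⊆ tokens (comp c L g ∷ χs)) (b-holds : AllHold (equations (comp c L g ∷ χs)) b)
                     (H-ok : H ⊆ tokens (comp c L g ∷ χs)) (H-vanishes : AllVanish (equations (comp c L g ∷ χs)) H) where

    Refined : Set
    Refined = Refinement (comp c L g ∷ χs) b H

    module _ {e : Edge} (e∈ : e ∈ edges c) (unused : ∀ {C} → C ∈ uses H → e ∉ C) where

      open Unfold c e

      private
        bound : ℤ
        bound = occurrences e (base L) + ∑ (occurrences e) (uses b)

        occurrences-+ : ∀ C → + ∣ occurrences e C ∣ ≡ occurrences e C
        occurrences-+ C = ℤₚ.0≤i⇒+∣i∣≡i (occurrences-≥0 e C)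

        same-count : ∀ {X ρ} → Agrees b H X → ρ ≈ base L ++ concat (uses X) → occurrences e ρ ≡ + ∣ bound ∣
        same-count {X} {ρ} ag eq = begin
          occurrences e ρ                                        ≡⟨ at-concat (base L) (uses X) eq (λ e′ → + count e e′) ⟩
          occurrences e (base L) + ∑ (occurrences e) (uses X)    ≡⟨ cong (_+_ (occurrences e (base L))) same-uses ⟩
          bound                                                  ≡⟨ sym (ℤₚ.0≤i⇒+∣i∣≡i (ℤₚ.+-mono-≤ (occurrences-≥0 e (base L))
                                                                      (∑-nonneg (occurrences e) (uses b) (λ {C} _ → occurrences-≥0 e C)))) ⟩
          + ∣ bound ∣ ∎
          where
            open ≡-Reasoning
            same-uses : ∑ (occurrences e) (uses X) ≡ ∑ (occurrences e) (uses b)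
            same-uses = trans (sym (∑-cong occurrences-+ (uses X)))
              (trans (agrees-uses {b} {H} {X} ag (λ C → ∣ occurrences e C ∣)
                        (∑-zero (uses H) λ {C} m → trans (occurrences-+ C) (occurrences-∉ e C (unused m))))
                     (∑-cong occurrences-+ (uses b)))

      -- The number of occurrences of `e` is a natural weight on cycles that vanishes on the cycles
      -- of `H`, so all agreeing runs pass through `e` the same number of times.
      refine-unfold : Refined
      refine-unfold = record
        { options  = [ unfold (start c) ∣ bound ∣ ++ map item χs ]
        ; smaller  = λ { (here refl) → replace (unfold (start c) ∣ bound ∣) (unfold-◁ e∈ (start c) ∣ bound ∣) }
        ; complete = λ { {X = X} (traced-comp {ρ = ρ} a rn eq t) ag →
            _ , here refl , unfold-runs ∣ bound ∣ {ρ = ρ} rn (same-count {X} ag eq) (traced-runs t) } }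

    -- Which counter stays low may differ from run to run, so freezing is offered for every counter
    -- in `J`.
    refine-freeze : ∀ T J → (∀ {i} → i ∈ J → i ∈ free c) →
      (∀ {x ρ z X} → CompRun c x ρ z → (∀ i → amount X i ≡ x i) → (∀ i → amount (lower X) i ≡ z i) → Agrees b H X →
        ∃ λ i → i ∈ J × Below T (effect i) (+ x i) ρ) → Refined
    refine-freeze T J J⊆ bounded = record
      { options  = concatMap choicesAt J
      ; smaller  = λ m → let i , i∈ , M∈ = find (∈-concatMap⁻ choicesAt {xs = J} m) in
                         case ∈-map⁻ (λ c′ → comp c′ ∷ map item χs) M∈ of λ
                           { (c′ , c′∈ , refl) → replace [ comp c′ ] λ { (here refl) → Freeze.options-◁ c i T (J⊆ i∈) c′∈ } }
      ; complete = λ { {X = X} (traced-comp {ρ = ρ} a rn eq t) ag →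
          let i , i∈ , bl = bounded {X = X} rn a (traced-amount t) ag
              c′ , ρ′ , c′∈ , rn′ = Freeze.freeze-run c i T rn bl
          in comp c′ ∷ map item χs ,
             ∈-concatMap⁺ choicesAt (Any.map (λ { refl → ∈-map⁺ (λ c′ → comp c′ ∷ map item χs) c′∈ }) i∈) ,
             by-comp rn′ (traced-runs t) } }
      where
        choicesAt : Fin d → List (List Item)
        choicesAt i = map (λ c′ → comp c′ ∷ map item χs) (Freeze.options c i T)

    bounded-free : Vecℕ d → List (Fin d)
    bounded-free h = filter (λ i → h i ℕ.≟ 0) (free c)

    module _ (exhaustive : ∀ {e} → e ∈ edges c → ∃ λ C → C ∈ uses H × e ∈ C) where

      -- The spine of the scaled runs must have the effect prescribed by `b`, so the cycles that `b`
      -- uses are inserted into the base walk.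
      open Inserted (insert-cycles (walkIn (spine g) (WalkPiece.within g)) (uses b)
                       (λ m → WalkPiece.cycles g (uses-comp {c} {L} {g} {χs} {b} b-ok m)))
      open TwoWayPumping src tgt _≟ˢ_ (edges c)

      private
        cs : CycleSystem (edges c) (start c) result (end c) (uses H)
        cs = record
          { spine-walk = result-walk
          ; attachment = λ m → attached-mono id result-sees (WalkPiece.cycles g (uses-comp {c} {L} {g} {χs} {H} H-ok m))
          ; exhaustive = exhaustive }

        fwd bwd : List (Fin d)
        fwd = bounded-free (amount H)
        bwd = bounded-free (amount (lower H))

        spine-moves : Moves (amount b) result (amount (lower b))
        spine-moves i = trans (hold-flow (comp c L g) χs b b-holds i)
          (cong (_+_ (+ amount b i)) (sym (trans (at result-≈ (effect i)) (∑-++ (effect i) (base L) (concat (uses b))))))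

        index-in : ∀ {h i} → i ∈ free c → h i ≡ 0 → ∃ λ j → lookup (bounded-free h) j ≡ i
        index-in {h} i∈ z = let m = ∈-filter⁺ (λ i → h i ℕ.≟ 0) i∈ z in Any.index m , sym (Anyₚ.lookup-index m)

        in-free : ∀ h {i} → i ∈ bounded-free h → i ∈ free c
        in-free h m = proj₁ (∈-filter⁻ (λ i → h i ℕ.≟ 0) m)

        zero-at : ∀ h {i} → i ∈ bounded-free h → h i ≡ 0
        zero-at h m = proj₂ (∈-filter⁻ (λ i → h i ℕ.≟ 0) {xs = free c} m)

      -- A trap is stated for fixed entry or exit values. It applies to all agreeing runs because
      -- the counters involved have amount zero in `H` there, which forces the value that `b` has.
      -- Counters with a positive amount are raised by `H` itself.
      pumping : Scalable (amount b) (amount (lower b)) (amount H) (amount (lower H)) ⊎ Refined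
      pumping with pump-or-trapped (λ j → effect (lookup fwd j)) (λ j → amount b (lookup fwd j)) (start c) (CycleSystem.return-to-start cs)
                 | back-pump-or-trapped (λ j → effect (lookup bwd j)) (λ j → amount (lower b) (lookup bwd j)) (end c) (CycleSystem.leave-from-end cs)
      ... | inj₂ (T , trapped) | _ = inj₂ (refine-freeze T fwd (in-free (amount H)) λ {x} {ρ} {z} {X} rn ax az ag →
            let same = λ j → trans (sym (ax (lookup fwd j)))
                               (agrees-amount {b} {H} {X} ag (lookup fwd j) (zero-at (amount H) (∈-lookup j)))
                j , bl = trapped (Confined.path rn) (λ j → subst (λ n → Safe (effect (lookup fwd j)) (+ n) ρ) (same j) (safe rn (lookup fwd j)))
            in lookup fwd j , ∈-lookup j , subst (λ n → Below T (effect (lookup fwd j)) (+ n) ρ) (sym (same j)) bl)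
      ... | inj₁ _ | inj₂ (T , trapped) = inj₂ (refine-freeze T bwd (in-free (amount (lower H))) λ {x} {ρ} {z} {X} rn ax az ag →
            let same = λ j → trans (sym (az (lookup bwd j)))
                               (agrees-amount {lower b} {lower H} {lower X} (agrees-lower {b} {H} {X} ag) (lookup bwd j)
                                 (zero-at (amount (lower H)) (∈-lookup j)))
                j , bl = trapped (λ j → + x (lookup bwd j)) (Confined.path rn)
                           (λ j → trans (sym (moves rn (lookup bwd j))) (cong +_ (same j))) (λ j → safe rn (lookup bwd j))
            in lookup bwd j , ∈-lookup j , bl)
      ... | inj₁ p | inj₁ q = inj₁ (scalable-component c (amount b) (amount (lower b)) (amount H) (amount (lower H)) cs
            (hold-label c L g χs b b-holds) spine-moves (vanish-flow (comp c L g) χs H H-vanishes) (vanish-label c L g χs H H-vanishes)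
            (Pump.loop-walk p) (BackPump.loop-walk q)
            (λ i i∈ z → let j , eq = index-in {amount H} i∈ z in
               subst (λ i → Safe (effect i) (+ amount b i) (Pump.loop p) × 1ℤ ℤ.≤ ∑ (effect i) (Pump.loop p)) eq
                 (Pump.loop-safe p j , Pump.loop-gain p j))
            (λ i i∈ z → let j , eq = index-in {amount (lower H)} i∈ z in
               subst (λ i → Safe (effect i) (+ amount (lower b) i - ∑ (effect i) (BackPump.loop q)) (BackPump.loop q) × 1ℤ ℤ.≤ - ∑ (effect i) (BackPump.loop q)) eq
                 (BackPump.loop-safe q j , BackPump.loop-loss q j)))

    open import Data.List.Membership.DecPropositional _≟ᵉ_ using (_∈?_)

    at-component : Scalable (amount b) (amount (lower b)) (amount H) (amount (lower H)) ⊎ Refined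
    at-component with Any.any? (λ e → ¬? (Any.any? (e ∈?_) (uses H))) (edges c)
    ... | yes y = let e , e∈ , no-use = find y in
                  inj₂ (refine-unfold e∈ (λ m e∈C → no-use (Any.map (λ { refl → e∈C }) m)))
    ... | no ¬y = pumping λ {e} e∈ → case Any.any? (e ∈?_) (uses H) of λ where
          (yes u) → find u
          (no ¬u) → contradiction (Any.map (λ { refl → ¬u }) e∈) ¬y

  -- From the last item backwards: a refinement of the tail is lifted to the whole sequence;
  -- otherwise the scalability of the tail is composed with that of the head at the common junction
  -- `lower b`, `lower H`.
  analyse : ∀ χs b H → b ⊆ tokens χs → AllHold (equations χs) b → H ⊆ tokens χs → AllVanish (equations χs) H →
            Scalable (amount b) (final χs b) (amount H) (final χs H) ⊎ Refinement χs b H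
  analyse [] b H _ _ _ _ = inj₁ scalable-refl
  analyse (χ ∷ χs) b H b-ok b-holds H-ok H-vanishes
    with analyse χs (lower b) (lower H) (lower-⊆ χ {χs} {b} b-ok) (hold-lower χ χs b b-holds) (lower-⊆ χ {χs} {H} H-ok) (vanish-lower χ χs H H-vanishes)
  ... | inj₂ r = inj₂ (refine-later χ r)
  analyse (step t ∷ χs) b H b-ok b-holds H-ok H-vanishes | inj₁ s = inj₁ (scalable-trans
    (scalable-step t
      (λ i → trans (hold-flow (step t) χs b b-holds i) (cong (_+_ (+ amount b i))
        (trans (cong (λ Cs → δ t i + ∑ (effect i) (concat Cs)) (uses-step {t} {χs} {b} b-ok)) (ℤₚ.+-identityʳ (δ t i)))))
      (λ i → ℤₚ.+-injective (trans (vanish-flow (step t) χs H H-vanishes i)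
        (trans (cong (λ Cs → + amount H i + ∑ (effect i) (concat Cs)) (uses-step {t} {χs} {H} H-ok)) (ℤₚ.+-identityʳ _)))))
    s)
  analyse (comp c L g ∷ χs) b H b-ok b-holds H-ok H-vanishes | inj₁ s
    with AtComponent.at-component c L g χs b H b-ok b-holds H-ok H-vanishes
  ... | inj₁ s₁ = inj₁ (scalable-trans s₁ s)
  ... | inj₂ r  = inj₂ r

-- Outputs as limits of reachable vectors

module Limits {d : ℕ} (V : VAS d) (f : Vecω d) where

  open System V
  open Scaling V
  open Tokens V f
  open Analysis V f

  Approximates : ℕ → ℕ → ℕω → Set
  Approximates m y (fin n) = y ≡ n
  Approximates m y ω       = m ≤ y

  Approximable : Vecω d → Set
  Approximable b = ∀ m → ∃ λ y → Reach x-in y × OnTarget y × (∀ i → Approximates m (y i) (b i))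

  OutputCover : (Vecℕ d → Set) → Set
  OutputCover = FinCover (λ y b → embed y ≤ᵛ b) Approximable

  limit : ℕ → ℕ → ℕω
  limit a zero    = fin a
  limit a (suc _) = ω

  limit-approximates : ∀ K N m a h → Approximates m (a ℕ.+ (N ℕ.+ m) ℕ.* (suc K ℕ.* h)) (limit a h)
  limit-approximates K N m a zero    =
    trans (cong (λ z → a ℕ.+ (N ℕ.+ m) ℕ.* z) (ℕₚ.*-zeroʳ (suc K))) (trans (cong (a ℕ.+_) (ℕₚ.*-zeroʳ (N ℕ.+ m))) (ℕₚ.+-identityʳ a))
  limit-approximates K N m a (suc h) =
    ℕₚ.≤-trans (ℕₚ.m≤n+m m N) (ℕₚ.≤-trans (ℕₚ.m≤m*n (N ℕ.+ m) (suc K ℕ.* suc h)) (ℕₚ.m≤n+m _ a))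

  limit-bounds : ∀ y a h → (h ≡ 0 → y ≡ a) → fin y ≤ω limit a h
  limit-bounds y a zero    e = fin≤fin (ℕₚ.≤-reflexive (e refl))
  limit-bounds y a (suc h) e = ≤ω-top

  Output : List Item → Vecℕ d → Set
  Output M y = Runs M x-in y × OnTarget y

  -- Nested finite choices: Parikh pieces for the components, then a solution set of the resulting
  -- system, then either a single limit vector or the options of a refinement, which are left to
  -- `rec`.
  cover-step : ∀ M → (∀ {M′} → M′ ≺ M → OutputCover (Output M′)) → OutputCover (Output M)
  cover-step M rec = cover-⋃ {S = λ χs y → Trace (x-in , y) χs × OnTarget y} (elems (choices M))
      (λ {χs} m → cover-choices χs (good (choices M) m))
      λ y (r , ot) → let χs , m , t = covers (choices M) (x-in , y) r in χs , m , t , ot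
    where
      cover-solution : ∀ χs → map item χs ≡ M → ∀ p → Solved χs p →
        OutputCover (λ y → ∃ λ X → Traced χs x-in y X × Agrees (proj₁ p) (proj₂ p) X × OnTarget y)
      cover-solution χs refl (b , H) ((b-ok , b-holds) , (H-ok , H-vanishes))
        with analyse χs b H b-ok (λ q m → b-holds q (∈-++⁺ʳ (map initial (allFin d)) m)) H-ok (λ q m → H-vanishes q (∈-++⁺ʳ (map initial (allFin d)) m))
      ... | inj₂ r = cover-⋃ {S = Output} (Refinement.options r) (λ m → rec (Refinement.smaller r m))
              λ y (X , t , ag , ot) → let M′ , m , rs = Refinement.complete r {X = X} t ag in M′ , m , rs , ot
      ... | inj₁ (K₀ , scale) = cover-one (λ i → limit (final χs b i) (final χs H i)) approx
              λ y (X , t , ag , ot) i → limit-bounds (y i) _ _ λ z →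
                trans (sym (traced-final t i)) (agrees-final χs {b} {H} {X} ag i z)
        where
          -- `H` satisfies the homogeneous form of the equations `initial`, so scaling leaves the
          -- initial vector in place.
          initially : ∀ K n i → x-in i ≡ scaled (amount b) (amount H) K n i
          initially K n i = sym (trans (cong₂ (λ a h → a ℕ.+ n ℕ.* (K ℕ.* h)) at-b at-H)
            (trans (cong (λ z → x-in i ℕ.+ n ℕ.* z) (ℕₚ.*-zeroʳ K)) (trans (cong (x-in i ℕ.+_) (ℕₚ.*-zeroʳ n)) (ℕₚ.+-identityʳ _))))
            where
              init∈ : initial i ∈ system χs
              init∈ = ∈-++⁺ˡ (∈-map⁺ initial (∈-allFin i))
              at-b : amount b i ≡ x-in i
              at-b = ℤₚ.+-injective (trans (sym (∑-amount b i)) (b-holds (initial i) init∈))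
              at-H : amount H i ≡ 0
              at-H = ℤₚ.+-injective (trans (sym (∑-amount H i)) (H-vanishes (initial i) init∈))
          approx : Approximable (λ i → limit (final χs b i) (final χs H i))
          approx m =
            -- `suc K₀` rather than `K₀`, since the factor must be positive for an unbounded exit
            -- value to reach `m`; the exponent `N₀ + m` is beyond the threshold and at least `m`.
            let N₀ , run = scale (suc K₀) (ℕₚ.n≤1+n K₀)
            in scaled (final χs b) (final χs H) (suc K₀) (N₀ ℕ.+ m) ,
               reach-trans ([] , x-in , run-[] , initially (suc K₀) (N₀ ℕ.+ m)) (run (N₀ ℕ.+ m) (ℕₚ.m≤m+n N₀ m)) ,
               (λ i n eq → trans
                 (cong₂ (λ a h → a ℕ.+ (N₀ ℕ.+ m) ℕ.* (suc K₀ ℕ.* h))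
                   (target-holds χs {b} (λ q j → b-holds q (∈-++⁺ʳ (map initial (allFin d)) j)) eq)
                   (target-vanishes χs {H} (λ q j → H-vanishes q (∈-++⁺ʳ (map initial (allFin d)) j)) eq))
                 (limit-approximates K₀ N₀ m n 0)) ,
               (λ i → limit-approximates K₀ N₀ m (final χs b i) (final χs H i))

      cover-choices : ∀ χs → map item χs ≡ M → OutputCover (λ y → Trace (x-in , y) χs × OnTarget y)
      cover-choices χs eq = cover-⋃
          {S = λ p y → ∃ λ X → Traced χs x-in y X × Agrees (proj₁ p) (proj₂ p) X × OnTarget y} (elems (solutions χs))
          (λ {p} m → cover-solution χs eq p (good (solutions χs) m))
          λ y ((X , t , ok) , ot) →
            let p , m , ag = covers (solutions χs) X (ok , holds t ot) in p , m , X , t , ag , ot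
        where
          holds : ∀ {y X} → Traced χs x-in y X → OnTarget y → AllHold (system χs) X
          holds {X = X} t ot q m with ∈-++⁻ (map initial (allFin d)) m
          ... | inj₂ j = traced-equations t ot q j
          ... | inj₁ j with ∈-map⁻ initial j
          ... | i , _ , refl = trans (∑-amount X i) (cong +_ (traced-amount t i))

  cover-runs : ∀ M → Acc _≺_ M → OutputCover (Output M)
  cover-runs M (acc r) = cover-step M (λ lt → cover-runs _ (r lt))

  cover-reachable : OutputCover (λ y → (∃ λ u → Run V x-in u y) × OnTarget y)
  cover-reachable = cover-⊆ {P′ = Output [ comp whole ]}
    (λ { y ((u , r) , ot) → let ρ , w = run-whole r in by-comp w (done λ _ → refl) , ot })
    (cover-runs [ comp whole ] (≺-wellFounded _))

-- From the cover to a basis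

≤ω-trans : ∀ {x y z} → x ≤ω y → y ≤ω z → x ≤ω z
≤ω-trans (fin≤fin p) (fin≤fin q) = fin≤fin (ℕₚ.≤-trans p q)
≤ω-trans _           ≤ω-top      = ≤ω-top

fin-part : ℕω → ℕ
fin-part (fin n) = n
fin-part ω       = 0

-- Starts from 1 so as to lie strictly above every finite coordinate in the list.
finite-bound : ∀ {d} → List (Vecω d) → ℕ
finite-bound []      = 1
finite-bound (b ∷ B) = total (fin-part ∘ b) ℕ.+ finite-bound B

fin-part-< : ∀ {d} {B : List (Vecω d)} {b} → b ∈ B → ∀ i → fin-part (b i) < finite-bound B
fin-part-< {B = b ∷ B} (here refl) i = ℕₚ.≤-trans (s≤s (≤-total (fin-part ∘ b) i))
  (subst (_≤ finite-bound (b ∷ B)) (ℕₚ.+-comm (total (fin-part ∘ b)) 1) (ℕₚ.+-monoʳ-≤ (total (fin-part ∘ b)) (positive B)))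
  where positive : ∀ B → 1 ≤ finite-bound B
        positive []      = ℕₚ.≤-refl
        positive (b ∷ B) = ℕₚ.≤-trans (positive B) (ℕₚ.m≤n+m _ _)
fin-part-< {B = b ∷ B} (there m)   i = ℕₚ.≤-trans (fin-part-< m i) (ℕₚ.m≤n+m _ _)

truncate : ℕω → ℕ → ℕ
truncate (fin k) y = k ℕ.⊓ y
truncate ω       y = y

module Basis {d : ℕ} (V : VAS d) (f : Vecω d)
             (reachable : Limits.OutputCover V f (λ y → (∃ λ u → Run V (VAS.x-in V) u y) × Tokens.OnTarget V f y)) where

  open System V
  open Tokens V f

  basis : List (Vecω d)
  basis = elems reachable

  -- A single member of the sequence decides: far enough out it equals `x` at the finite coordinates
  -- and is at least `finite-bound basis` at the others. A basis element above it must have `ω` at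
  -- the latter, hence lies above `x`.
  lim⇒below : ∀ x → Lim (↓[ f ] (Post* V)) x → ↓ ⟦ basis ⟧ x
  lim⇒below x (s , s∈ , conv) = conclude (s∈ N)
    where
      m : ℕ
      m = finite-bound basis

      Close : ℕω → ℕω → Set
      Close (fin k) z = z ≡ fin k
      Close ω       z = ∃ λ k → z ≡ fin k × m ≤ k

      -- Vectors below reachable ones are finite, so a coordinate with limit `ω` cannot be
      -- eventually constant.
      no-ω : ∀ n i → ∃ λ k → s n i ≡ fin k
      no-ω n i with s∈ n
      ... | y , ((y′ , _ , refl) , _) , le with s n i | le i
      ... | fin k | _ = k , refl

      eventually : ∀ i → ∃ λ N → ∀ n → n ≥ N → Close (x i) (s n i)
      eventually i with x i | conv i
      ... | fin k | inj₁ (N , h)           = N , h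
      ... | ω     | inj₁ (N , h)           = N , λ n le → case trans (sym (proj₂ (no-ω n i))) (h n le) of λ ()
      ... | ω     | inj₂ (_ , grows , _)   =
        let N , h = grows m in N , λ n le → let k , e = no-ω n i in k , e , h n k le e

      N : ℕ
      N = total (proj₁ ∘ eventually)

      close : ∀ i → Close (x i) (s N i)
      close i = proj₂ (eventually i) N (≤-total (proj₁ ∘ eventually) i)

      raise : ∀ {b} → b ∈ basis → ∀ i {z} → Close (x i) z → z ≤ω b i → x i ≤ω b i
      raise {b} b∈ i c le with x i
      raise {b} b∈ i refl le | fin k = le
      raise {b} b∈ i (k , refl , big) le | ω with b i | le | fin-part-< b∈ i
      ... | ω     | _         | _  = ≤ω-top
      ... | fin n | fin≤fin q | lt = contradiction (ℕₚ.≤-trans big q) (ℕₚ.<⇒≱ lt)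

      fin-injective : ∀ {m n} → fin m ≡ fin n → m ≡ n
      fin-injective refl = refl

      conclude : ↓[ f ] (Post* V) (s N) → ↓ ⟦ basis ⟧ x
      conclude (y , ((y′ , (u , r) , refl) , on) , le) =
        let b , b∈ , y≤b = covers reachable y′ ((u , r) , λ i n e → fin-injective (on i n e))
        in b , b∈ , λ i → raise b∈ i (close i) (≤ω-trans (le i) (y≤b i))

  -- The reachable vectors approximating `b` are cut off at the finite coordinates of `x`, which
  -- keeps them in the downward closure and moves the limit from `b` to `x`.
  below⇒lim : ∀ x → ↓ ⟦ basis ⟧ x → Lim (↓[ f ] (Post* V)) x
  below⇒lim x (b , b∈ , x≤b) = s , s∈ , conv
    where
      y : ℕ → Vecℕ d
      y m = proj₁ (good reachable b∈ m)

      s : ℕ → Vecω d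
      s m i = fin (truncate (x i) (y m i))

      truncate-≤ : ∀ z n → truncate z n ≤ n
      truncate-≤ (fin k) n = ℕₚ.m⊓n≤n k n
      truncate-≤ ω       n = ℕₚ.≤-refl

      s∈ : ∀ m → ↓[ f ] (Post* V) (s m)
      s∈ m with good reachable b∈ m
      ... | z , (u , z′ , r , e) , on , _ =
        embed z′ , ((z′ , (u , r) , refl) , λ i n eq → cong fin (trans (e i) (on i n eq))) ,
        λ i → fin≤fin (subst (truncate (x i) (z i) ≤_) (sym (e i)) (truncate-≤ (x i) (z i)))

      conv : ConvergesToᵛ s x
      conv i with x i | b i | x≤b i | (λ m → proj₂ (proj₂ (proj₂ (good reachable b∈ m))) i)
      ... | fin k | fin n | fin≤fin le | h = inj₁ (0 , λ m _ → cong fin (ℕₚ.m≤n⇒m⊓n≡m (subst (k ≤_) (sym (h m)) le)))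
      -- The coordinate of `y m` is at least `m`, so the cut at `k` is exact from index `k` on.
      ... | fin k | ω     | _          | h = inj₁ (k , λ m le → cong fin (ℕₚ.m≤n⇒m⊓n≡m (ℕₚ.≤-trans le (h m))))
      ... | ω     | ω     | _          | h = inj₂ ((λ N → N , ℕₚ.≤-refl , _ , refl) ,
                                                   (λ m → m , λ { n k le refl → ℕₚ.≤-trans le (h n) }) , refl)

theorem5p2 : ∀ {d : ℕ} (V : VAS d) (f : Vecω d) →
    Σ (List (Vecω d)) λ B → IsBasis B (↓[ f ] (Post* V))
theorem5p2 V f = basis , λ x → lim⇒below x , below⇒lim x
  where open Basis V f (Limits.cover-reachable V f)
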